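{- Let $\alpha\in(0,1)$ be a fixed constant. Choose any integer $p\ge2$ and any functions $\Delta_{\mathrm{out}}(n)\in\Omega(1)\cap O(n)$ and $m(n)\in\Omega(n)\cap O\big(n\Delta_{\mathrm{out}}(n)\big)$. Consider any (randomized) algorithm $\mathcal{B}(t)$ that with probability at least $1/p$ estimates $\pi(t)$ within a multiplicative factor of $O(1)$, where $\mathcal{B}$ can only query the graph oracle to access unseen nodes and edges in the underlying graph. Then, for every sufficiently large $n$, there exists a graph $H$ such that: (i) $H$ contains $\Theta(n)$ nodes and $\Theta(m)$ edges, and its maximum out-degree is $\Theta(\Delta_{\mathrm{out}})$; (ii) $H$ contains a node $t$ such that $\mathcal{B}(t)$ requires $$\Omega\left(n^{1/2}\cdot\min\left(\Delta_{\mathrm{out}}^{1/2},m^{1/4}\right)\right)$$ queries in expectation.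
   Context: Graphs are directed, and every node has nonzero out-degree (self-loops allowed). If $(u,v)$ is an edge then $u$ is a parent of $v$ and $v$ is a child of $u$. PageRank: the decay factor $\alpha\in(0,1)$ is a fixed constant (asymptotic constants may depend on it). In a graph with node set $V$, an $\alpha$-discounted random walk starts at its source node, moves to a uniformly random child of the current node at each step, and has random length equal to $\ell$ with probability $\alpha(1-\alpha)^{\ell}$ for each $\ell\ge 0$. The PageRank score $\pi(t)$ is the probability that an $\alpha$-discounted random walk from a uniformly random source node in $V$ terminates at $t$. Model (arc-centric graph-access model): the algorithm, given the target node $t$, interacts with the underlying graph only through an oracle supporting the queries $\mathrm{INDEG}(v)$ (returns the in-degree of $v$), $\mathrm{OUTDEG}(v)$ (returns the out-degree of $v$), $\mathrm{PARENT}(v,i)$ (returns the $i$-th parent of $v$), $\mathrm{CHILD}(v,i)$ (returns the $i$-th child of $v$), and $\mathrm{JUMP}()$ (returns a node chosen uniformly at random). All of these queries are allowed. Queries are counted by the number of oracle invocations. -}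

module Defs where

open import Algebra.Bundles using (CommutativeRing; Semiring)
open import Algebra.Structures using (IsCommutativeRing)
import Algebra.Construct.NaturalChoice.Min as Min
import Algebra.Definitions.RawSemiring as RawSemiringDefs
open import Data.Bool.Base using (Bool; if_then_else_)
open import Data.Fin.Base using (Fin; zero; suc; toℕ)
import Data.Fin.Properties as Fin
open import Data.List.Base using (List; []; foldr; length; map; allFin; head; drop)
open import Data.List.Extrema.Nat using (max)
open import Data.List.Membership.Propositional using (_∈_)
open import Data.List.Relation.Unary.Unique.Propositional using (Unique)
open import Data.Maybe.Base using (Maybe; just; nothing)
open import Data.Nat.Base as ℕ using (ℕ; zero; suc)
open import Data.Nat.ListAction using () renaming (sum to sumℕ)
open import Data.Product.Base using (∃; _×_; _,_)
open import Data.Vec.Base using (Vec; []; _∷_; lookup)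
open import Function.Bundles using (_⇔_)
open import Level using (0ℓ)
open import Relation.Binary.Bundles using (DecTotalOrder)
open import Relation.Binary.Core using (Rel)
open import Relation.Binary.PropositionalEquality.Core using (_≡_; _≢_)
open import Relation.Binary.Structures using (IsDecTotalOrder)
import Relation.Binary.Construct.NonStrictToStrict as ToStrict
open import Relation.Nullary.Decidable.Core using (⌊_⌋; _×-dec_)
open import Relation.Unary using (Pred)

-- The library has no real numbers, so they enter through their categorical
-- axiomatisation: a complete ordered field, understood classically (the order
-- is decidable, and suprema are approximated by explicit elements).  The
-- values of _⁻¹ at 0 and of sup at empty or unbounded predicates are
-- unspecified.

record Reals : Set₁ where
  infix  8 _⁻¹
  infixl 7 _*_
  infixl 6 _+_ _-_
  infix  4 _≤_
  field
    ℝ                 : Set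
    _+_ _*_           : ℝ → ℝ → ℝ
    -_                : ℝ → ℝ
    0# 1#             : ℝ
    _⁻¹               : ℝ → ℝ
    _≤_               : Rel ℝ 0ℓ
    isCommutativeRing : IsCommutativeRing _≡_ _+_ _*_ -_ 0# 1#
    0≢1               : 0# ≢ 1#
    *-inverseʳ        : ∀ {x} → x ≢ 0# → x * x ⁻¹ ≡ 1#
    isDecTotalOrder   : IsDecTotalOrder _≡_ _≤_
    +-monoˡ-≤         : ∀ {x y} z → x ≤ y → x + z ≤ y + z
    *-nonneg          : ∀ {x y} → 0# ≤ x → 0# ≤ y → 0# ≤ x * y

  open ToStrict _≡_ _≤_ public using (_<_)

  UpperBound : Pred ℝ 0ℓ → ℝ → Set
  UpperBound S b = ∀ {x} → S x → x ≤ b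

  field
    sup               : Pred ℝ 0ℓ → ℝ
    sup-upper         : ∀ {S} → ∃ (UpperBound S) → UpperBound S (sup S)
    sup-approx        : ∀ {S} → ∃ (UpperBound S) → ∃ S →
                        ∀ {y} → y < sup S → ∃ λ x → S x × y < x

  commutativeRing : CommutativeRing 0ℓ 0ℓ
  commutativeRing = record { isCommutativeRing = isCommutativeRing }

  decTotalOrder : DecTotalOrder 0ℓ 0ℓ 0ℓ
  decTotalOrder = record { isDecTotalOrder = isDecTotalOrder }

  open RawSemiringDefs (Semiring.rawSemiring (CommutativeRing.semiring commutativeRing)) public
    using (_^_) renaming (_×_ to _·_)
  open IsDecTotalOrder isDecTotalOrder public using (_≤?_)
  open Min (DecTotalOrder.totalOrder decTotalOrder) public using (_⊓_)

  _-_ : ℝ → ℝ → ℝ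
  x - y = x + (- y)

  fromℕ : ℕ → ℝ
  fromℕ n = n · 1#

  -- The square root of a nonnegative x.
  √ : ℝ → ℝ
  √ x = sup (λ y → y * y ≤ x)

  ∑< : ℕ → (ℕ → ℝ) → ℝ
  ∑< zero    f = 0#
  ∑< (suc k) f = ∑< k f + f k

  -- The sum of a convergent series with nonnegative terms.
  ∑∞ : (ℕ → ℝ) → ℝ
  ∑∞ f = sup (λ y → ∃ λ k → y ≡ ∑< k f)

  -- b is at most the supremum of f in (-∞,∞].
  infix 4 _≤⋁_
  _≤⋁_ : ℝ → (ℕ → ℝ) → Set
  b ≤⋁ f = ∀ {y} → y < b → ∃ λ k → y < f k

  -- The mean of f over a uniformly random entry of a nonempty list.
  mean : {A : Set} → List A → (A → ℝ) → ℝ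
  mean xs f = foldr (λ x s → f x + s) 0# xs * fromℕ (length xs) ⁻¹

  infix 4 _∈O_ _∈Ω_
  _∈O_ _∈Ω_ : (ℕ → ℝ) → (ℕ → ℝ) → Set
  f ∈O g = ∃ λ c → 0# < c × ∃ λ n₀ → ∀ n → n₀ ℕ.≤ n → f n ≤ c * g n
  f ∈Ω g = ∃ λ c → 0# < c × ∃ λ n₀ → ∀ n → n₀ ℕ.≤ n → c * g n ≤ f n

-- A finite simple digraph (self-loops allowed) with its adjacency lists; their
-- order is what "the i-th parent" and "the i-th child" refer to.

record Graph : Set where
  field
    size            : ℕ
  Node : Set
  Node = Fin size
  field
    children        : Node → List Node
    parents         : Node → List Node
    children-unique : ∀ u → Unique (children u)
    parents-unique  : ∀ v → Unique (parents v)
    parent⇔child    : ∀ u v → u ∈ parents v ⇔ v ∈ children u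
    no-sinks        : ∀ u → children u ≢ []

  nodes : List Node
  nodes = allFin size

  outdeg indeg : Node → ℕ
  outdeg u = length (children u)
  indeg  v = length (parents v)

  edges : ℕ
  edges = sumℕ (map outdeg nodes)

  maxOutdeg : ℕ
  maxOutdeg = max 0 (map outdeg nodes)

module _ (𝓡 : Reals) where
  open Reals 𝓡

  module _ (G : Graph) where
    open Graph G

    -- The probability that a walk of exactly ℓ steps from s ends at t.
    walk : ℕ → Node → Node → ℝ
    walk zero    s t = if ⌊ s Fin.≟ t ⌋ then 1# else 0#
    walk (suc ℓ) s t = mean (children s) (λ u → walk ℓ u t)

    pageRank : ℝ → Node → ℝ
    pageRank α t = mean nodes (λ s → ∑∞ (λ ℓ → α * (1# - α) ^ ℓ * walk ℓ s t))

  -- What an algorithm in a state of S k does next, k being the number of node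
  -- occurrences received so far (the target and every node returned by a
  -- query).  Only these can be queried: Fin k indexes them, the most recent
  -- being zero.  A newly received node is revealed through its identifier, a
  -- natural number.  Positions in adjacency lists count from 0, and the first
  -- continuation of parent and child is taken when the position is out of
  -- range.

  data Action (S : ℕ → Set) (k : ℕ) : Set where
    output : ℝ → Action S k
    toss   : (q : ℝ) → 0# ≤ q → q ≤ 1# → S k → S k → Action S k
    INDEG  : Fin k → (ℕ → S k) → Action S k
    OUTDEG : Fin k → (ℕ → S k) → Action S k
    PARENT : Fin k → ℕ → S k → (ℕ → S (suc k)) → Action S k
    CHILD  : Fin k → ℕ → S k → (ℕ → S (suc k)) → Action S k
    JUMP   : (ℕ → S (suc k)) → Action S k

  record Algorithm : Set₁ where
    field
      State : ℕ → Set
      start : ℕ → State 1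
      step  : ∀ {k} → State k → Action State k

  module _ (B : Algorithm) (G : Graph) where
    open Algorithm B
    open Graph G

    -- The expectation, over coin tosses and jumps, of fee times the number of
    -- queries plus the reward of the output (0 if there is none), for the run
    -- cut off after the given number of actions.
    module _ (fee : ℝ) (reward : ℝ → ℝ) where
      payoff  : ℕ → ∀ {k} → Vec Node k → State k → ℝ
      perform : ℕ → ∀ {k} → Vec Node k → Action State k → ℝ
      receive : ℕ → ∀ {k} → Vec Node k → State k → (ℕ → State (suc k)) → Maybe Node → ℝ

      payoff zero    vs s = 0#
      payoff (suc j) vs s = perform j vs (step s)

      perform j vs (output x)         = reward x
      perform j vs (toss q _ _ s₁ s₂) = q * payoff j vs s₁ + (1# - q) * payoff j vs s₂
      perform j vs (INDEG i f)        = fee + payoff j vs (f (indeg (lookup vs i)))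
      perform j vs (OUTDEG i f)       = fee + payoff j vs (f (outdeg (lookup vs i)))
      perform j vs (PARENT i a s f)   = fee + receive j vs s f (head (drop a (parents (lookup vs i))))
      perform j vs (CHILD i a s f)    = fee + receive j vs s f (head (drop a (children (lookup vs i))))
      perform j vs (JUMP f)           = fee + mean nodes (λ v → payoff j (v ∷ vs) (f (toℕ v)))

      receive j vs s f nothing  = payoff j vs s
      receive j vs s f (just v) = payoff j (v ∷ vs) (f (toℕ v))

    -- Both sequences are nondecreasing in the cut-off; their suprema are the
    -- probability of an output in E and the (possibly infinite) expected
    -- number of queries.
    outputProbability : Node → (ℝ → Bool) → ℕ → ℝ
    outputProbability t E j =
      payoff 0# (λ x → if E x then 1# else 0#) j (t ∷ []) (start (toℕ t))

    expectedQueries : Node → ℕ → ℝ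
    expectedQueries t j = payoff 1# (λ _ → 0#) j (t ∷ []) (start (toℕ t))

  -- On every graph and target, B outputs an estimate of the PageRank score
  -- within a factor γ with probability at least δ.
  Estimates : ℝ → ℝ → ℝ → Algorithm → Set
  Estimates α γ δ B = ∀ G t → δ ≤⋁ outputProbability B G t (accurate G t)
    where
    accurate : ∀ G → Graph.Node G → ℝ → Bool
    accurate G t x = ⌊ (π ≤? γ * x) ×-dec (x ≤? γ * π) ⌋
      where
      π : ℝ
      π = pageRank G α t

-- The hard graph does not depend on the algorithm.  Besides a small part through
-- which walks reach the target t, it contains hubs of out-degree d ≈ min(Δ, √m)
-- on 4p levels, those of level i having about Γ ^ i √(nd) private parents.
-- Swapping an edge of a hub with an edge near t, at unchanged positions in the
-- adjacency lists, makes the hub dominate π(t), and Γ is so large that π(t) then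
-- differs by a factor above γ² between levels.  Each level offers L ≈ √(nd) such
-- swaps, indexed by slots, and a single query can meet the edges of only one slot.
-- Run the algorithm on the unswapped graph.  For each slot, an output is accurate on
-- at most one level, and a query spoils at most one variant per level, so the success
-- probabilities of all 4pL variants sum to at most L + 4p E[queries].  Each of them
-- being at least 1/(2p), the expected number of queries is at least L/(4p).
module Submission where

open import Algebra.Bundles using (CommutativeRing)
import Algebra.Construct.NaturalChoice.Min as Min
import Algebra.Construct.NaturalChoice.MinOp as MinOp
import Algebra.Properties.Ring as RingProperties
import Algebra.Solver.Ring.NaturalCoefficients.Default as SemiringSolver
open import Data.Bool.Base using (if_then_else_)
open import Data.Empty using (⊥-elim)
open import Data.Fin.Base as Fin using (Fin; zero; suc; toℕ)
import Data.Fin.Properties as Fin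
open import Data.List.Base as List using (List; []; _∷_; _++_; foldr; length; map; allFin; head; drop; filter; cartesianProduct)
open import Data.List.Extrema.Nat using (max≤v⁺; xs≤max)
import Data.List.Membership.DecPropositional as DecMembership
open import Data.List.Membership.Propositional using (_∈_; _∉_)
open import Data.List.Membership.Propositional.Properties
  using (∈-allFin; ∈-lookup; ∈-map⁺; ∈-map⁻; ∈-++⁺ˡ; ∈-++⁺ʳ; ∈-++⁻; ∈-filter⁺; ∈-filter⁻)
import Data.List.Properties as List
open import Data.List.Relation.Unary.All as All using (All; []; _∷_)
import Data.List.Relation.Unary.All.Properties as All
open import Data.List.Relation.Unary.AllPairs using ([]; _∷_)
open import Data.List.Relation.Unary.Any as Any using (here; there)
import Data.List.Relation.Unary.Any.Properties as Any
open import Data.List.Relation.Unary.Unique.Propositional using (Unique)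
import Data.List.Relation.Unary.Unique.Propositional.Properties as Unique
open import Data.Maybe.Base as Maybe using (Maybe; just; nothing; _>>=_)
import Data.Maybe.Properties as Maybe
open import Data.Nat.Base as ℕ using (ℕ; zero; suc; z≤n; s≤s)
open import Data.Nat.ListAction using () renaming (sum to sumℕ)
import Data.Nat.Properties as ℕ
open import Data.Product.Base using (Σ; ∃; ∃₂; _×_; _,_; proj₁; proj₂)
import Data.Product.Properties as Product
open import Data.Sum.Base using (_⊎_; inj₁; inj₂)
open import Data.Unit.Base using (⊤; tt)
open import Data.Vec.Base using (Vec; []; _∷_; lookup)
open import Defs
open import Function.Base using (_∘_; id)
open import Function.Bundles using (_⇔_; mk⇔; mk↣; Equivalence)
open import Relation.Binary.Bundles using (DecTotalOrder)
import Relation.Binary.Construct.NonStrictToStrict as ToStrict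
open import Relation.Binary.Definitions using (DecidableEquality; Tri; tri<; tri≈; tri>)
open import Relation.Binary.PropositionalEquality
  using (_≡_; _≢_; refl; sym; trans; cong; cong₂; subst; subst₂; module ≡-Reasoning)
import Relation.Binary.Reasoning.PartialOrder as PosetReasoning
open import Relation.Nullary using (¬_; Dec; yes; no; contradiction)
open import Relation.Nullary.Decidable using (⌊_⌋; _×-dec_; via-injection)

-- Digraphs on finite types

-- Where √(nd) comes from: with S hubs per level, the swapped hub contributes about 1/d per leaf to
-- n π(t), while the vertices near t contribute about S in any case. So a hub needs about S d
-- leaves, a level has S² d of them, and S ≈ √(n/d) is the most that n nodes allow. This gives S d ≈
-- √(nd) slots. Where d ≤ √m comes from: each slot needs an edge near t of its own, and only S
-- vertices may point straight at t without outweighing the hub. If d > S, this takes d sources, and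
-- each must be diluted by d further children, or together they would contribute d instead of S.
-- That costs d² edges. Why there are levels: with success probability only 1/p, an algorithm may
-- fail on a single variant, or on the unswapped graph, without contradiction. The variants of one
-- slot on 4p levels need total success 4p · 1/(2p) = 2, whereas one output supplies at most 1. The
-- missing 1 per slot must come from queries.

record Digraph (V : Set) : Set where
  field
    children        : V → List V
    parents         : V → List V
    children-unique : ∀ u → Unique (children u)
    parents-unique  : ∀ v → Unique (parents v)
    parent⇔child    : ∀ u v → u ∈ parents v ⇔ v ∈ children u
    no-sinks        : ∀ u → children u ≢ []

toGraph : ∀ {n} → Digraph (Fin n) → Graph
toGraph {n} G = record { size = n ; Digraph G }

record Finite (A : Set) : Set where
  field
    elements : List A
    unique   : Unique elements
    complete : ∀ x → x ∈ elements

  size : ℕ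
  size = length elements

  to : A → Fin size
  to x = Any.index (complete x)

  from : Fin size → A
  from = List.lookup elements

  from-to : ∀ x → from (to x) ≡ x
  from-to x = sym (Any.lookup-index (complete x))

  from-injective : ∀ {i j} → from i ≡ from j → i ≡ j
  from-injective = go unique
    where
    go : ∀ {xs : List A} → Unique xs → ∀ {i j} → List.lookup xs i ≡ List.lookup xs j → i ≡ j
    go (_ ∷ _)  {zero}  {zero}  e = refl
    go (x∉ ∷ _) {zero}  {suc j} e = contradiction e (All.lookup x∉ (∈-lookup j))
    go (x∉ ∷ _) {suc i} {zero}  e = contradiction (sym e) (All.lookup x∉ (∈-lookup i))
    go (_ ∷ u)  {suc i} {suc j} e = cong suc (go u e)

  to-from : ∀ i → to (from i) ≡ i
  to-from i = from-injective (from-to (from i))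

  to-injective : ∀ {x y} → to x ≡ to y → x ≡ y
  to-injective {x} {y} e = trans (sym (from-to x)) (trans (cong from e) (from-to y))

  map-from-allFin : map from (allFin size) ≡ elements
  map-from-allFin = trans (List.map-tabulate id from) (List.tabulate-lookup elements)

  infix 4 _≟_
  _≟_ : DecidableEquality A
  _≟_ = via-injection (mk↣ to-injective) Fin._≟_

private module ⇔ = Equivalence

⊤-finite : Finite ⊤
⊤-finite = record { elements = tt ∷ [] ; unique = [] ∷ [] ; complete = λ _ → here refl }

Fin-finite : ∀ n → Finite (Fin n)
Fin-finite n = record { elements = allFin n ; unique = Unique.allFin⁺ n ; complete = ∈-allFin }

infixr 1 _⊎-finite_
_⊎-finite_ : ∀ {A B} → Finite A → Finite B → Finite (A ⊎ B)
F ⊎-finite G = record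
  { elements = map inj₁ (Finite.elements F) ++ map inj₂ (Finite.elements G)
  ; unique   = Unique.++⁺ (Unique.map⁺ (λ { refl → refl }) (Finite.unique F)) (Unique.map⁺ (λ { refl → refl }) (Finite.unique G))
                 λ (p , q) → inj₁≢inj₂ (∈-map⁻ inj₁ p) (∈-map⁻ inj₂ q)
  ; complete = λ { (inj₁ x) → ∈-++⁺ˡ (∈-map⁺ inj₁ (Finite.complete F x))
                 ; (inj₂ y) → ∈-++⁺ʳ (map inj₁ (Finite.elements F)) (∈-map⁺ inj₂ (Finite.complete G y)) }
  }
  where
  inj₁≢inj₂ : ∀ {z} → (∃ λ x → x ∈ Finite.elements F × z ≡ inj₁ x) → ¬ (∃ λ y → y ∈ Finite.elements G × z ≡ inj₂ y)
  inj₁≢inj₂ (_ , _ , refl) (_ , _ , ())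

size-⊎ : ∀ {A B} (F : Finite A) (G : Finite B) → Finite.size (F ⊎-finite G) ≡ Finite.size F ℕ.+ Finite.size G
size-⊎ F G = trans (List.length-++ (map inj₁ (Finite.elements F)))
  (cong₂ ℕ._+_ (List.length-map inj₁ (Finite.elements F)) (List.length-map inj₂ (Finite.elements G)))

dependentProduct : ∀ {A : Set} {B : A → Set} → List A → (∀ x → List (B x)) → List (Σ A B)
dependentProduct []       ys = []
dependentProduct (x ∷ xs) ys = map (x ,_) (ys x) ++ dependentProduct xs ys

∈-dependentProduct⁺ : ∀ {A : Set} {B : A → Set} {xs : List A} (ys : ∀ x → List (B x)) {x y} →
                      x ∈ xs → y ∈ ys x → (x , y) ∈ dependentProduct xs ys
∈-dependentProduct⁺ ys         (here refl) y∈ = ∈-++⁺ˡ (∈-map⁺ _ y∈)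
∈-dependentProduct⁺ ys {x = _} (there x∈)  y∈ = ∈-++⁺ʳ (map _ (ys _)) (∈-dependentProduct⁺ ys x∈ y∈)

∈-dependentProduct⁻ : ∀ {A : Set} {B : A → Set} (xs : List A) (ys : ∀ x → List (B x)) {z} →
                      z ∈ dependentProduct xs ys → proj₁ z ∈ xs
∈-dependentProduct⁻ (x ∷ xs) ys z∈ with ∈-++⁻ (map (x ,_) (ys x)) z∈
... | inj₂ q = there (∈-dependentProduct⁻ xs ys q)
... | inj₁ q with ∈-map⁻ _ q
...   | _ , _ , refl = here refl

dependentProduct⁺ : ∀ {A : Set} {B : A → Set} {xs : List A} {ys : ∀ x → List (B x)} →
                    Unique xs → (∀ x → Unique (ys x)) → Unique (dependentProduct xs ys)
dependentProduct⁺ {xs = []}          []       uy = []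
dependentProduct⁺ {xs = x ∷ xs} {ys} (x∉ ∷ ux) uy =
  Unique.++⁺ (Unique.map⁺ (λ { refl → refl }) (uy x)) (dependentProduct⁺ ux uy) disjoint
  where
  disjoint : ∀ {z} → ¬ (z ∈ map (x ,_) (ys x) × z ∈ dependentProduct xs ys)
  disjoint (p , q) with ∈-map⁻ _ p
  ... | _ , _ , refl = All.lookup x∉ (∈-dependentProduct⁻ xs ys q) refl

Σ-finite : ∀ {A : Set} {B : A → Set} → Finite A → (∀ x → Finite (B x)) → Finite (Σ A B)
Σ-finite F G = record
  { elements = dependentProduct (Finite.elements F) (λ x → Finite.elements (G x))
  ; unique   = dependentProduct⁺ (Finite.unique F) (λ x → Finite.unique (G x))
  ; complete = λ (x , y) → ∈-dependentProduct⁺ _ (Finite.complete F x) (Finite.complete (G x) y)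
  }

length-cartesianProduct : ∀ {A B : Set} (xs : List A) (ys : List B) →
                          length (cartesianProduct xs ys) ≡ length xs ℕ.* length ys
length-cartesianProduct []       ys = refl
length-cartesianProduct (x ∷ xs) ys = trans (List.length-++ (List.map (x ,_) ys))
  (cong₂ ℕ._+_ (List.length-map (x ,_) ys) (length-cartesianProduct xs ys))

head-drop-map : ∀ {A B : Set} (f : A → B) a xs → head (drop a (map f xs)) ≡ Maybe.map f (head (drop a xs))
head-drop-map f a xs = trans (cong head (List.drop-map a xs)) (List.head-map (drop a xs))

map≢[] : ∀ {A B : Set} {f : A → B} {xs} → xs ≢ [] → map f xs ≢ []
map≢[] {xs = []}    ne = λ _ → ne refl
map≢[] {xs = _ ∷ _} ne = λ ()

module _ {V : Set} (F : Finite V) where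
  open Finite F using (to; from; from-to; to-from; to-injective; _≟_)
  open DecMembership _≟_ using (_∈?_)

  -- Only the unswapped graph is built this way. Recomputing the parents of a swapped graph by
  -- filtering could move entries within the parent lists, and `PARENT` queries would notice that;
  -- the variants therefore come from `swap`.
  fromChildren : (children : V → List V) → (∀ u → Unique (children u)) → (∀ u → children u ≢ []) → Digraph V
  fromChildren children uniq nonempty = record
    { children        = children
    ; parents         = λ v → filter (λ u → v ∈? children u) (Finite.elements F)
    ; children-unique = uniq
    ; parents-unique  = λ v → Unique.filter⁺ (λ u → v ∈? children u) (Finite.unique F)
    ; parent⇔child    = λ u v → mk⇔ (proj₂ ∘ ∈-filter⁻ (λ u → v ∈? children u) {xs = Finite.elements F})
                                     (∈-filter⁺ (λ u → v ∈? children u) (Finite.complete F u))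
    ; no-sinks        = nonempty
    }

  ∈-map-to : ∀ {x i xs} → x ≡ from i → i ∈ map to xs ⇔ x ∈ xs
  ∈-map-to {i = i} {xs} refl = mk⇔ fwd (λ p → subst (_∈ map to xs) (to-from i) (∈-map⁺ to p))
    where
    fwd : i ∈ map to xs → from i ∈ xs
    fwd p with ∈-map⁻ to p
    ... | y , y∈ , refl = subst (_∈ xs) (sym (from-to y)) y∈

  -- The numbering depends on `F` alone. Graphs on the same vertex type thus give each vertex the
  -- same identifier, so identifiers never tell a variant from the base graph.
  relabel : Digraph V → Digraph (Fin (Finite.size F))
  relabel G = record
    { children        = λ u → map to (children (from u))
    ; parents         = λ v → map to (parents (from v))
    ; children-unique = λ u → Unique.map⁺ to-injective (children-unique (from u))
    ; parents-unique  = λ v → Unique.map⁺ to-injective (parents-unique (from v))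
    ; parent⇔child    = λ u v →
        let p = ∈-map-to {i = u} {parents (from v)} refl
            q = ∈-map-to {i = v} {children (from u)} refl
            r = parent⇔child (from u) (from v)
        in mk⇔ (⇔.from q ∘ ⇔.to r ∘ ⇔.to p) (⇔.from p ∘ ⇔.from r ∘ ⇔.to q)
    ; no-sinks        = λ u → map≢[] (no-sinks (from u))
    }
    where
    open Digraph G

-- Swapping two edges of a digraph

module Transposition {V : Set} (_≟_ : DecidableEquality V) where

  transpose : V → V → V → V
  transpose a b x with x ≟ a | x ≟ b
  ... | yes _ | _     = b
  ... | no _  | yes _ = a
  ... | no _  | no _  = x

  transpose-left : ∀ a b → transpose a b a ≡ b
  transpose-left a b with a ≟ a
  ... | yes _ = refl
  ... | no ¬p = contradiction refl ¬p

  transpose-right : ∀ a b → transpose a b b ≡ a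
  transpose-right a b with b ≟ a | b ≟ b
  ... | yes e | _     = e
  ... | no _  | yes _ = refl
  ... | no _  | no ¬p = contradiction refl ¬p

  transpose-other : ∀ {a b x} → x ≢ a → x ≢ b → transpose a b x ≡ x
  transpose-other {a} {b} {x} x≢a x≢b with x ≟ a | x ≟ b
  ... | yes e | _     = contradiction e x≢a
  ... | no _  | yes e = contradiction e x≢b
  ... | no _  | no _  = refl

  transpose-involutive : ∀ a b x → transpose a b (transpose a b x) ≡ x
  transpose-involutive a b x with x ≟ a | x ≟ b
  ... | yes refl | _        = transpose-right a b
  ... | no _     | yes refl = transpose-left a b
  ... | no x≢a   | no x≢b   = transpose-other x≢a x≢b

  transpose-injective : ∀ a b {x y} → transpose a b x ≡ transpose a b y → x ≡ y
  transpose-injective a b {x} {y} e =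
    trans (sym (transpose-involutive a b x)) (trans (cong (transpose a b) e) (transpose-involutive a b y))

  ∈-map-transpose : ∀ a b {x xs} → x ∈ map (transpose a b) xs ⇔ transpose a b x ∈ xs
  ∈-map-transpose a b {x} {xs} = mk⇔ fwd
    λ p → subst (_∈ map (transpose a b) xs) (transpose-involutive a b x) (∈-map⁺ (transpose a b) p)
    where
    fwd : x ∈ map (transpose a b) xs → transpose a b x ∈ xs
    fwd p with ∈-map⁻ (transpose a b) p
    ... | y , y∈ , refl = subst (_∈ xs) (sym (transpose-involutive a b y)) y∈

  -- Renaming by a transposition, rather than overwriting one entry, keeps lists duplicate-free and
  -- lengths fixed by injectivity alone. When p is not joined to b nor q to a, just one entry in
  -- each of the two lists changes.
  switch : V → V → V → V → (V → List V) → V → List V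
  switch p q a b lists u with u ≟ p | u ≟ q
  ... | no _ | no _ = lists u
  ... | _    | _    = map (transpose a b) (lists u)

  switch-elim : ∀ p q a b lists u →
    (u ≢ p × u ≢ q × switch p q a b lists u ≡ lists u) ⊎
    ((u ≡ p ⊎ u ≡ q) × switch p q a b lists u ≡ map (transpose a b) (lists u))
  switch-elim p q a b lists u with u ≟ p | u ≟ q
  ... | no u≢p | no u≢q = inj₁ (u≢p , u≢q , refl)
  ... | yes e  | yes _  = inj₂ (inj₁ e , refl)
  ... | yes e  | no _   = inj₂ (inj₁ e , refl)
  ... | no _   | yes e  = inj₂ (inj₂ e , refl)

  switch-unique : ∀ p q a b lists → (∀ u → Unique (lists u)) → ∀ u → Unique (switch p q a b lists u)
  switch-unique p q a b lists uniq u with switch-elim p q a b lists u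
  ... | inj₁ (_ , _ , e) = subst Unique (sym e) (uniq u)
  ... | inj₂ (_ , e)     = subst Unique (sym e) (Unique.map⁺ (transpose-injective a b) (uniq u))

  switch-length : ∀ p q a b lists u → length (switch p q a b lists u) ≡ length (lists u)
  switch-length p q a b lists u with switch-elim p q a b lists u
  ... | inj₁ (_ , _ , e) = cong length e
  ... | inj₂ (_ , e)     = trans (cong length e) (List.length-map _ (lists u))

  -- The membership `v ∈ lists u` is recorded so that `swap-child` and `swap-parent` can discard the
  -- crossed pairs, p with b and q with a, which are no edges.
  switch-head-drop : ∀ p q a b lists u i →
    head (drop i (switch p q a b lists u)) ≡ head (drop i (lists u)) ⊎
    (u ≡ p ⊎ u ≡ q) × ∃ λ v → head (drop i (lists u)) ≡ just v × v ∈ lists u × (v ≡ a ⊎ v ≡ b)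
  switch-head-drop p q a b lists u i with switch-elim p q a b lists u
  ... | inj₁ (_ , _ , e)  = inj₁ (cong (λ l → head (drop i l)) e)
  ... | inj₂ (u=pq , e) with position i (lists u)
    where
    position : ∀ i xs → head (drop i (map (transpose a b) xs)) ≡ head (drop i xs) ⊎
               ∃ λ v → head (drop i xs) ≡ just v × v ∈ xs × (v ≡ a ⊎ v ≡ b)
    position zero    []       = inj₁ refl
    position (suc i) []       = inj₁ refl
    position zero    (x ∷ xs) with x ≟ a | x ≟ b
    ... | yes x≡a | _       = inj₂ (x , refl , here refl , inj₁ x≡a)
    ... | no _    | yes x≡b = inj₂ (x , refl , here refl , inj₂ x≡b)
    ... | no x≢a  | no x≢b  = inj₁ refl
    position (suc i) (x ∷ xs) with position i xs
    ... | inj₁ e                 = inj₁ e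
    ... | inj₂ (v , e , v∈ , ab) = inj₂ (v , e , there v∈ , ab)
  ...   | inj₁ e′ = inj₁ (trans (cong (λ l → head (drop i l)) e) e′)
  ...   | inj₂ r  = inj₂ (u=pq , r)

  -- The edges p→a and q→b become p→b and q→a.  Every other entry keeps its
  -- position, so only queries that meet one of the two edges notice the swap.
  module Swap (G : Digraph V) {p q a b : V} where
    open Digraph G

    module _ (p→a : a ∈ children p) (q→b : b ∈ children q) (p↛b : b ∉ children p) (q↛a : a ∉ children q) where
      open Equivalence

      private
        children′ = switch p q a b children
        parents′  = switch a b p q parents

        edge : ∀ u v → Set
        edge u v = v ∈ children u

        parent⇔child′ : ∀ u v → u ∈ parents′ v ⇔ v ∈ children′ u
        parent⇔child′ u v with switch-elim p q a b children u | switch-elim a b p q parents v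
        ... | inj₁ (_ , _ , e)     | inj₁ (_ , _ , e′) rewrite e | e′ = parent⇔child u v
        ... | inj₁ (u≢p , u≢q , e) | inj₂ (_ , e′)     rewrite e | e′ =
          mk⇔ (λ m → to (parent⇔child u v) (subst (_∈ parents v) (transpose-other u≢p u≢q) (to (∈-map-transpose p q) m)))
              (λ m → from (∈-map-transpose p q) (subst (_∈ parents v) (sym (transpose-other u≢p u≢q)) (from (parent⇔child u v) m)))
        ... | inj₂ (_ , e)         | inj₁ (v≢a , v≢b , e′) rewrite e | e′ =
          mk⇔ (λ m → from (∈-map-transpose a b) (subst (_∈ children u) (sym (transpose-other v≢a v≢b)) (to (parent⇔child u v) m)))
              (λ m → from (parent⇔child u v) (subst (_∈ children u) (transpose-other v≢a v≢b) (to (∈-map-transpose a b) m)))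
        ... | inj₂ (u=pq , e)      | inj₂ (v=ab , e′) rewrite e | e′ =
          mk⇔ (λ m → from (∈-map-transpose a b) (to (crossed u=pq v=ab) (to (parent⇔child _ v) (to (∈-map-transpose p q) m))))
              (λ m → from (∈-map-transpose p q) (from (parent⇔child _ v) (from (crossed u=pq v=ab) (to (∈-map-transpose a b) m))))
          where
          -- On the four pairs between {p, q} and {a, b}, the edges are exactly p→a and q→b. This
          -- pattern is symmetric, so exchanging the tails has the same effect as exchanging the
          -- heads; children renamed by a, b and parents renamed by p, q therefore describe one
          -- graph.
          crossed : ∀ {u v} → u ≡ p ⊎ u ≡ q → v ≡ a ⊎ v ≡ b →
                    edge (transpose p q u) v ⇔ edge u (transpose a b v)
          crossed (inj₁ refl) (inj₁ refl) rewrite transpose-left p q | transpose-left a b =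
            mk⇔ (⊥-elim ∘ q↛a) (⊥-elim ∘ p↛b)
          crossed (inj₁ refl) (inj₂ refl) rewrite transpose-left p q | transpose-right a b =
            mk⇔ (λ _ → p→a) (λ _ → q→b)
          crossed (inj₂ refl) (inj₁ refl) rewrite transpose-right p q | transpose-left a b =
            mk⇔ (λ _ → q→b) (λ _ → p→a)
          crossed (inj₂ refl) (inj₂ refl) rewrite transpose-right p q | transpose-right a b =
            mk⇔ (⊥-elim ∘ p↛b) (⊥-elim ∘ q↛a)

      swap : Digraph V
      swap = record
        { children        = children′
        ; parents         = parents′
        ; children-unique = switch-unique p q a b children children-unique
        ; parents-unique  = switch-unique a b p q parents parents-unique
        ; parent⇔child    = parent⇔child′
        ; no-sinks        = nonempty
        }
        where
        nonempty : ∀ u → children′ u ≢ []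
        nonempty u with switch-elim p q a b children u
        ... | inj₁ (_ , _ , e) = λ eq → no-sinks u (trans (sym e) eq)
        ... | inj₂ (_ , e)     = λ eq → map≢[] (no-sinks u) (trans (sym e) eq)

      swap-child : ∀ u i → head (drop i (children′ u)) ≡ head (drop i (children u)) ⊎
        ∃ λ v → head (drop i (children u)) ≡ just v × (u ≡ p × v ≡ a ⊎ u ≡ q × v ≡ b)
      swap-child u i with switch-head-drop p q a b children u i
      ... | inj₁ e = inj₁ e
      ... | inj₂ (inj₁ refl , v , e , v∈ , inj₁ refl) = inj₂ (v , e , inj₁ (refl , refl))
      ... | inj₂ (inj₁ refl , v , e , v∈ , inj₂ refl) = contradiction v∈ p↛b
      ... | inj₂ (inj₂ refl , v , e , v∈ , inj₁ refl) = contradiction v∈ q↛a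
      ... | inj₂ (inj₂ refl , v , e , v∈ , inj₂ refl) = inj₂ (v , e , inj₂ (refl , refl))

      swap-parent : ∀ v i → head (drop i (parents′ v)) ≡ head (drop i (parents v)) ⊎
        ∃ λ u → head (drop i (parents v)) ≡ just u × (u ≡ p × v ≡ a ⊎ u ≡ q × v ≡ b)
      swap-parent v i with switch-head-drop a b p q parents v i
      ... | inj₁ e = inj₁ e
      ... | inj₂ (inj₁ refl , u , e , u∈ , inj₁ refl) = inj₂ (u , e , inj₁ (refl , refl))
      ... | inj₂ (inj₁ refl , u , e , u∈ , inj₂ refl) = contradiction (to (parent⇔child u v) u∈) q↛a
      ... | inj₂ (inj₂ refl , u , e , u∈ , inj₁ refl) = contradiction (to (parent⇔child u v) u∈) p↛b
      ... | inj₂ (inj₂ refl , u , e , u∈ , inj₂ refl) = inj₂ (u , e , inj₂ (refl , refl))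

-- Sums and ordered fields

-- The monoid is arbitrary because the decomposition `∑-V` of the hard graph is used twice: over the
-- reals for PageRank and over ℕ for counting nodes and edges.
module ListSum {C : Set} (_∙_ : C → C → C) (ε : C)
               (assoc : ∀ x y z → ((x ∙ y) ∙ z) ≡ (x ∙ (y ∙ z)))
               (identityˡ : ∀ x → (ε ∙ x) ≡ x) where

  ∑ : {A : Set} → List A → (A → C) → C
  ∑ xs f = foldr (λ x s → f x ∙ s) ε xs

  ∑-++ : {A : Set} (xs ys : List A) (f : A → C) →
         ∑ (xs ++ ys) f ≡ (∑ xs f ∙ ∑ ys f)
  ∑-++ []       ys f = sym (identityˡ _)
  ∑-++ (x ∷ xs) ys f = trans (cong (f x ∙_) (∑-++ xs ys f)) (sym (assoc _ _ _))

  ∑-map : {A B : Set} (g : A → B) (xs : List A) (f : B → C) →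
          ∑ (map g xs) f ≡ ∑ xs (λ x → f (g x))
  ∑-map g []       f = refl
  ∑-map g (x ∷ xs) f = cong (f (g x) ∙_) (∑-map g xs f)

  ∑-⊎ : {A B : Set} (F : Finite A) (G : Finite B) (f : A ⊎ B → C) →
        ∑ (Finite.elements (F ⊎-finite G)) f ≡ (∑ (Finite.elements F) (f ∘ inj₁) ∙ ∑ (Finite.elements G) (f ∘ inj₂))
  ∑-⊎ F G f = trans (∑-++ (map inj₁ (Finite.elements F)) _ f)
    (cong₂ _∙_ (∑-map inj₁ (Finite.elements F) f) (∑-map inj₂ (Finite.elements G) f))

  ∑-dependentProduct : {A : Set} {B : A → Set} (xs : List A) (ys : ∀ x → List (B x)) (f : Σ A B → C) →
                       ∑ (dependentProduct xs ys) f ≡ ∑ xs (λ x → ∑ (ys x) (λ y → f (x , y)))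
  ∑-dependentProduct []       ys f = refl
  ∑-dependentProduct (x ∷ xs) ys f = trans (∑-++ (map (x ,_) (ys x)) _ f)
    (cong₂ _∙_ (∑-map (x ,_) (ys x) f) (∑-dependentProduct xs ys f))

module OrderedField (𝓡 : Reals) where
  open Reals 𝓡
  private
    module R = CommutativeRing commutativeRing
    module O = DecTotalOrder decTotalOrder
    module S = ToStrict _≡_ _≤_
  open R public using (+-assoc; +-comm; +-identityˡ; +-identityʳ; *-assoc; *-comm;
    *-identityˡ; *-identityʳ; distribˡ; distribʳ; zeroˡ; zeroʳ; -‿inverseʳ)
  open O public using () renaming (refl to ≤-refl; trans to ≤-trans; antisym to ≤-antisym; total to ≤-total; reflexive to ≤-reflexive)
  module ≤-Reasoning = PosetReasoning O.poset
  open SemiringSolver R.commutativeSemiring public using (solve; _:+_; _:*_; _:=_; con)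

  open ListSum _+_ 0# +-assoc +-identityˡ public

  <⇒≤ : ∀ {x y} → x < y → x ≤ y
  <⇒≤ = S.<⇒≤

  <⇒≱ : ∀ {x y} → x < y → ¬ y ≤ x
  <⇒≱ = S.<⇒≱ ≤-antisym

  ≰⇒> : ∀ {x y} → ¬ x ≤ y → y < x
  ≰⇒> {x} {y} x≰y with ≤-total x y
  ... | inj₁ x≤y = contradiction x≤y x≰y
  ... | inj₂ y≤x = y≤x , λ { refl → x≰y ≤-refl }

  <-≤-trans : ∀ {x y z} → x < y → y ≤ z → x < z
  <-≤-trans = S.<-≤-trans sym ≤-trans ≤-antisym (λ { refl p → p })

  ≤-<-trans : ∀ {x y z} → x ≤ y → y < z → x < z
  ≤-<-trans = S.≤-<-trans ≤-trans ≤-antisym (λ { refl p → p })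

  +-monoʳ-≤ : ∀ z {x y} → x ≤ y → z + x ≤ z + y
  +-monoʳ-≤ z {x} {y} p = subst₂ _≤_ (+-comm x z) (+-comm y z) (+-monoˡ-≤ z p)

  +-mono-≤ : ∀ {x y u v} → x ≤ y → u ≤ v → x + u ≤ y + v
  +-mono-≤ {y = y} {u} p q = ≤-trans (+-monoˡ-≤ u p) (+-monoʳ-≤ y q)

  +-cancelʳ-≤ : ∀ z {x y} → x + z ≤ y + z → x ≤ y
  +-cancelʳ-≤ z {x} {y} p = subst₂ _≤_ (lem x) (lem y) (+-monoˡ-≤ (- z) p)
    where
    lem : ∀ w → w + z + - z ≡ w
    lem w = trans (+-assoc w z (- z)) (trans (cong (w +_) (-‿inverseʳ z)) (+-identityʳ w))

  +-nonneg : ∀ {x y} → 0# ≤ x → 0# ≤ y → 0# ≤ x + y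
  +-nonneg p q = subst (_≤ _) (+-identityˡ 0#) (+-mono-≤ p q)

  x+[y-x]≡y : ∀ x y → x + (y - x) ≡ y
  x+[y-x]≡y x y = trans (cong (x +_) (+-comm y (- x)))
    (trans (sym (+-assoc x (- x) y)) (trans (cong (_+ y) (-‿inverseʳ x)) (+-identityˡ y)))

  0≤y-x : ∀ {x y} → x ≤ y → 0# ≤ y - x
  0≤y-x {x} {y} p = subst (_≤ y - x) (-‿inverseʳ x) (+-monoˡ-≤ (- x) p)

  0<y-x : ∀ {x y} → x < y → 0# < y - x
  0<y-x {x} {y} (x≤y , x≢y) = 0≤y-x x≤y ,
    λ e → x≢y (trans (sym (+-identityʳ x)) (trans (cong (x +_) e) (x+[y-x]≡y x y)))

  x≤x+y : ∀ {x y} → 0# ≤ y → x ≤ x + y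
  x≤x+y {x} {y} p = subst (_≤ x + y) (+-identityʳ x) (+-monoʳ-≤ x p)

  y≤x+y : ∀ {x y} → 0# ≤ x → y ≤ x + y
  y≤x+y {x} {y} p = subst (_≤ x + y) (+-identityˡ y) (+-monoˡ-≤ y p)

  *-monoˡ-≤ : ∀ {x y z} → 0# ≤ z → x ≤ y → x * z ≤ y * z
  *-monoˡ-≤ {x} {y} {z} 0≤z x≤y = subst (x * z ≤_) lem (x≤x+y (*-nonneg (0≤y-x x≤y) 0≤z))
    where
    lem : x * z + (y - x) * z ≡ y * z
    lem = trans (sym (distribʳ z x (y - x))) (cong (_* z) (x+[y-x]≡y x y))

  *-monoʳ-≤ : ∀ {x y z} → 0# ≤ z → x ≤ y → z * x ≤ z * y
  *-monoʳ-≤ {x} {y} {z} p q = subst₂ _≤_ (*-comm x z) (*-comm y z) (*-monoˡ-≤ p q)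

  *-mono-≤ : ∀ {x y u v} → 0# ≤ u → 0# ≤ y → x ≤ y → u ≤ v → x * u ≤ y * v
  *-mono-≤ 0≤u 0≤y x≤y u≤v = ≤-trans (*-monoˡ-≤ 0≤u x≤y) (*-monoʳ-≤ 0≤y u≤v)

  0≤1 : 0# ≤ 1#
  0≤1 with ≤-total 0# 1#
  ... | inj₁ p = p
  ... | inj₂ p = subst (0# ≤_) lem (*-nonneg 0≤-1 0≤-1)
    where
    0≤-1 : 0# ≤ - 1#
    0≤-1 = subst₂ _≤_ (-‿inverseʳ 1#) (+-identityˡ _) (+-monoˡ-≤ (- 1#) p)
    lem : - 1# * - 1# ≡ 1#
    lem = trans (RingProperties.-1*x≈-x R.ring (- 1#)) (RingProperties.-‿involutive R.ring 1#)

  0<1 : 0# < 1#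
  0<1 = 0≤1 , 0≢1

  *-pos : ∀ {x y} → 0# < x → 0# < y → 0# < x * y
  *-pos {x} {y} (p , x≢0) (q , y≢0) = *-nonneg p q , λ e → y≢0 (sym (begin
    y               ≡⟨ *-identityˡ y ⟨
    1# * y          ≡⟨ cong (_* y) (*-inverseʳ (x≢0 ∘ sym)) ⟨
    x * x ⁻¹ * y    ≡⟨ solve 3 (λ a b c → a :* b :* c := a :* c :* b) refl x (x ⁻¹) y ⟩
    x * y * x ⁻¹    ≡⟨ cong (_* x ⁻¹) (sym e) ⟩
    0# * x ⁻¹       ≡⟨ zeroˡ _ ⟩
    0#              ∎))
    where open ≡-Reasoning

  *-cancelʳ-≤ : ∀ {x y z} → 0# < z → x * z ≤ y * z → x ≤ y
  *-cancelʳ-≤ {x} {y} {z} 0<z p with x ≤? y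
  ... | yes q = q
  ... | no ¬q = contradiction (≤-antisym p (*-monoˡ-≤ (<⇒≤ 0<z) y≤x)) λ e →
                proj₂ y<x (sym (*-cancel e))
    where
    y<x = ≰⇒> ¬q
    y≤x = <⇒≤ y<x
    undo : ∀ w → w * z * z ⁻¹ ≡ w
    undo w = trans (*-assoc w z (z ⁻¹)) (trans (cong (w *_) (*-inverseʳ (proj₂ 0<z ∘ sym))) (*-identityʳ w))
    *-cancel : x * z ≡ y * z → x ≡ y
    *-cancel e = trans (sym (undo x)) (trans (cong (_* z ⁻¹) e) (undo y))

  *-inverseˡ : ∀ {x} → 0# < x → x ⁻¹ * x ≡ 1#
  *-inverseˡ (_ , x≢0) = trans (*-comm _ _) (*-inverseʳ (x≢0 ∘ sym))

  ⁻¹-pos : ∀ {x} → 0# < x → 0# < x ⁻¹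
  ⁻¹-pos {x} 0<x = *-cancelʳ-≤ 0<x (subst₂ _≤_ (sym (zeroˡ x)) (sym (*-inverseˡ 0<x)) 0≤1) ,
    λ e → 0≢1 (trans (sym (zeroˡ x)) (trans (cong (_* x) e) (*-inverseˡ 0<x)))

  x*y⁻¹*y≡x : ∀ x {y} → 0# < y → x * y ⁻¹ * y ≡ x
  x*y⁻¹*y≡x x {y} 0<y = trans (*-assoc x _ y) (trans (cong (x *_) (*-inverseˡ 0<y)) (*-identityʳ x))

  x≤y*z⇒x*z⁻¹≤y : ∀ {x y z} → 0# < z → x ≤ y * z → x * z ⁻¹ ≤ y
  x≤y*z⇒x*z⁻¹≤y {x} 0<z p = *-cancelʳ-≤ 0<z (subst (_≤ _) (sym (x*y⁻¹*y≡x x 0<z)) p)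

  x*z≤y⇒x≤y*z⁻¹ : ∀ {x y z} → 0# < z → x * z ≤ y → x ≤ y * z ⁻¹
  x*z≤y⇒x≤y*z⁻¹ {y = y} 0<z p = *-cancelʳ-≤ 0<z (subst (_ ≤_) (sym (x*y⁻¹*y≡x y 0<z)) p)

  fromℕ-+ : ∀ m n → fromℕ (m ℕ.+ n) ≡ fromℕ m + fromℕ n
  fromℕ-+ zero    n = sym (+-identityˡ _)
  fromℕ-+ (suc m) n = trans (cong (1# +_) (fromℕ-+ m n)) (sym (+-assoc _ _ _))

  fromℕ-* : ∀ m n → fromℕ (m ℕ.* n) ≡ fromℕ m * fromℕ n
  fromℕ-* zero    n = sym (zeroˡ _)
  fromℕ-* (suc m) n = trans (fromℕ-+ n (m ℕ.* n)) (trans (cong₂ _+_ (sym (*-identityˡ _)) (fromℕ-* m n)) (sym (distribʳ _ _ _)))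

  fromℕ-1 : fromℕ 1 ≡ 1#
  fromℕ-1 = +-identityʳ 1#

  fromℕ-nonneg : ∀ n → 0# ≤ fromℕ n
  fromℕ-nonneg zero    = ≤-refl
  fromℕ-nonneg (suc n) = +-nonneg 0≤1 (fromℕ-nonneg n)

  fromℕ-mono-≤ : ∀ {m n} → m ℕ.≤ n → fromℕ m ≤ fromℕ n
  fromℕ-mono-≤ {n = n} ℕ.z≤n = fromℕ-nonneg n
  fromℕ-mono-≤ (ℕ.s≤s p) = +-monoʳ-≤ 1# (fromℕ-mono-≤ p)

  fromℕ-mono-< : ∀ {m n} → m ℕ.< n → fromℕ m < fromℕ n
  fromℕ-mono-< {m} {n} m<n = <-≤-trans (y≤x+y 0≤1 , λ e → 0≢1 (begin
      0#                         ≡⟨ -‿inverseʳ (fromℕ m) ⟨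
      fromℕ m + - fromℕ m        ≡⟨ cong (_+ - fromℕ m) e ⟩
      1# + fromℕ m + - fromℕ m   ≡⟨ +-assoc _ _ _ ⟩
      1# + (fromℕ m + - fromℕ m) ≡⟨ cong (1# +_) (-‿inverseʳ _) ⟩
      1# + 0#                    ≡⟨ +-identityʳ 1# ⟩
      1#                         ∎)) (fromℕ-mono-≤ {suc m} {n} m<n)
    where open ≡-Reasoning

  fromℕ-pos : ∀ {n} → 1 ℕ.≤ n → 0# < fromℕ n
  fromℕ-pos {n} p = fromℕ-mono-< {0} {n} p

  fromℕ-cancel-≤ : ∀ m n → fromℕ m ≤ fromℕ n → m ℕ.≤ n
  fromℕ-cancel-≤ m n p = ℕ.≮⇒≥ λ n<m → <⇒≱ (fromℕ-mono-< {n} {m} n<m) p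

  ^-nonneg : ∀ {x} → 0# ≤ x → ∀ n → 0# ≤ x ^ n
  ^-nonneg p zero    = 0≤1
  ^-nonneg p (suc n) = *-nonneg p (^-nonneg p n)

  ^-pos : ∀ {x} → 0# < x → ∀ n → 0# < x ^ n
  ^-pos p zero    = 0<1
  ^-pos p (suc n) = *-pos p (^-pos p n)

  sup-least : ∀ {S b} → ∃ S → UpperBound S b → sup S ≤ b
  sup-least {S} {b} s ub with sup S ≤? b
  ... | yes p = p
  ... | no ¬p with sup-approx {S} (b , ub) s (≰⇒> ¬p)
  ...   | x , x∈S , b<x = contradiction (ub x∈S) (<⇒≱ b<x)

  -- sup-approx at distance 1 below the supremum of the integers up to x
  -- exhibits the largest of them.
  floor : ∀ {x} → 0# ≤ x → ∃ λ k → fromℕ k ≤ x × x < fromℕ (suc k)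
  floor {x} 0≤x with sup-approx {S} (x , ub) (0# , (0 , refl) , 0≤x) {sup S - 1#} below
    where
    S : ℝ → Set
    S y = (∃ λ k → y ≡ fromℕ k) × y ≤ x
    ub : UpperBound S x
    ub = proj₂
    below : sup S - 1# < sup S
    below = subst (sup S - 1# ≤_) (x+[y-x]≡y 1# (sup S)) (y≤x+y 0≤1) ,
      λ e → 0≢1 (sym (begin
        1#                                  ≡⟨ +-identityʳ 1# ⟨
        1# + 0#                             ≡⟨ cong (1# +_) (-‿inverseʳ (sup S)) ⟨
        1# + (sup S - sup S)                ≡⟨ +-assoc _ _ _ ⟨
        1# + sup S - sup S                  ≡⟨ cong (λ z → 1# + z - sup S) e ⟨
        1# + (sup S - 1#) - sup S           ≡⟨ cong (_- sup S) (x+[y-x]≡y 1# (sup S)) ⟩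
        sup S - sup S                       ≡⟨ -‿inverseʳ _ ⟩
        0#                                  ∎))
      where open ≡-Reasoning
  ... | _ , ((k , refl) , k≤x) , sup-1<k = k , k≤x , ≰⇒> λ 1+k≤x →
    <⇒≱ sup-1<k (+-cancelʳ-≤ 1# (subst₂ _≤_ (+-comm 1# (fromℕ k)) (trans (sym (x+[y-x]≡y 1# _)) (+-comm 1# _))
      (sup-upper (x , proj₂) ((suc k , refl) , 1+k≤x))))

  archimedean : ∀ x → ∃ λ k → x ≤ fromℕ k
  archimedean x with ≤-total 0# x
  ... | inj₁ 0≤x = let k , _ , x<1+k = floor 0≤x in suc k , <⇒≤ x<1+k
  ... | inj₂ x≤0 = 0 , x≤0

  -- The roots stand only on the smaller side of the final inequality, so upper bounds suffice;
  -- nonnegativity serves for multiplying them and for the nested root.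
  √-bounds : ∀ {x b} → 0# ≤ x → 0# ≤ b → x ≤ b * b → 0# ≤ √ x × √ x ≤ b
  √-bounds {x} {b} 0≤x 0≤b x≤b² =
    sup-upper (b , ub) 0∈S , sup-least (0# , 0∈S) ub
    where
    0∈S : 0# * 0# ≤ x
    0∈S = subst (_≤ x) (sym (zeroˡ 0#)) 0≤x
    ub : UpperBound (λ y → y * y ≤ x) b
    ub {y} y²≤x with y ≤? b
    ... | yes y≤b = y≤b
    ... | no y≰b = *-cancelʳ-≤ (≤-<-trans 0≤b b<y) (begin
          y * y ≤⟨ y²≤x ⟩
          x     ≤⟨ x≤b² ⟩
          b * b ≤⟨ *-monoʳ-≤ 0≤b (<⇒≤ b<y) ⟩
          b * y ∎)
      where
      open ≤-Reasoning
      b<y = ≰⇒> y≰b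

module Sums (𝓡 : Reals) where
  open Reals 𝓡
  open OrderedField 𝓡

  private variable
    A B : Set

  ∑-cong : ∀ (xs : List A) {f g : A → ℝ} → (∀ x → f x ≡ g x) → ∑ xs f ≡ ∑ xs g
  ∑-cong []       e = refl
  ∑-cong (x ∷ xs) e = cong₂ _+_ (e x) (∑-cong xs e)

  ∑-mono : ∀ (xs : List A) {f g : A → ℝ} → (∀ x → f x ≤ g x) → ∑ xs f ≤ ∑ xs g
  ∑-mono []       p = ≤-refl
  ∑-mono (x ∷ xs) p = +-mono-≤ (p x) (∑-mono xs p)

  ∑-const : ∀ (xs : List A) c → ∑ xs (λ _ → c) ≡ fromℕ (length xs) * c
  ∑-const []       c = sym (zeroˡ c)
  ∑-const (x ∷ xs) c = trans (cong₂ _+_ (sym (*-identityˡ c)) (∑-const xs c)) (sym (distribʳ c 1# _))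

  ∑-nonneg : ∀ (xs : List A) {f : A → ℝ} → (∀ x → 0# ≤ f x) → 0# ≤ ∑ xs f
  ∑-nonneg []       p = ≤-refl
  ∑-nonneg (x ∷ xs) p = +-nonneg (p x) (∑-nonneg xs p)

  ∑-+ : ∀ (xs : List A) (f g : A → ℝ) → ∑ xs (λ x → f x + g x) ≡ ∑ xs f + ∑ xs g
  ∑-+ []       f g = sym (+-identityˡ 0#)
  ∑-+ (x ∷ xs) f g = trans (cong (f x + g x +_) (∑-+ xs f g))
    (solve 4 (λ a b c d → (a :+ b) :+ (c :+ d) := (a :+ c) :+ (b :+ d)) refl (f x) (g x) (∑ xs f) (∑ xs g))

  ∑-*ˡ : ∀ (xs : List A) c (f : A → ℝ) → ∑ xs (λ x → c * f x) ≡ c * ∑ xs f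
  ∑-*ˡ []       c f = sym (zeroʳ c)
  ∑-*ˡ (x ∷ xs) c f = trans (cong (c * f x +_) (∑-*ˡ xs c f)) (sym (distribˡ c _ _))

  ∑-*ʳ : ∀ (xs : List A) c (f : A → ℝ) → ∑ xs (λ x → f x * c) ≡ ∑ xs f * c
  ∑-*ʳ xs c f = trans (∑-cong xs (λ x → *-comm (f x) c)) (trans (∑-*ˡ xs c f) (*-comm c _))

  ∑-∑-comm : ∀ (xs : List A) (ys : List B) (f : A → B → ℝ) →
             ∑ xs (λ x → ∑ ys (f x)) ≡ ∑ ys (λ y → ∑ xs (λ x → f x y))
  ∑-∑-comm []       ys f = sym (trans (∑-const ys 0#) (zeroʳ _))
  ∑-∑-comm (x ∷ xs) ys f = trans (cong (∑ ys (f x) +_) (∑-∑-comm xs ys f))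
    (sym (∑-+ ys (f x) _))

  ∑-cartesianProduct : ∀ (xs : List A) (ys : List B) (f : A × B → ℝ) →
    ∑ (cartesianProduct xs ys) f ≡ ∑ xs (λ x → ∑ ys (λ y → f (x , y)))
  ∑-cartesianProduct []       ys f = refl
  ∑-cartesianProduct (x ∷ xs) ys f = trans (∑-++ (map (x ,_) ys) _ f)
    (cong₂ _+_ (∑-map (x ,_) ys f) (∑-cartesianProduct xs ys f))

  term≤∑ : ∀ {xs : List A} {f : A → ℝ} → (∀ x → 0# ≤ f x) → ∀ {x} → x ∈ xs → f x ≤ ∑ xs f
  term≤∑ {xs = _ ∷ xs} p (here refl) = x≤x+y (∑-nonneg xs p)
  term≤∑ {xs = y ∷ _}  p (there q)   = ≤-trans (term≤∑ p q) (y≤x+y (p y))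

  -- The Iverson bracket, written as in `walk` and `outputProbability`, so that the reward for an
  -- accurate output is a bracket by definition.
  [_] : {P : Set} → Dec P → ℝ
  [ d ] = if ⌊ d ⌋ then 1# else 0#

  []-nonneg : ∀ {P : Set} (d : Dec P) → 0# ≤ [ d ]
  []-nonneg (yes _) = 0≤1
  []-nonneg (no _)  = ≤-refl

  []-≤1 : ∀ {P : Set} (d : Dec P) → [ d ] ≤ 1#
  []-≤1 (yes _) = ≤-refl
  []-≤1 (no _)  = 0≤1

  -- Applied over levels, this says that an output serves one level; over slots, that an answer
  -- meets one slot; over the children of a hub, that one of them leads to the target.
  ∑-exclusive : ∀ {xs : List A} {P : A → Set} (P? : ∀ x → Dec (P x)) → Unique xs →
                (∀ {x y} → P x → P y → x ≡ y) → ∑ xs (λ x → [ P? x ]) ≤ 1#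
  ∑-exclusive {xs = []}     P? []         exc = 0≤1
  ∑-exclusive {xs = x ∷ xs} P? (x∉ ∷ uniq) exc with P? x
  ... | no _  = subst (_≤ 1#) (sym (+-identityˡ _)) (∑-exclusive P? uniq exc)
  ... | yes p = ≤-reflexive (trans (cong (1# +_) (vanish x∉)) (+-identityʳ 1#))
    where
    vanish : ∀ {ys} → All (x ≢_) ys → ∑ ys (λ y → [ P? y ]) ≡ 0#
    vanish []                = refl
    vanish (_∷_ {y} x≢y x∉ys) with P? y
    ... | yes q = contradiction (exc p q) x≢y
    ... | no _  = trans (+-identityˡ _) (vanish x∉ys)

  ∑-select : ∀ {n} (y : Fin n) (f : Fin n → ℝ) → ∑ (allFin n) (λ x → [ x Fin.≟ y ] * f x) ≡ f y
  ∑-select {n} y f = begin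
    ∑ (allFin n) (λ x → [ x Fin.≟ y ] * f x) ≡⟨ ∑-cong (allFin n) same ⟩
    ∑ (allFin n) (λ x → [ x Fin.≟ y ] * f y) ≡⟨ ∑-*ʳ (allFin n) (f y) _ ⟩
    ∑ (allFin n) (λ x → [ x Fin.≟ y ]) * f y ≡⟨ cong (_* f y) count ⟩
    1# * f y                                 ≡⟨ *-identityˡ (f y) ⟩
    f y                                      ∎
    where
    open ≡-Reasoning
    same : ∀ x → [ x Fin.≟ y ] * f x ≡ [ x Fin.≟ y ] * f y
    same x with x Fin.≟ y
    ... | yes refl = refl
    ... | no _     = trans (zeroˡ _) (sym (zeroˡ _))
    self : [ y Fin.≟ y ] ≡ 1#
    self with y Fin.≟ y
    ... | yes _ = refl
    ... | no ¬p = contradiction refl ¬p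
    count : ∑ (allFin n) (λ x → [ x Fin.≟ y ]) ≡ 1#
    count = ≤-antisym (∑-exclusive (Fin._≟ y) (Unique.allFin⁺ n) (λ p q → trans p (sym q)))
      (subst (_≤ ∑ (allFin n) (λ x → [ x Fin.≟ y ])) self (term≤∑ (λ x → []-nonneg (x Fin.≟ y)) (∈-allFin y)))

  ∑-allFin-const : ∀ n c → ∑ (allFin n) (λ _ → c) ≡ fromℕ n * c
  ∑-allFin-const n c = trans (∑-const (allFin n) c) (cong (λ k → fromℕ k * c) (List.length-tabulate {n = n} id))

  ∑-zero : ∀ {A : Set} (xs : List A) → ∑ xs (λ _ → 0#) ≡ 0#
  ∑-zero xs = trans (∑-const xs 0#) (zeroʳ _)

  length-pos : ∀ {xs : List A} → xs ≢ [] → 0# < fromℕ (length xs)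
  length-pos {xs = []}    ne = contradiction refl ne
  length-pos {xs = _ ∷ xs} ne = fromℕ-pos {suc (length xs)} (ℕ.s≤s ℕ.z≤n)

  1/length-nonneg : ∀ {xs : List A} → xs ≢ [] → 0# ≤ fromℕ (length xs) ⁻¹
  1/length-nonneg ne = <⇒≤ (⁻¹-pos (length-pos ne))

  mean-mono : ∀ {xs : List A} {f g : A → ℝ} → xs ≢ [] → (∀ x → f x ≤ g x) → mean xs f ≤ mean xs g
  mean-mono {xs = xs} ne p = *-monoˡ-≤ (1/length-nonneg ne) (∑-mono xs p)

  mean-cong : ∀ (xs : List A) {f g : A → ℝ} → (∀ x → f x ≡ g x) → mean xs f ≡ mean xs g
  mean-cong xs e = cong (_* _) (∑-cong xs e)

  mean-nonneg : ∀ {xs : List A} {f : A → ℝ} → xs ≢ [] → (∀ x → 0# ≤ f x) → 0# ≤ mean xs f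
  mean-nonneg {xs = xs} ne p = *-nonneg (∑-nonneg xs p) (1/length-nonneg ne)

  mean-const : ∀ {xs : List A} → xs ≢ [] → ∀ c → mean xs (λ _ → c) ≡ c
  mean-const {xs = xs} ne c = begin
    ∑ xs (λ _ → c) * fromℕ (length xs) ⁻¹     ≡⟨ cong (_* fromℕ (length xs) ⁻¹) (trans (∑-const xs c) (*-comm _ c)) ⟩
    c * fromℕ (length xs) * fromℕ (length xs) ⁻¹ ≡⟨ *-assoc c _ _ ⟩
    c * (fromℕ (length xs) * fromℕ (length xs) ⁻¹) ≡⟨ cong (c *_) (*-inverseʳ (proj₂ (length-pos ne) ∘ sym)) ⟩
    c * 1#                                    ≡⟨ *-identityʳ c ⟩
    c                                         ∎
    where open ≡-Reasoning

  mean-+ : ∀ (xs : List A) (f g : A → ℝ) → mean xs (λ x → f x + g x) ≡ mean xs f + mean xs g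
  mean-+ xs f g = trans (cong (_* _) (∑-+ xs f g)) (distribʳ _ _ _)

  mean-*ˡ : ∀ (xs : List A) c (f : A → ℝ) → mean xs (λ x → c * f x) ≡ c * mean xs f
  mean-*ˡ xs c f = trans (cong (_* _) (∑-*ˡ xs c f)) (*-assoc c _ _)

  mean-∑-comm : ∀ (xs : List A) (ys : List B) (f : A → B → ℝ) →
                ∑ ys (λ y → mean xs (λ x → f x y)) ≡ mean xs (λ x → ∑ ys (f x))
  mean-∑-comm xs ys f = trans (∑-*ʳ ys _ _) (cong (_* _) (sym (∑-∑-comm xs ys f)))

  mean-map : ∀ (g : A → B) (xs : List A) (f : B → ℝ) → mean (map g xs) f ≡ mean xs (λ x → f (g x))
  mean-map g xs f = cong₂ (λ s n → s * fromℕ n ⁻¹) (∑-map g xs f) (List.length-map g xs)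

  1⁻¹≡1 : fromℕ 1 ⁻¹ ≡ 1#
  1⁻¹≡1 = begin
    fromℕ 1 ⁻¹           ≡⟨ *-identityʳ _ ⟨
    fromℕ 1 ⁻¹ * 1#      ≡⟨ cong (fromℕ 1 ⁻¹ *_) fromℕ-1 ⟨
    fromℕ 1 ⁻¹ * fromℕ 1 ≡⟨ *-inverseˡ (fromℕ-pos {1} ℕ.≤-refl) ⟩
    1#                   ∎
    where open ≡-Reasoning

  mean-singleton : ∀ (x : A) f → mean (x ∷ []) f ≡ f x
  mean-singleton x f = trans (cong₂ _*_ (+-identityʳ _) 1⁻¹≡1) (*-identityʳ _)

-- PageRank and runs of an algorithm

module PageRankBounds (𝓡 : Reals) (G : Graph) where
  open Reals 𝓡
  open OrderedField 𝓡
  open Sums 𝓡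
  open Graph G

  Superharmonic : (Node → ℝ) → Set
  Superharmonic h = ∀ u → mean (children u) h ≤ h u

  walk-nonneg : ∀ ℓ s t → 0# ≤ walk 𝓡 G ℓ s t
  walk-nonneg zero    s t = []-nonneg (s Fin.≟ t)
  walk-nonneg (suc ℓ) s t = mean-nonneg (no-sinks s) (λ u → walk-nonneg ℓ u t)

  -- Along the walk h is a nonnegative supermartingale, and it dominates the indicator of t.
  walk-≤-superharmonic : ∀ {h t} → (∀ u → 0# ≤ h u) → 1# ≤ h t → Superharmonic h →
                         ∀ ℓ s → walk 𝓡 G ℓ s t ≤ h s
  walk-≤-superharmonic {t = t} 0≤h 1≤ht sh zero s with s Fin.≟ t
  ... | yes refl = 1≤ht
  ... | no _     = 0≤h s
  walk-≤-superharmonic 0≤h 1≤ht sh (suc ℓ) s =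
    ≤-trans (mean-mono (no-sinks s) (walk-≤-superharmonic 0≤h 1≤ht sh ℓ)) (sh s)

  walk-zero-refl : ∀ t → walk 𝓡 G 0 t t ≡ 1#
  walk-zero-refl t with t Fin.≟ t
  ... | yes _ = refl
  ... | no ¬p = contradiction refl ¬p

  walk-step : ∀ {u v} → v ∈ children u → ∀ ℓ t →
              walk 𝓡 G ℓ v t * fromℕ (outdeg u) ⁻¹ ≤ walk 𝓡 G (suc ℓ) u t
  walk-step {u} v∈ ℓ t = *-monoˡ-≤ (1/length-nonneg (no-sinks u))
                         (term≤∑ {f = λ v → walk 𝓡 G ℓ v t} (λ v → walk-nonneg ℓ v t) v∈)

  module _ {α} (0<α : 0# < α) (α<1 : α < 1#) where

    private
      β = 1# - α
      0≤β : 0# ≤ β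
      0≤β = 0≤y-x (<⇒≤ α<1)

      coeff-nonneg : ∀ ℓ → 0# ≤ α * β ^ ℓ
      coeff-nonneg ℓ = *-nonneg (<⇒≤ 0<α) (^-nonneg 0≤β ℓ)

      score : Node → Node → ℕ → ℝ
      score t s ℓ = α * β ^ ℓ * walk 𝓡 G ℓ s t

      score-nonneg : ∀ t s ℓ → 0# ≤ score t s ℓ
      score-nonneg t s ℓ = *-nonneg (coeff-nonneg ℓ) (walk-nonneg ℓ s t)

      ∑<-nonneg : ∀ (f : ℕ → ℝ) → (∀ k → 0# ≤ f k) → ∀ k → 0# ≤ ∑< k f
      ∑<-nonneg f p zero    = ≤-refl
      ∑<-nonneg f p (suc k) = +-nonneg (∑<-nonneg f p k) (p k)

      -- The summand β^k c is the mass of the walks longer than the partial sum. With it the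
      -- induction closes by α + β = 1, and no limit of the geometric series is needed.
      geometric : ∀ (f : ℕ → ℝ) c → (∀ ℓ → f ℓ ≤ c) →
                  ∀ k → ∑< k (λ ℓ → α * β ^ ℓ * f ℓ) + β ^ k * c ≤ c
      geometric f c p zero    = ≤-reflexive (trans (+-identityˡ _) (*-identityˡ c))
      geometric f c p (suc k) = begin
        ∑< k g + α * β ^ k * f k + β * β ^ k * c
          ≤⟨ +-monoˡ-≤ _ (+-monoʳ-≤ _ (*-monoʳ-≤ (coeff-nonneg k) (p k))) ⟩
        ∑< k g + α * β ^ k * c + β * β ^ k * c
          ≡⟨ solve 5 (λ s a b q x → s :+ a :* q :* x :+ b :* q :* x := s :+ (a :+ b) :* (q :* x)) refl (∑< k g) α β (β ^ k) c ⟩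
        ∑< k g + (α + β) * (β ^ k * c)
          ≡⟨ cong (λ z → ∑< k g + z) (trans (cong (_* (β ^ k * c)) (x+[y-x]≡y α 1#)) (*-identityˡ _)) ⟩
        ∑< k g + β ^ k * c
          ≤⟨ geometric f c p k ⟩
        c ∎
        where
        open ≤-Reasoning
        g = λ ℓ → α * β ^ ℓ * f ℓ

      partial≤ : ∀ {h t} → (∀ u → 0# ≤ h u) → 1# ≤ h t → Superharmonic h →
                 ∀ s → UpperBound (λ y → ∃ λ k → y ≡ ∑< k (score t s)) (h s)
      partial≤ {h} {t} 0≤h 1≤ht sh s (k , refl) = ≤-trans (x≤x+y (*-nonneg (^-nonneg 0≤β k) (0≤h s)))
        (geometric (λ ℓ → walk 𝓡 G ℓ s t) (h s) (λ ℓ → walk-≤-superharmonic 0≤h 1≤ht sh ℓ s) k)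

    pageRank-≤ : nodes ≢ [] → ∀ {h t} → (∀ u → 0# ≤ h u) → 1# ≤ h t → Superharmonic h →
                 pageRank 𝓡 G α t ≤ mean nodes h
    pageRank-≤ ne 0≤h 1≤ht sh = mean-mono ne λ s → sup-least (0# , (0 , refl)) (partial≤ 0≤h 1≤ht sh s)

    pageRank-≥ : nodes ≢ [] → ∀ ℓ t →
                 mean nodes (λ s → α * (1# - α) ^ ℓ * walk 𝓡 G ℓ s t) ≤ pageRank 𝓡 G α t
    pageRank-≥ ne ℓ t = mean-mono ne λ s →
      ≤-trans (y≤x+y (∑<-nonneg (score t s) (score-nonneg t s) ℓ))
        -- `sup-upper` asks for some bound on the partial sums; the constant 1 is superharmonic and
        -- provides it.
        (sup-upper (1# , partial≤ {λ _ → 1#} {t} (λ _ → 0≤1) ≤-refl (λ u → ≤-reflexive (mean-const (no-sinks u) 1#)) s)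
                   (suc ℓ , refl))

module Payoff (𝓡 : Reals) (B : Algorithm 𝓡) (G : Graph) (nodes≢[] : Graph.nodes G ≢ []) where
  open Reals 𝓡
  open OrderedField 𝓡
  open Sums 𝓡
  open Algorithm B
  open Graph G

  convex-mono : ∀ {q x x′ y y′} → 0# ≤ q → q ≤ 1# → x ≤ x′ → y ≤ y′ →
                q * x + (1# - q) * y ≤ q * x′ + (1# - q) * y′
  convex-mono 0≤q q≤1 p p′ = +-mono-≤ (*-monoʳ-≤ 0≤q p) (*-monoʳ-≤ (0≤y-x q≤1) p′)

  convex-const : ∀ q x → q * x + (1# - q) * x ≡ x
  convex-const q x = trans (sym (distribʳ x q (1# - q))) (trans (cong (_* x) (x+[y-x]≡y q 1#)) (*-identityˡ x))

  module _ {fee : ℝ} {reward : ℝ → ℝ} (0≤fee : 0# ≤ fee) (0≤reward : ∀ x → 0# ≤ reward x) where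

    private
      pay = payoff 𝓡 B G fee reward

    payoff-nonneg : ∀ j {k} (vs : Vec Node k) s → 0# ≤ pay j vs s
    payoff-nonneg zero    vs s = ≤-refl
    payoff-nonneg (suc j) vs s = go (step s)
      where
      received : ∀ s f mb → 0# ≤ receive 𝓡 B G fee reward j vs s f mb
      received s f nothing  = payoff-nonneg j vs s
      received s f (just v) = payoff-nonneg j (v ∷ vs) _
      go : ∀ a → 0# ≤ perform 𝓡 B G fee reward j vs a
      go (output x)            = 0≤reward x
      go (toss q 0≤q q≤1 s s′) = +-nonneg (*-nonneg 0≤q (payoff-nonneg j vs s))
                                          (*-nonneg (0≤y-x q≤1) (payoff-nonneg j vs s′))
      go (INDEG i f)           = +-nonneg 0≤fee (payoff-nonneg j vs _)
      go (OUTDEG i f)          = +-nonneg 0≤fee (payoff-nonneg j vs _)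
      go (PARENT i a s f)      = +-nonneg 0≤fee (received s f (head (drop a (parents (lookup vs i)))))
      go (CHILD i a s f)       = +-nonneg 0≤fee (received s f (head (drop a (children (lookup vs i)))))
      go (JUMP f)              = +-nonneg 0≤fee (mean-nonneg nodes≢[] λ v → payoff-nonneg j (v ∷ vs) _)

    payoff-suc : ∀ j {k} (vs : Vec Node k) s → pay j vs s ≤ pay (suc j) vs s
    payoff-suc zero    vs s = payoff-nonneg 1 vs s
    payoff-suc (suc j) vs s = go (step s)
      where
      received : ∀ s f mb → receive 𝓡 B G fee reward j vs s f mb ≤ receive 𝓡 B G fee reward (suc j) vs s f mb
      received s f nothing  = payoff-suc j vs s
      received s f (just v) = payoff-suc j (v ∷ vs) _
      go : ∀ a → perform 𝓡 B G fee reward j vs a ≤ perform 𝓡 B G fee reward (suc j) vs a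
      go (output x)            = ≤-refl
      go (toss q 0≤q q≤1 s s′) = convex-mono 0≤q q≤1 (payoff-suc j vs s) (payoff-suc j vs s′)
      go (INDEG i f)           = +-monoʳ-≤ fee (payoff-suc j vs _)
      go (OUTDEG i f)          = +-monoʳ-≤ fee (payoff-suc j vs _)
      go (PARENT i a s f)      = +-monoʳ-≤ fee (received s f (head (drop a (parents (lookup vs i)))))
      go (CHILD i a s f)       = +-monoʳ-≤ fee (received s f (head (drop a (children (lookup vs i)))))
      go (JUMP f)              = +-monoʳ-≤ fee (mean-mono nodes≢[] λ v → payoff-suc j (v ∷ vs) _)

    payoff-mono : ∀ {i j} → i ℕ.≤ j → ∀ {k} (vs : Vec Node k) s → pay i vs s ≤ pay j vs s
    payoff-mono p = go (ℕ.≤⇒≤′ p)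
      where
      go : ∀ {i j} → i ℕ.≤′ j → ∀ {k} (vs : Vec Node k) s → pay i vs s ≤ pay j vs s
      go (ℕ.≤′-reflexive refl)    vs s = ≤-refl
      go (ℕ.≤′-step {n = j} i≤′j) vs s = ≤-trans (go i≤′j vs s) (payoff-suc j vs s)

  payoff-≤1 : ∀ {reward} → (∀ x → reward x ≤ 1#) →
              ∀ j {k} (vs : Vec Node k) s → payoff 𝓡 B G 0# reward j vs s ≤ 1#
  payoff-≤1 {reward} r≤1 zero    vs s = 0≤1
  payoff-≤1 {reward} r≤1 (suc j) vs s = go (step s)
    where
    free : ∀ {x} → x ≤ 1# → 0# + x ≤ 1#
    free = subst (_≤ 1#) (sym (+-identityˡ _))
    received : ∀ s f mb → receive 𝓡 B G 0# reward j vs s f mb ≤ 1#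
    received s f nothing  = payoff-≤1 r≤1 j vs s
    received s f (just v) = payoff-≤1 r≤1 j (v ∷ vs) _
    go : ∀ a → perform 𝓡 B G 0# reward j vs a ≤ 1#
    go (output x)            = r≤1 x
    go (toss q 0≤q q≤1 s s′) = ≤-trans (convex-mono 0≤q q≤1 (payoff-≤1 r≤1 j vs s) (payoff-≤1 r≤1 j vs s′))
                                       (≤-reflexive (convex-const q 1#))
    go (INDEG i f)           = free (payoff-≤1 r≤1 j vs _)
    go (OUTDEG i f)          = free (payoff-≤1 r≤1 j vs _)
    go (PARENT i a s f)      = free (received s f (head (drop a (parents (lookup vs i)))))
    go (CHILD i a s f)       = free (received s f (head (drop a (children (lookup vs i)))))
    go (JUMP f)              = free (≤-trans (mean-mono nodes≢[] λ v → payoff-≤1 r≤1 j (v ∷ vs) _)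
                                             (≤-reflexive (mean-const nodes≢[] 1#)))

-- Coupling the runs on all variants with the run on the base graph

module Coupling (𝓡 : Reals) {n : ℕ} (nonempty : allFin n ≢ [])
                (base : Digraph (Fin n)) {K : Set} (ks : List K) (variant : K → Digraph (Fin n))
                (M : Reals.ℝ 𝓡) where
  open Reals 𝓡
  open OrderedField 𝓡
  open Sums 𝓡
  private
    module G₀ = Digraph base
    module G k = Digraph (variant k)

  -- τ is a charge: a variant that answers differently from the base graph pays at least 1, and all
  -- charges together stay within the budget M. A real-valued charge can be added directly to the
  -- payoffs.
  AgreeUpTo : {X : Set} → (K → X) → X → Set
  AgreeUpTo f x = ∃ λ τ → (∀ k → f k ≡ x × 0# ≤ τ k ⊎ 1# ≤ τ k) × ∑ ks τ ≤ M

  record Close : Set where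
    field
      M-nonneg : 0# ≤ M
      indeg-≡  : ∀ k v → length (G.parents k v) ≡ length (G₀.parents v)
      outdeg-≡ : ∀ k v → length (G.children k v) ≡ length (G₀.children v)
      parent-≈ : ∀ v a → AgreeUpTo (λ k → head (drop a (G.parents k v))) (head (drop a (G₀.parents v)))
      child-≈  : ∀ u a → AgreeUpTo (λ k → head (drop a (G.children k u))) (head (drop a (G₀.children u)))

  -- Along the run on the base graph, a query loses at most M from the sum of
  -- the success probabilities: only variants answering it differently lose
  -- anything, and each of them at most 1.
  module _ (close : Close) (B : Algorithm 𝓡) (reward : K → ℝ → ℝ) (A : ℝ) (0≤A : 0# ≤ A)
           (0≤reward : ∀ k x → 0# ≤ reward k x) (reward≤1 : ∀ k x → reward k x ≤ 1#)
           (∑reward≤A : ∀ x → ∑ ks (λ k → reward k x) ≤ A) where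
    open Close close
    open Algorithm B

    private
      Node = Fin n

      P : K → ℕ → ∀ {i} → Vec Node i → State i → ℝ
      P k = payoff 𝓡 B (toGraph (variant k)) 0# (reward k)
      N : ℕ → ∀ {i} → Vec Node i → State i → ℝ
      N = payoff 𝓡 B (toGraph base) 1# (λ _ → 0#)

      module PO k = Payoff 𝓡 B (toGraph (variant k)) nonempty
      open Payoff 𝓡 B (toGraph base) nonempty using (convex-const)

      P-nonneg : ∀ k j {i} (vs : Vec Node i) s → 0# ≤ P k j vs s
      P-nonneg k = PO.payoff-nonneg k ≤-refl (0≤reward k)

      P≤1 : ∀ k j {i} (vs : Vec Node i) s → P k j vs s ≤ 1#
      P≤1 k = PO.payoff-≤1 k (reward≤1 k)

    ∑success≤ : ∀ j {i} (vs : Vec Node i) s → ∑ ks (λ k → P k j vs s) ≤ A + M * N j vs s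
    ∑success≤ zero vs s = begin
      ∑ ks (λ _ → 0#) ≡⟨ trans (∑-const ks 0#) (zeroʳ _) ⟩
      0#              ≤⟨ 0≤A ⟩
      A               ≡⟨ trans (cong (A +_) (zeroʳ M)) (+-identityʳ A) ⟨
      A + M * 0#      ∎
      where open ≤-Reasoning
    ∑success≤ (suc j) vs s = go (step s)
      where
      open ≤-Reasoning
      paid : ∀ {x : K → ℝ} {y} → ∑ ks x ≤ M + (A + M * y) → ∑ ks (λ k → 0# + x k) ≤ A + M * (1# + y)
      paid {x} {y} p = begin
        ∑ ks (λ k → 0# + x k) ≡⟨ ∑-cong ks (λ k → +-identityˡ (x k)) ⟩
        ∑ ks x                ≤⟨ p ⟩
        M + (A + M * y)       ≡⟨ cong (_+ (A + M * y)) (*-identityʳ M) ⟨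
        M * 1# + (A + M * y)  ≡⟨ solve 4 (λ m o a y → m :* o :+ (a :+ m :* y) := a :+ m :* (o :+ y)) refl M 1# A y ⟩
        A + M * (1# + y)      ∎

      same : ∀ s → ∑ ks (λ k → P k j vs s) ≤ M + (A + M * N j vs s)
      same s = ≤-trans (∑success≤ j vs s) (y≤x+y M-nonneg)

      received : ∀ s f {mb : K → Maybe Node} {mb₀} → AgreeUpTo mb mb₀ →
                 ∑ ks (λ k → receive 𝓡 B (toGraph (variant k)) 0# (reward k) j vs s f (mb k)) ≤
                 M + (A + M * receive 𝓡 B (toGraph base) 1# (λ _ → 0#) j vs s f mb₀)
      received s f {mb} {mb₀} (τ , agree , ∑τ≤M) = begin
        ∑ ks (λ k → rec k (mb k))       ≤⟨ ∑-mono ks compare ⟩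
        ∑ ks (λ k → τ k + rec k mb₀)    ≡⟨ ∑-+ ks τ _ ⟩
        ∑ ks τ + ∑ ks (λ k → rec k mb₀) ≤⟨ +-mono-≤ ∑τ≤M (unperturbed mb₀) ⟩
        M + (A + M * receive 𝓡 B (toGraph base) 1# (λ _ → 0#) j vs s f mb₀) ∎
        where
        rec : K → Maybe Node → ℝ
        rec k = receive 𝓡 B (toGraph (variant k)) 0# (reward k) j vs s f
        rec-nonneg : ∀ k mb → 0# ≤ rec k mb
        rec-nonneg k nothing  = P-nonneg k j vs s
        rec-nonneg k (just v) = P-nonneg k j (v ∷ vs) _
        rec≤1 : ∀ k mb → rec k mb ≤ 1#
        rec≤1 k nothing  = P≤1 k j vs s
        rec≤1 k (just v) = P≤1 k j (v ∷ vs) _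
        compare : ∀ k → rec k (mb k) ≤ τ k + rec k mb₀
        compare k with agree k
        ... | inj₁ (eq , 0≤τ) = subst (λ z → rec k z ≤ τ k + rec k mb₀) (sym eq) (y≤x+y 0≤τ)
        -- A variant that answers differently is given up: whatever it achieves afterwards is at
        -- most 1, which its charge covers.
        ... | inj₂ 1≤τ        = ≤-trans (rec≤1 k (mb k)) (≤-trans 1≤τ (x≤x+y (rec-nonneg k mb₀)))
        unperturbed : ∀ mb → ∑ ks (λ k → rec k mb) ≤
                      A + M * receive 𝓡 B (toGraph base) 1# (λ _ → 0#) j vs s f mb
        unperturbed nothing  = ∑success≤ j vs s
        unperturbed (just v) = ∑success≤ j (v ∷ vs) _

      go : ∀ a → ∑ ks (λ k → perform 𝓡 B (toGraph (variant k)) 0# (reward k) j vs a) ≤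
                 A + M * perform 𝓡 B (toGraph base) 1# (λ _ → 0#) j vs a
      -- The variants not yet given up have followed the same run and all output this x, so the
      -- bound A on their joint reward applies.
      go (output x) = ≤-trans (∑reward≤A x)
        (≤-reflexive (sym (trans (cong (A +_) (zeroʳ M)) (+-identityʳ A))))
      go (toss q 0≤q q≤1 s s′) = begin
        ∑ ks (λ k → q * P k j vs s + (1# - q) * P k j vs s′)
          ≡⟨ ∑-+ ks _ _ ⟩
        ∑ ks (λ k → q * P k j vs s) + ∑ ks (λ k → (1# - q) * P k j vs s′)
          ≡⟨ cong₂ _+_ (∑-*ˡ ks q _) (∑-*ˡ ks (1# - q) _) ⟩
        q * ∑ ks (λ k → P k j vs s) + (1# - q) * ∑ ks (λ k → P k j vs s′)
          ≤⟨ +-mono-≤ (*-monoʳ-≤ 0≤q (∑success≤ j vs s)) (*-monoʳ-≤ (0≤y-x q≤1) (∑success≤ j vs s′)) ⟩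
        q * (A + M * N j vs s) + (1# - q) * (A + M * N j vs s′)
          ≡⟨ solve 6 (λ q r a m x y → q :* (a :+ m :* x) :+ r :* (a :+ m :* y) :=
                                      (q :* a :+ r :* a) :+ m :* (q :* x :+ r :* y))
                   refl q (1# - q) A M (N j vs s) (N j vs s′) ⟩
        q * A + (1# - q) * A + M * (q * N j vs s + (1# - q) * N j vs s′)
          ≡⟨ cong (_+ M * (q * N j vs s + (1# - q) * N j vs s′)) (convex-const q A) ⟩
        A + M * (q * N j vs s + (1# - q) * N j vs s′) ∎
      go (INDEG i f) = paid (≤-trans
        (≤-reflexive (∑-cong ks λ k → cong (λ d → P k j vs (f d)) (indeg-≡ k (lookup vs i)))) (same _))
      go (OUTDEG i f) = paid (≤-trans
        (≤-reflexive (∑-cong ks λ k → cong (λ d → P k j vs (f d)) (outdeg-≡ k (lookup vs i)))) (same _))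
      go (PARENT i a s f) = paid (received s f (parent-≈ (lookup vs i) a))
      go (CHILD i a s f)  = paid (received s f (child-≈ (lookup vs i) a))
      -- A jump draws from the same `Fin n` in every graph. The sum over the variants therefore
      -- passes inside the mean, and the budget M of this query is left unspent.
      go (JUMP f) = paid (begin
        ∑ ks (λ k → mean (allFin n) (λ v → P k j (v ∷ vs) (f (toℕ v))))
          ≡⟨ mean-∑-comm (allFin n) ks _ ⟩
        mean (allFin n) (λ v → ∑ ks (λ k → P k j (v ∷ vs) (f (toℕ v))))
          ≤⟨ mean-mono nonempty (λ v → ∑success≤ j (v ∷ vs) _) ⟩
        mean (allFin n) (λ v → A + M * N j (v ∷ vs) (f (toℕ v)))
          ≡⟨ mean-+ (allFin n) _ _ ⟩
        mean (allFin n) (λ _ → A) + mean (allFin n) (λ v → M * N j (v ∷ vs) (f (toℕ v)))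
          ≡⟨ cong₂ _+_ (mean-const nonempty A) (mean-*ˡ (allFin n) M _) ⟩
        A + M * mean (allFin n) (λ v → N j (v ∷ vs) (f (toℕ v)))
          ≤⟨ y≤x+y M-nonneg ⟩
        M + (A + M * mean (allFin n) (λ v → N j (v ∷ vs) (f (toℕ v)))) ∎)

-- The hard graph

-- Walks reach the target along src → mid → tgt.  A hub has its own leaves as
-- parents, and all its children are self-loops until a swap attaches it to a
-- mid.  The pads, with dums as children, supply the remaining edges and the
-- maximum out-degree; the extras supply the remaining nodes.
record Shape : Set where
  field
    levels groups width mids srcs dums pads extras : ℕ
    leaves : Fin levels → ℕ
    1≤width : 1 ℕ.≤ width
    1≤dums  : 1 ℕ.≤ dums

  Slot : Set
  Slot = Fin groups × Fin width

  field
    srcOf     : Slot → Fin srcs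
    midOf     : Slot → Fin mids
    slotAt    : Fin srcs → Fin mids → Slot
    -- A left inverse is what is wanted: distinct slots own distinct edges from a `src` to a `mid`,
    -- and an answer showing such an edge identifies its slot.
    slotAt-inverse : ∀ l → slotAt (srcOf l) (midOf l) ≡ l

  Hub Leaf Loop V : Set
  Hub  = Σ (Fin levels) λ _ → Fin groups
  Leaf = Σ (Fin levels) λ i → Σ (Fin groups) λ _ → Fin (leaves i)
  Loop = Fin width ⊎ Fin width ⊎ Fin dums ⊎ Fin extras
  V    = ⊤ ⊎ Fin mids ⊎ Fin srcs ⊎ Hub ⊎ Leaf ⊎ Fin pads ⊎ Loop

pattern tgt        = inj₁ tt
pattern mid i      = inj₂ (inj₁ i)
pattern src j      = inj₂ (inj₂ (inj₁ j))
pattern hub i g    = inj₂ (inj₂ (inj₂ (inj₁ (i , g))))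
pattern leaf i g x = inj₂ (inj₂ (inj₂ (inj₂ (inj₁ (i , g , x)))))
pattern pad q      = inj₂ (inj₂ (inj₂ (inj₂ (inj₂ (inj₁ q)))))
pattern loop l     = inj₂ (inj₂ (inj₂ (inj₂ (inj₂ (inj₂ l)))))
pattern out c      = loop (inj₁ c)
pattern alt c      = loop (inj₂ (inj₁ c))
pattern dum c      = loop (inj₂ (inj₂ (inj₁ c)))

module Construction (shape : Shape) where
  open Shape shape

  hub-finite : Finite Hub
  hub-finite = Σ-finite (Fin-finite levels) (λ _ → Fin-finite groups)

  leaf-finite : Finite Leaf
  leaf-finite = Σ-finite (Fin-finite levels) (λ i → Σ-finite (Fin-finite groups) (λ _ → Fin-finite (leaves i)))

  loop-finite : Finite Loop
  loop-finite = Fin-finite width ⊎-finite Fin-finite width ⊎-finite Fin-finite dums ⊎-finite Fin-finite extras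

  private
    V₅-finite = Fin-finite pads ⊎-finite loop-finite
    V₄-finite = leaf-finite ⊎-finite V₅-finite
    V₃-finite = hub-finite ⊎-finite V₄-finite
    V₂-finite = Fin-finite srcs ⊎-finite V₃-finite
    V₁-finite = Fin-finite mids ⊎-finite V₂-finite

  opaque
    V-finite : Finite V
    V-finite = ⊤-finite ⊎-finite V₁-finite

  module _ {C : Set} (_∙_ : C → C → C) (ε : C)
           (assoc : ∀ x y z → ((x ∙ y) ∙ z) ≡ (x ∙ (y ∙ z))) (identityˡ : ∀ x → (ε ∙ x) ≡ x) where
    open ListSum _∙_ ε assoc identityˡ

    opaque
      unfolding V-finite

      ∑-V : ∀ f → ∑ (Finite.elements V-finite) f ≡
            ((f tgt ∙ ε) ∙ (∑ (allFin mids) (λ i → f (mid i)) ∙ (∑ (allFin srcs) (λ j → f (src j)) ∙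
            (∑ (allFin levels) (λ i → ∑ (allFin groups) (λ g → f (hub i g))) ∙
            (∑ (allFin levels) (λ i → ∑ (allFin groups) (λ g → ∑ (allFin (leaves i)) (λ x → f (leaf i g x)))) ∙
            (∑ (allFin pads) (λ q → f (pad q)) ∙ ∑ (Finite.elements loop-finite) (λ l → f (loop l))))))))
      ∑-V f =
        trans (∑-⊎ ⊤-finite V₁-finite f) (cong ((f tgt ∙ ε) ∙_)
        (trans (∑-⊎ (Fin-finite mids) V₂-finite (f ∘ inj₂)) (cong (∑ (allFin mids) (λ i → f (mid i)) ∙_)
        (trans (∑-⊎ (Fin-finite srcs) V₃-finite (f ∘ inj₂ ∘ inj₂)) (cong (∑ (allFin srcs) (λ j → f (src j)) ∙_)
        (trans (∑-⊎ hub-finite V₄-finite (f ∘ inj₂ ∘ inj₂ ∘ inj₂)) (cong₂ _∙_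
          (∑-dependentProduct (allFin levels) (λ _ → allFin groups) (λ (i , g) → f (hub i g)))
        (trans (∑-⊎ leaf-finite V₅-finite (f ∘ inj₂ ∘ inj₂ ∘ inj₂ ∘ inj₂)) (cong₂ _∙_
          (trans (∑-dependentProduct (allFin levels)
                   (λ i → dependentProduct (allFin groups) (λ _ → allFin (leaves i))) (λ (i , g , x) → f (leaf i g x)))
                 (List.foldr-cong (λ i s → cong (_∙ s)
                   (∑-dependentProduct (allFin groups) (λ _ → allFin (leaves i)) (λ (g , x) → f (leaf i g x))))
                   refl (allFin levels)))
          (∑-⊎ (Fin-finite pads) loop-finite (f ∘ inj₂ ∘ inj₂ ∘ inj₂ ∘ inj₂ ∘ inj₂)))))))))))

  open Finite V-finite public using (elements; to; from; from-to; to-from; _≟_) renaming (size to order)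

  -- The loops `alt` dilute a `src`: a walk moves from it to a `mid` with probability at most `mids`
  -- / `width`. All sources share the `alt`s and all hubs share the `out`s, so these cost only 2
  -- `width` vertices.
  children : V → List V
  children tgt          = tgt ∷ []
  children (mid _)      = tgt ∷ []
  children (src _)      = map (λ i → mid i) (allFin mids) ++ map (λ c → alt c) (allFin width)
  children (hub _ _)    = map (λ c → out c) (allFin width)
  children (leaf i g _) = hub i g ∷ []
  children (pad _)      = map (λ c → dum c) (allFin dums)
  children (loop l)     = loop l ∷ []

  allFin≢[] : ∀ {n} → 1 ℕ.≤ n → allFin n ≢ []
  allFin≢[] (ℕ.s≤s _) ()

  children-unique : ∀ u → Unique (children u)
  children-unique tgt          = [] ∷ []
  children-unique (mid _)      = [] ∷ []
  children-unique (src _)      =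
    Unique.++⁺ (Unique.map⁺ (λ { refl → refl }) (Unique.allFin⁺ mids)) (Unique.map⁺ (λ { refl → refl }) (Unique.allFin⁺ width)) disjoint
    where
    disjoint : ∀ {z} → ¬ (z ∈ map (λ i → mid i) (allFin mids) × z ∈ map (λ c → alt c) (allFin width))
    disjoint (p , q) with ∈-map⁻ _ p | ∈-map⁻ _ q
    ... | _ , _ , refl | _ , _ , ()
  children-unique (hub _ _)    = Unique.map⁺ (λ { refl → refl }) (Unique.allFin⁺ width)
  children-unique (leaf _ _ _) = [] ∷ []
  children-unique (pad _)      = Unique.map⁺ (λ { refl → refl }) (Unique.allFin⁺ dums)
  children-unique (loop _)     = [] ∷ []

  children≢[] : ∀ u → children u ≢ []
  children≢[] tgt          = λ ()
  children≢[] (mid _)      = λ ()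
  children≢[] (src _)      = map≢[] (allFin≢[] 1≤width) ∘ List.++-conicalʳ (map (λ i → mid i) (allFin mids)) _
  children≢[] (hub _ _)    = map≢[] (allFin≢[] 1≤width)
  children≢[] (leaf _ _ _) = λ ()
  children≢[] (pad _)      = map≢[] (allFin≢[] 1≤dums)
  children≢[] (loop _)     = λ ()

  base : Digraph V
  base = fromChildren V-finite children children-unique children≢[]

  baseGraph : Graph
  baseGraph = toGraph (relabel V-finite base)

  open Transposition _≟_

  mid∈src : ∀ i j → mid i ∈ children (src j)
  mid∈src i j = ∈-++⁺ˡ (∈-map⁺ _ (∈-allFin i))

  out∈hub : ∀ i g c → out c ∈ children (hub i g)
  out∈hub i g c = ∈-map⁺ _ (∈-allFin c)

  out∉src : ∀ c j → out c ∉ children (src j)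
  out∉src c j p with ∈-++⁻ (map (λ i → mid i) (allFin mids)) p
  ... | inj₁ q with ∈-map⁻ _ q
  ...   | _ , _ , ()
  out∉src c j p | inj₂ q with ∈-map⁻ _ q
  ...   | _ , _ , ()

  mid∉hub : ∀ i i′ g → mid i ∉ children (hub i′ g)
  mid∉hub i i′ g p with ∈-map⁻ _ p
  ... | _ , _ , ()

  Index : Set
  Index = Fin levels × Slot

  slots : List Slot
  slots = cartesianProduct (allFin groups) (allFin width)

  slots-unique : Unique slots
  slots-unique = Unique.cartesianProduct⁺ (Unique.allFin⁺ groups) (Unique.allFin⁺ width)

  indices : List Index
  indices = cartesianProduct (allFin levels) slots

  -- After the swap, the hub points to a `mid` and the `src` to a loop. The edge near the target
  -- depends on the slot but not on the level, so that the levels do not multiply the number of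
  -- edges needed there.
  module Variant ((i , l) : Index) = Swap base {src (srcOf l)} {hub i (proj₁ l)} {mid (midOf l)} {out (proj₂ l)}

  variant : Index → Digraph V
  variant k@(i , l@(g , c)) =
    Variant.swap k (mid∈src (midOf l) (srcOf l)) (out∈hub i g c) (out∉src c (srcOf l)) (mid∉hub (midOf l) i g)

  -- The level of a hub is forgotten on purpose. An edge from a `src` to a `mid` takes part in the
  -- variants of all levels anyway, so every answer is charged to all levels of its slot; hence the
  -- budget `fromℕ levels` of a query.
  edgeSlot : V → V → Maybe Slot
  edgeSlot (src j)   (mid i) = just (slotAt j i)
  edgeSlot (hub i g) (out c) = just (g , c)
  edgeSlot _         _       = nothing

  _≟ₛ_ : DecidableEquality (Maybe Slot)
  _≟ₛ_ = Maybe.≡-dec (Product.≡-dec Fin._≟_ Fin._≟_)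

  edgeSlot-swapped : ∀ {i l u v} → u ≡ src (srcOf l) × v ≡ mid (midOf l) ⊎ u ≡ hub i (proj₁ l) × v ≡ out (proj₂ l) →
                     edgeSlot u v ≡ just l
  edgeSlot-swapped {l = l} (inj₁ (refl , refl)) = cong just (slotAt-inverse l)
  edgeSlot-swapped         (inj₂ (refl , refl)) = refl

  -- The slot is computed from the answer of the base graph alone and is therefore the same for all
  -- k. This is why one query cannot spoil variants of two slots.
  variant-child : ∀ k u a →
    head (drop a (Digraph.children (variant k) u)) ≡ head (drop a (Digraph.children base u)) ⊎
    (head (drop a (Digraph.children base u)) >>= edgeSlot u) ≡ just (proj₂ k)
  variant-child k@(i , l@(g , c)) u a
    with Variant.swap-child k (mid∈src (midOf l) (srcOf l)) (out∈hub i g c) (out∉src c (srcOf l)) (mid∉hub (midOf l) i g) u a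
  ... | inj₁ e            = inj₁ e
  ... | inj₂ (v , e , uv) = inj₂ (trans (cong (_>>= edgeSlot u) e) (edgeSlot-swapped {i} {l} uv))

  variant-parent : ∀ k v a →
    head (drop a (Digraph.parents (variant k) v)) ≡ head (drop a (Digraph.parents base v)) ⊎
    (head (drop a (Digraph.parents base v)) >>= λ u → edgeSlot u v) ≡ just (proj₂ k)
  variant-parent k@(i , l@(g , c)) v a
    with Variant.swap-parent k (mid∈src (midOf l) (srcOf l)) (out∈hub i g c) (out∉src c (srcOf l)) (mid∉hub (midOf l) i g) v a
  ... | inj₁ e            = inj₁ e
  ... | inj₂ (u , e , uv) = inj₂ (trans (cong (_>>= λ u → edgeSlot u v) e) (edgeSlot-swapped {i} {l} uv))

  module _ (𝓡 : Reals) where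
    open Reals 𝓡
    open OrderedField 𝓡
    open Sums 𝓡

    nodes≢[] : allFin order ≢ []
    nodes≢[] e with subst (to tgt ∈_) e (∈-allFin (to tgt))
    ... | ()

    open Coupling 𝓡 nodes≢[] (relabel V-finite base) indices (λ k → relabel V-finite (variant k)) (fromℕ levels)

    agree : ∀ {f : Index → List V} {xs : List V} {a o} →
            (∀ k → head (drop a (f k)) ≡ head (drop a xs) ⊎ o ≡ just (proj₂ k)) →
            AgreeUpTo (λ k → head (drop a (map to (f k)))) (head (drop a (map to xs)))
    agree {f} {xs} {a} {o} same = τ , compare , (begin
      ∑ indices τ
        ≡⟨ ∑-cartesianProduct (allFin levels) slots τ ⟩
      ∑ (allFin levels) (λ i → ∑ slots (λ l → τ (i , l)))
        ≤⟨ ∑-mono (allFin levels) (λ i → ∑-exclusive (λ l → just l ≟ₛ o) slots-unique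
             (λ p q → Maybe.just-injective (trans p (sym q)))) ⟩
      ∑ (allFin levels) (λ _ → 1#)
        ≡⟨ ∑-const (allFin levels) 1# ⟩
      fromℕ (length (allFin levels)) * 1#
        ≡⟨ trans (*-identityʳ _) (cong fromℕ (List.length-tabulate {n = levels} id)) ⟩
      fromℕ levels ∎)
      where
      open ≤-Reasoning
      τ : Index → ℝ
      τ (_ , l) = [ just l ≟ₛ o ]
      compare : ∀ k → head (drop a (map to (f k))) ≡ head (drop a (map to xs)) × 0# ≤ τ k ⊎ 1# ≤ τ k
      compare (i , l) with just l ≟ₛ o | same (i , l)
      ... | yes _  | _      = inj₂ ≤-refl
      ... | no l≢o | inj₂ e = contradiction (sym e) l≢o
      ... | no _   | inj₁ e = inj₁ (trans (head-drop-map to a (f (i , l)))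
                                     (trans (cong (Maybe.map to) e) (sym (head-drop-map to a xs))) , ≤-refl)

    variants-close : Close
    variants-close = record
      { M-nonneg = fromℕ-nonneg levels
      ; indeg-≡  = λ k v → length-map-≡ (Digraph.parents (variant k) (from v)) (Digraph.parents base (from v))
                             (switch-length (mid (midOf (proj₂ k))) _ (src (srcOf (proj₂ k))) _ (Digraph.parents base) (from v))
      ; outdeg-≡ = λ k u → length-map-≡ (Digraph.children (variant k) (from u)) (children (from u))
                             (switch-length (src (srcOf (proj₂ k))) _ (mid (midOf (proj₂ k))) _ children (from u))
      ; parent-≈ = λ v a → agree {f = λ k → Digraph.parents (variant k) (from v)} {a = a} (λ k → variant-parent k (from v) a)
      ; child-≈  = λ u a → agree {f = λ k → Digraph.children (variant k) (from u)} {a = a} (λ k → variant-child k (from u) a)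
      }
      where
      length-map-≡ : ∀ (xs ys : List V) → length xs ≡ length ys → length (map to xs) ≡ length (map to ys)
      length-map-≡ xs ys e = trans (List.length-map to xs) (trans e (sym (List.length-map to ys)))

-- PageRank of the target in the variants

module RelabelledPageRank (𝓡 : Reals) {V : Set} (F : Finite V) (nonempty : allFin (Finite.size F) ≢ [])
                          (G : Digraph V) where
  open Reals 𝓡
  open OrderedField 𝓡
  open Sums 𝓡
  open Finite F
  open Digraph G

  private
    Γ = toGraph (relabel F G)
  open PageRankBounds 𝓡 Γ using (walk-step; walk-zero-refl; pageRank-≤; pageRank-≥)

  mean-nodes : ∀ (f : V → ℝ) → mean (allFin size) (λ u → f (from u)) ≡ mean elements f
  mean-nodes f = trans (sym (mean-map from (allFin size) f)) (cong (λ xs → mean xs f) map-from-allFin)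

  walkV : ℕ → V → V → ℝ
  walkV ℓ u t = walk 𝓡 Γ ℓ (to u) (to t)

  walkV-zero : ∀ t → walkV 0 t t ≡ 1#
  walkV-zero t = walk-zero-refl (to t)

  walkV-step : ∀ {u v} → v ∈ children u → ∀ ℓ t →
               walkV ℓ v t * fromℕ (length (children u)) ⁻¹ ≤ walkV (suc ℓ) u t
  walkV-step {u} {v} v∈ ℓ t = subst (λ n → walkV ℓ v t * fromℕ n ⁻¹ ≤ walkV (suc ℓ) u t)
    (trans (List.length-map to (children (from (to u)))) (cong (length ∘ children) (from-to u)))
    (walk-step (subst (λ w → to v ∈ map to (children w)) (sym (from-to u)) (∈-map⁺ to v∈)) ℓ (to t))

  module _ {α} (0<α : 0# < α) (α<1 : α < 1#) where

    pageRankV-≤ : ∀ {h t} → (∀ u → 0# ≤ h u) → 1# ≤ h t → (∀ u → mean (children u) h ≤ h u) →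
                  pageRank 𝓡 Γ α (to t) ≤ mean elements h
    pageRankV-≤ {h} {t} 0≤h 1≤ht sh = subst (pageRank 𝓡 Γ α (to t) ≤_) (mean-nodes h)
      (pageRank-≤ 0<α α<1 nonempty {h ∘ from} (0≤h ∘ from) (subst (λ v → 1# ≤ h v) (sym (from-to t)) 1≤ht) λ u →
        subst (_≤ h (from u))
          (sym (trans (mean-map to (children (from u)) _) (mean-cong (children (from u)) (λ v → cong h (from-to v)))))
          (sh (from u)))

    pageRankV-≥ : ∀ ℓ t → mean elements (λ u → α * (1# - α) ^ ℓ * walkV ℓ u t) ≤ pageRank 𝓡 Γ α (to t)
    pageRankV-≥ ℓ t = subst (_≤ pageRank 𝓡 Γ α (to t))
      (trans (mean-cong (allFin size) (λ s → cong (λ w → α * (1# - α) ^ ℓ * walk 𝓡 Γ ℓ w (to t)) (sym (to-from s))))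
             (mean-nodes (λ u → α * (1# - α) ^ ℓ * walkV ℓ u t)))
      (pageRank-≥ 0<α α<1 nonempty ℓ (to t))

module VariantPageRank (𝓡 : Reals) (shape : Shape) where
  open Reals 𝓡
  open OrderedField 𝓡
  open Sums 𝓡
  open Shape shape
  open Construction shape
  open Transposition _≟_

  d a : ℝ
  d = fromℕ width
  a = fromℕ mids

  δ ν : ℝ
  δ = d ⁻¹
  ν = fromℕ order ⁻¹

  0<d : 0# < d
  0<d = fromℕ-pos {width} 1≤width

  0<δ : 0# < δ
  0<δ = ⁻¹-pos 0<d

  0≤δ : 0# ≤ δ
  0≤δ = <⇒≤ 0<δ

  1≤order : 1 ℕ.≤ order
  1≤order with order | to tgt
  ... | suc _ | _ = ℕ.s≤s ℕ.z≤n

  0<ν : 0# < ν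
  0<ν = ⁻¹-pos (fromℕ-pos {order} 1≤order)

  module _ (i₀ : Fin levels) (g₀ : Fin groups) (c₀ : Fin width) where

    private
      l₀ = g₀ , c₀
      k₀ = i₀ , l₀
      G = variant k₀
      τ = transpose (mid (midOf l₀)) (out c₀)
      open RelabelledPageRank 𝓡 V-finite (nodes≢[] 𝓡) G

      -- Only the swapped hub can lead to the target, through one of its `width` children, hence
      -- with probability δ. The product of brackets lets `∑-select` evaluate the sums over levels
      -- and groups.
      χ : Fin levels → Fin groups → ℝ
      χ i g = [ i Fin.≟ i₀ ] * ([ g Fin.≟ g₀ ] * δ)

      χ-nonneg : ∀ i g → 0# ≤ χ i g
      χ-nonneg i g = *-nonneg ([]-nonneg (i Fin.≟ i₀)) (*-nonneg ([]-nonneg (g Fin.≟ g₀)) 0≤δ)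

      χ-at : χ i₀ g₀ ≡ δ
      χ-at with i₀ Fin.≟ i₀ | g₀ Fin.≟ g₀
      ... | yes _ | yes _ = trans (*-identityˡ _) (*-identityˡ _)
      ... | no ¬p | _     = contradiction refl ¬p
      ... | yes _ | no ¬p = contradiction refl ¬p

      -- An upper bound for the probability that a walk ever meets the target.
      h : V → ℝ
      h tgt          = 1#
      h (mid _)      = 1#
      h (src _)      = a * δ
      h (hub i g)    = χ i g
      h (leaf i g _) = χ i g
      h (pad _)      = 0#
      h (loop _)     = 0#

      0≤aδ : 0# ≤ a * δ
      0≤aδ = *-nonneg (fromℕ-nonneg mids) 0≤δ

      h-nonneg : ∀ u → 0# ≤ h u
      h-nonneg tgt          = 0≤1
      h-nonneg (mid _)      = 0≤1
      h-nonneg (src _)      = 0≤aδ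
      h-nonneg (hub i g)    = χ-nonneg i g
      h-nonneg (leaf i g _) = χ-nonneg i g
      h-nonneg (pad _)      = ≤-refl
      h-nonneg (loop _)     = ≤-refl

      length-out : length (children (hub i₀ g₀)) ≡ width
      length-out = trans (List.length-map _ (allFin width)) (List.length-tabulate {n = width} id)

      -- The function is general because the `src` that takes part in the swap is treated with f =
      -- `h ∘ τ`, where one `mid` has turned into a loop and only lowers the mean.
      mean-src : ∀ j (f : V → ℝ) → (∀ i → f (mid i) ≤ 1#) → (∀ c → f (alt c) ≤ 0#) →
                 mean (children (src j)) f ≤ a * δ
      mean-src j f f≤1 f≤0 = x≤y*z⇒x*z⁻¹≤y (length-pos (children≢[] (src j))) (begin
        ∑ (children (src j)) f
          ≡⟨ ∑-++ (map (λ i → mid i) (allFin mids)) _ f ⟩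
        ∑ (map (λ i → mid i) (allFin mids)) f + ∑ (map (λ c → alt c) (allFin width)) f
          ≡⟨ cong₂ _+_ (∑-map _ (allFin mids) f) (∑-map _ (allFin width) f) ⟩
        ∑ (allFin mids) (λ i → f (mid i)) + ∑ (allFin width) (λ c → f (alt c))
          ≤⟨ +-mono-≤ (∑-mono (allFin mids) f≤1) (∑-mono (allFin width) f≤0) ⟩
        ∑ (allFin mids) (λ _ → 1#) + ∑ (allFin width) (λ _ → 0#)
          ≡⟨ cong₂ _+_ (trans (∑-allFin-const mids 1#) (*-identityʳ a)) (∑-zero (allFin width)) ⟩
        a + 0#
          ≡⟨ +-identityʳ a ⟩
        a
          ≡⟨ x*y⁻¹*y≡x a 0<d ⟨
        a * δ * d
          ≤⟨ *-monoʳ-≤ 0≤aδ (fromℕ-mono-≤ {width} {length (children (src j))} width≤) ⟩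
        a * δ * fromℕ (length (children (src j))) ∎)
        where
        open ≤-Reasoning
        width≤ : width ℕ.≤ length (children (src j))
        width≤ = subst (width ℕ.≤_) (sym (List.length-++ (map (λ i → mid i) (allFin mids))))
          (ℕ.≤-trans (ℕ.≤-reflexive (sym (trans (List.length-map _ (allFin width)) (List.length-tabulate {n = width} id))))
                     (ℕ.m≤n+m _ _))

      base-superharmonic : ∀ u → mean (children u) h ≤ h u
      base-superharmonic tgt          = ≤-reflexive (mean-singleton {A = V} tgt h)
      base-superharmonic (mid _)      = ≤-reflexive (mean-singleton {A = V} tgt h)
      base-superharmonic (src j)      = mean-src j h (λ _ → ≤-refl) (λ _ → ≤-refl)
      base-superharmonic (hub i g)    = ≤-trans (≤-reflexive
        (trans (cong (_* _) (trans (∑-map _ (allFin width) h) (∑-zero (allFin width)))) (zeroˡ _))) (χ-nonneg i g)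
      base-superharmonic (leaf i g x) = ≤-reflexive (mean-singleton {A = V} (hub i g) h)
      base-superharmonic (pad _)      = ≤-reflexive
        (trans (cong (_* _) (trans (∑-map _ (allFin dums) h) (∑-zero (allFin dums)))) (zeroˡ _))
      base-superharmonic (loop l)     = ≤-reflexive (mean-singleton {A = V} (loop l) h)

      h∘τ-mid : ∀ i → h (τ (mid i)) ≤ 1#
      h∘τ-mid i with mid i ≟ mid (midOf l₀) | mid i ≟ out c₀
      ... | yes _ | _     = 0≤1
      ... | no _  | yes _ = ≤-refl
      ... | no _  | no _  = ≤-refl

      h∘τ-alt : ∀ c → h (τ (alt c)) ≤ 0#
      h∘τ-alt c = ≤-reflexive (cong h (transpose-other {mid (midOf l₀)} {out c₀} (λ ()) (λ ())))

      h∘τ-out : ∀ c → h (τ (out c)) ≤ [ c Fin.≟ c₀ ]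
      h∘τ-out c with c Fin.≟ c₀
      ... | yes refl = ≤-reflexive (cong h (transpose-right (mid (midOf l₀)) (out c₀)))
      ... | no c≢c₀  = ≤-reflexive (cong h (transpose-other {mid (midOf l₀)} {out c₀} (λ ()) (λ { refl → c≢c₀ refl })))

      superharmonic : ∀ u → mean (Digraph.children G u) h ≤ h u
      superharmonic u with switch-elim (src (srcOf l₀)) (hub i₀ g₀) (mid (midOf l₀)) (out c₀) children u
      ... | inj₁ (_ , _ , e) = subst (λ xs → mean xs h ≤ h u) (sym e) (base-superharmonic u)
      ... | inj₂ (inj₁ refl , e) = subst (λ xs → mean xs h ≤ h u) (sym e)
            (subst (_≤ a * δ) (sym (mean-map τ (children (src (srcOf l₀))) h))
              (mean-src (srcOf l₀) (h ∘ τ) h∘τ-mid h∘τ-alt))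
      ... | inj₂ (inj₂ refl , e) = subst (λ xs → mean xs h ≤ h u) (sym e)
            (subst (_≤ χ i₀ g₀) (sym (mean-map τ (children (hub i₀ g₀)) h)) (begin
              ∑ (children (hub i₀ g₀)) (h ∘ τ) * fromℕ (length (children (hub i₀ g₀))) ⁻¹
                ≡⟨ cong₂ (λ s n → s * fromℕ n ⁻¹) (∑-map _ (allFin width) (h ∘ τ)) length-out ⟩
              ∑ (allFin width) (λ c → h (τ (out c))) * δ
                ≤⟨ *-monoˡ-≤ 0≤δ (≤-trans (∑-mono (allFin width) h∘τ-out)
                     (∑-exclusive (Fin._≟ c₀) (Unique.allFin⁺ width) (λ p q → trans p (sym q)))) ⟩
              1# * δ  ≡⟨ *-identityˡ δ ⟩
              δ       ≡⟨ χ-at ⟨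
              χ i₀ g₀ ∎))
        where open ≤-Reasoning

      ∑h : ∑ elements h ≡ 1# + (a + (fromℕ srcs * (a * δ) + (δ + fromℕ (leaves i₀) * δ)))
      ∑h = begin
        ∑ elements h
          ≡⟨ ∑-V _+_ 0# +-assoc +-identityˡ h ⟩
        _ ≡⟨ cong₂ _+_ (+-identityʳ 1#) (cong₂ _+_ (trans (∑-allFin-const mids 1#) (*-identityʳ a))
             (cong₂ _+_ (∑-allFin-const srcs (a * δ)) (cong₂ _+_ hubs (trans (cong₂ _+_ leafs
               (trans (cong₂ _+_ (∑-zero (allFin pads)) (∑-zero (Finite.elements loop-finite))) (+-identityˡ 0#))) (+-identityʳ _))))) ⟩
        1# + (a + (fromℕ srcs * (a * δ) + (δ + fromℕ (leaves i₀) * δ))) ∎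
        where
        open ≡-Reasoning
        hubs : ∑ (allFin levels) (λ i → ∑ (allFin groups) (λ g → χ i g)) ≡ δ
        hubs = trans (∑-cong (allFin levels) (λ i → trans (∑-*ˡ (allFin groups) [ i Fin.≟ i₀ ] _)
                       (cong ([ i Fin.≟ i₀ ] *_) (∑-select g₀ (λ _ → δ)))))
                     (∑-select i₀ (λ _ → δ))
        leafs : ∑ (allFin levels) (λ i → ∑ (allFin groups) (λ g → ∑ (allFin (leaves i)) (λ _ → χ i g))) ≡ fromℕ (leaves i₀) * δ
        leafs = trans (∑-cong (allFin levels) (λ i →
            trans (∑-cong (allFin groups) (λ g → trans (∑-allFin-const (leaves i) (χ i g))
              (solve 4 (λ n x y z → n :* (x :* (y :* z)) := x :* (y :* (n :* z))) refl
                (fromℕ (leaves i)) [ i Fin.≟ i₀ ] [ g Fin.≟ g₀ ] δ)))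
            (trans (∑-*ˡ (allFin groups) [ i Fin.≟ i₀ ] _)
              (cong ([ i Fin.≟ i₀ ] *_) (∑-select g₀ (λ _ → fromℕ (leaves i) * δ))))))
          (∑-select i₀ (λ i → fromℕ (leaves i) * δ))

    module _ {α} (0<α : 0# < α) (α<1 : α < 1#) where

      private
        -- The probability that a walk has length 3, the length of the path from a leaf through its
        -- hub and a `mid` to the target.
        β = α * (1# - α) ^ 3

      -- In units of δν, the parts of `∑h` are d for the target, a d for the mids, s a for the
      -- sources, 1 for the hub and n for its leaves. The hypothesis says that the first four
      -- together do not exceed the last, whence the factor 2.
      variant-pageRank-≤ : width ℕ.+ mids ℕ.* width ℕ.+ srcs ℕ.* mids ℕ.+ 1 ℕ.≤ leaves i₀ →
        pageRank 𝓡 (toGraph (relabel V-finite G)) α (to tgt) ≤ fromℕ (leaves i₀ ℕ.+ leaves i₀) * (δ * ν)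
      variant-pageRank-≤ few = ≤-trans (pageRankV-≤ 0<α α<1 h-nonneg ≤-refl superharmonic) (begin
        ∑ elements h * ν
          ≡⟨ cong (_* ν) ∑h ⟩
        (1# + (a + (s * (a * δ) + (δ + n * δ)))) * ν
          ≡⟨ cong (λ x → (x + (a + (s * (a * δ) + (δ + n * δ)))) * ν) (*-inverseʳ (proj₂ 0<d ∘ sym)) ⟨
        (d * δ + (a + (s * (a * δ) + (δ + n * δ)))) * ν
          ≡⟨ cong (λ x → (d * δ + (x + (s * (a * δ) + (δ + n * δ)))) * ν)
               (trans (*-assoc a d δ) (trans (cong (a *_) (*-inverseʳ (proj₂ 0<d ∘ sym))) (*-identityʳ a))) ⟨
        (d * δ + (a * d * δ + (s * (a * δ) + (δ + n * δ)))) * ν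
          ≡⟨ cong (λ x → (d * δ + (a * d * δ + (s * (a * δ) + (x + n * δ)))) * ν) (*-identityˡ δ) ⟨
        (d * δ + (a * d * δ + (s * (a * δ) + (1# * δ + n * δ)))) * ν
          ≡⟨ solve 7 (λ d a s o n δ ν → (d :* δ :+ (a :* d :* δ :+ (s :* (a :* δ) :+ (o :* δ :+ n :* δ)))) :* ν :=
                                        (d :+ a :* d :+ s :* a :+ o :+ n) :* (δ :* ν)) refl d a s 1# n δ ν ⟩
        (d + a * d + s * a + 1# + n) * (δ * ν)
          ≡⟨ cong (_* (δ * ν)) collect ⟨
        fromℕ (few′ ℕ.+ leaves i₀) * (δ * ν)
          ≤⟨ *-monoˡ-≤ (*-nonneg 0≤δ (<⇒≤ 0<ν))
               (fromℕ-mono-≤ {few′ ℕ.+ leaves i₀} {leaves i₀ ℕ.+ leaves i₀} (ℕ.+-monoˡ-≤ (leaves i₀) few)) ⟩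
        fromℕ (leaves i₀ ℕ.+ leaves i₀) * (δ * ν) ∎)
        where
        open ≤-Reasoning
        s = fromℕ srcs
        n = fromℕ (leaves i₀)
        few′ = width ℕ.+ mids ℕ.* width ℕ.+ srcs ℕ.* mids ℕ.+ 1
        collect : fromℕ (few′ ℕ.+ leaves i₀) ≡ d + a * d + s * a + 1# + n
        collect = trans (fromℕ-+ few′ (leaves i₀)) (cong (_+ n)
          (trans (fromℕ-+ (width ℕ.+ mids ℕ.* width ℕ.+ srcs ℕ.* mids) 1) (cong₂ _+_
            (trans (fromℕ-+ (width ℕ.+ mids ℕ.* width) (srcs ℕ.* mids))
              (cong₂ _+_ (trans (fromℕ-+ width (mids ℕ.* width)) (cong (d +_) (fromℕ-* mids width))) (fromℕ-* srcs mids)))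
            fromℕ-1)))

      private
        mid∈hub : mid (midOf l₀) ∈ Digraph.children G (hub i₀ g₀)
        mid∈hub with switch-elim (src (srcOf l₀)) (hub i₀ g₀) (mid (midOf l₀)) (out c₀) children (hub i₀ g₀)
        ... | inj₁ (_ , ne , _) = contradiction refl ne
        ... | inj₂ (_ , e) = subst (mid (midOf l₀) ∈_) (sym e)
              (subst (_∈ map τ (children (hub i₀ g₀))) (transpose-right (mid (midOf l₀)) (out c₀)) (∈-map⁺ τ (out∈hub i₀ g₀ c₀)))

        unswitched : ∀ u → u ≢ src (srcOf l₀) → u ≢ hub i₀ g₀ → Digraph.children G u ≡ children u
        unswitched u u≢p u≢q with switch-elim (src (srcOf l₀)) (hub i₀ g₀) (mid (midOf l₀)) (out c₀) children u
        ... | inj₁ (_ , _ , e)    = e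
        ... | inj₂ (inj₁ e , _)   = contradiction e u≢p
        ... | inj₂ (inj₂ e , _)   = contradiction e u≢q

        walkV-only : ∀ {u v} → u ≢ src (srcOf l₀) → u ≢ hub i₀ g₀ → children u ≡ v ∷ [] →
                     ∀ ℓ → walkV ℓ v tgt ≤ walkV (suc ℓ) u tgt
        walkV-only {u} {v} u≢p u≢q only ℓ = subst (_≤ walkV (suc ℓ) u tgt)
          (trans (cong (λ xs → walkV ℓ v tgt * fromℕ (length xs) ⁻¹) e) (trans (cong (walkV ℓ v tgt *_) 1⁻¹≡1) (*-identityʳ _)))
          (walkV-step (subst (v ∈_) (sym e) (here refl)) ℓ tgt)
          where e = trans (unswitched u u≢p u≢q) only

        walk-leaf : ∀ x → δ ≤ walkV 3 (leaf i₀ g₀ x) tgt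
        walk-leaf x = begin
          δ                          ≡⟨ *-identityˡ δ ⟨
          1# * δ                     ≡⟨ cong (_* δ) (walkV-zero tgt) ⟨
          walkV 0 tgt tgt * δ        ≤⟨ *-monoˡ-≤ 0≤δ (walkV-only {mid (midOf l₀)} {tgt} (λ ()) (λ ()) refl 0) ⟩
          walkV 1 (mid (midOf l₀)) tgt * δ ≡⟨ cong (λ n → walkV 1 (mid (midOf l₀)) tgt * fromℕ n ⁻¹) same-length ⟨
          walkV 1 (mid (midOf l₀)) tgt * fromℕ (length (Digraph.children G (hub i₀ g₀))) ⁻¹ ≤⟨ walkV-step mid∈hub 1 tgt ⟩
          walkV 2 (hub i₀ g₀) tgt    ≤⟨ walkV-only {leaf i₀ g₀ x} {hub i₀ g₀} (λ ()) (λ ()) refl 2 ⟩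
          walkV 3 (leaf i₀ g₀ x) tgt ∎
          where
          open ≤-Reasoning
          same-length : length (Digraph.children G (hub i₀ g₀)) ≡ width
          same-length = trans (switch-length (src (srcOf l₀)) (hub i₀ g₀) (mid (midOf l₀)) (out c₀) children (hub i₀ g₀)) length-out

        0≤β : 0# ≤ β
        0≤β = *-nonneg (<⇒≤ 0<α) (^-nonneg (0≤y-x (<⇒≤ α<1)) 3)

        ∑≥ : ∀ (f : V → ℝ) → (∀ u → 0# ≤ f u) → ∑ (allFin (leaves i₀)) (λ x → f (leaf i₀ g₀ x)) ≤ ∑ elements f
        ∑≥ f 0≤f = begin
          ∑ (allFin (leaves i₀)) (λ x → f (leaf i₀ g₀ x))
            ≤⟨ term≤∑ {f = λ g → ∑ (allFin (leaves i₀)) (λ x → f (leaf i₀ g x))} (λ g → ∑-nonneg (allFin (leaves i₀)) (λ x → 0≤f _)) (∈-allFin g₀) ⟩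
          ∑ (allFin groups) (λ g → ∑ (allFin (leaves i₀)) (λ x → f (leaf i₀ g x)))
            ≤⟨ term≤∑ {f = λ i → ∑ (allFin groups) (λ g → ∑ (allFin (leaves i)) (λ x → f (leaf i g x)))}
                 (λ i → ∑-nonneg (allFin groups) (λ g → ∑-nonneg (allFin (leaves i)) (λ x → 0≤f _))) (∈-allFin i₀) ⟩
          ∑ (allFin levels) (λ i → ∑ (allFin groups) (λ g → ∑ (allFin (leaves i)) (λ x → f (leaf i g x))))
            ≤⟨ x≤x+y (+-nonneg (∑-nonneg (allFin pads) (λ q → 0≤f _)) (∑-nonneg (Finite.elements loop-finite) (λ l → 0≤f _))) ⟩
          _ ≤⟨ y≤x+y (∑-nonneg (allFin levels) (λ i → ∑-nonneg (allFin groups) (λ g → 0≤f _))) ⟩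
          _ ≤⟨ y≤x+y (∑-nonneg (allFin srcs) (λ j → 0≤f _)) ⟩
          _ ≤⟨ y≤x+y (∑-nonneg (allFin mids) (λ j → 0≤f _)) ⟩
          _ ≤⟨ y≤x+y (+-nonneg (0≤f tgt) ≤-refl) ⟩
          _ ≡⟨ ∑-V _+_ 0# +-assoc +-identityˡ f ⟨
          ∑ elements f ∎
          where open ≤-Reasoning

      variant-pageRank-≥ : fromℕ (leaves i₀) * β * (δ * ν) ≤
                           pageRank 𝓡 (toGraph (relabel V-finite G)) α (to tgt)
      variant-pageRank-≥ = ≤-trans (begin
        fromℕ (leaves i₀) * β * (δ * ν)
          ≡⟨ solve 4 (λ n b δ ν → n :* b :* (δ :* ν) := n :* (b :* δ) :* ν) refl (fromℕ (leaves i₀)) β δ ν ⟩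
        fromℕ (leaves i₀) * (β * δ) * ν
          ≡⟨ cong (_* ν) (∑-allFin-const (leaves i₀) (β * δ)) ⟨
        ∑ (allFin (leaves i₀)) (λ _ → β * δ) * ν
          ≤⟨ *-monoˡ-≤ (<⇒≤ 0<ν) (≤-trans (∑-mono (allFin (leaves i₀)) (λ x → *-monoʳ-≤ 0≤β (walk-leaf x)))
               (∑≥ (λ u → β * walkV 3 u tgt) (λ u → *-nonneg 0≤β (walk-nonneg′ u)))) ⟩
        mean elements (λ u → β * walkV 3 u tgt) ∎) (pageRankV-≥ 0<α α<1 3 tgt)
        where
        open ≤-Reasoning
        walk-nonneg′ : ∀ u → 0# ≤ walkV 3 u tgt
        walk-nonneg′ u = PageRankBounds.walk-nonneg 𝓡 (toGraph (relabel V-finite G)) 3 (to u) (to tgt)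

-- From success probabilities to the expected number of queries

module QueryBound (𝓡 : Reals) (shape : Shape) where
  open Reals 𝓡
  open OrderedField 𝓡
  open Sums 𝓡
  open Shape shape
  open Construction shape
  open VariantPageRank 𝓡 shape

  module _ {α} (0<α : 0# < α) (α<1 : α < 1#) {γ} (1≤γ : 1# ≤ γ) {p} (1≤p : 1 ℕ.≤ p)
           (levels≡4p : levels ≡ 4 ℕ.* p)
           (Γ : ℕ) (Γ-large : (γ * γ) * fromℕ 2 < fromℕ Γ * (α * (1# - α) ^ 3))
           (growth : ∀ {i j} → i Fin.< j → Γ ℕ.* leaves i ℕ.≤ leaves j)
           (few : ∀ i → width ℕ.+ mids ℕ.* width ℕ.+ srcs ℕ.* mids ℕ.+ 1 ℕ.≤ leaves i) where

    private
      β = α * (1# - α) ^ 3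

      graph : Index → Graph
      graph k = toGraph (relabel V-finite (variant k))

      t : Fin order
      t = to tgt

      π : Index → ℝ
      π k = pageRank 𝓡 (graph k) α t

      Accurate : ℝ → Index → Set
      Accurate x k = π k ≤ γ * x × x ≤ γ * π k

      accurate? : ∀ x k → Dec (Accurate x k)
      accurate? x k = (π k ≤? γ * x) ×-dec (x ≤? γ * π k)

      0≤γ : 0# ≤ γ
      0≤γ = ≤-trans 0≤1 1≤γ

      0<β : 0# < β
      0<β = *-pos 0<α (^-pos (0<y-x α<1) 3)

      0<δν : 0# < δ * ν
      0<δν = *-pos 0<δ 0<ν

      -- On level i, π lies between β and 2 times `leaves i` · δν. An x accurate on both levels
      -- would make the two values of π differ by at most γ², whereas the leaves grow by a factor Γ
      -- with Γ β > 2 γ².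
      separated : ∀ x {i j} l → i Fin.< j → Accurate x (i , l) → ¬ Accurate x (j , l)
      separated x {i} {j} l@(g , c) i<j (_ , x≤γπ) (π′≤γx , _) = <⇒≱ Γ-large
        (*-cancelʳ-≤ 0<n (*-cancelʳ-≤ 0<δν (begin
          fromℕ Γ * β * n * (δ * ν)
            ≡⟨ cong (_* (δ * ν)) (trans (solve 3 (λ a b c → a :* b :* c := a :* c :* b) refl (fromℕ Γ) β n)
                                        (cong (_* β) (sym (fromℕ-* Γ (leaves i))))) ⟩
          fromℕ (Γ ℕ.* leaves i) * β * (δ * ν)
            ≤⟨ *-monoˡ-≤ (<⇒≤ 0<δν) (*-monoˡ-≤ (<⇒≤ 0<β) (fromℕ-mono-≤ {Γ ℕ.* leaves i} {leaves j} (growth i<j))) ⟩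
          fromℕ (leaves j) * β * (δ * ν)      ≤⟨ variant-pageRank-≥ j g c 0<α α<1 ⟩
          π (j , l)                           ≤⟨ π′≤γx ⟩
          γ * x                               ≤⟨ *-monoʳ-≤ 0≤γ x≤γπ ⟩
          γ * (γ * π (i , l))                 ≤⟨ *-monoʳ-≤ 0≤γ (*-monoʳ-≤ 0≤γ (variant-pageRank-≤ i g c 0<α α<1 (few i))) ⟩
          γ * (γ * (fromℕ (leaves i ℕ.+ leaves i) * (δ * ν)))
            ≡⟨ cong (λ z → γ * (γ * (z * (δ * ν)))) twice ⟩
          γ * (γ * (fromℕ 2 * n * (δ * ν)))   ≡⟨ solve 4 (λ a b c d → a :* (a :* (b :* c :* d)) := a :* a :* b :* c :* d) refl γ (fromℕ 2) n (δ * ν) ⟩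
          (γ * γ) * fromℕ 2 * n * (δ * ν)     ∎)))
        where
        open ≤-Reasoning
        n = fromℕ (leaves i)
        0<n : 0# < n
        0<n = fromℕ-pos {leaves i} (ℕ.≤-trans (ℕ.m≤n+m 1 _) (few i))
        twice : fromℕ (leaves i ℕ.+ leaves i) ≡ fromℕ 2 * n
        twice = trans (cong fromℕ (cong (leaves i ℕ.+_) (sym (ℕ.+-identityʳ (leaves i))))) (fromℕ-* 2 (leaves i))

      exclusive : ∀ x l {i j} → Accurate x (i , l) → Accurate x (j , l) → i ≡ j
      exclusive x l {i} {j} p q = decide (Fin.<-cmp i j)
        where
        decide : Tri (i Fin.< j) (i ≡ j) (j Fin.< i) → i ≡ j
        decide (tri< i<j _ _) = contradiction q (separated x {i} {j} l i<j p)
        decide (tri≈ _ i≡j _) = i≡j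
        decide (tri> _ _ j<i) = contradiction p (separated x {j} {i} l j<i q)

      L : ℕ
      L = groups ℕ.* width

      length-slots : length slots ≡ L
      length-slots = trans (length-cartesianProduct (allFin groups) (allFin width))
        (cong₂ ℕ._*_ (List.length-tabulate {n = groups} id) (List.length-tabulate {n = width} id))

      length-indices : length indices ≡ levels ℕ.* L
      length-indices = trans (length-cartesianProduct (allFin levels) slots)
        (cong₂ ℕ._*_ (List.length-tabulate {n = levels} id) length-slots)

      ∑accurate≤L : ∀ x → ∑ indices (λ k → [ accurate? x k ]) ≤ fromℕ L
      ∑accurate≤L x = begin
        ∑ indices (λ k → [ accurate? x k ])
          ≡⟨ ∑-cartesianProduct (allFin levels) slots _ ⟩
        ∑ (allFin levels) (λ i → ∑ slots (λ l → [ accurate? x (i , l) ]))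
          ≡⟨ ∑-∑-comm (allFin levels) slots (λ i l → [ accurate? x (i , l) ]) ⟩
        ∑ slots (λ l → ∑ (allFin levels) (λ i → [ accurate? x (i , l) ]))
          ≤⟨ ∑-mono slots (λ l → ∑-exclusive (λ i → accurate? x (i , l)) (Unique.allFin⁺ levels) (exclusive x l)) ⟩
        ∑ slots (λ _ → 1#)
          ≡⟨ trans (∑-const slots 1#) (trans (*-identityʳ _) (cong fromℕ length-slots)) ⟩
        fromℕ L ∎
        where open ≤-Reasoning

      -- The success probabilities are suprema over cut-offs, but the coupling compares runs with
      -- one cut-off. As the variants are finitely many and the payoffs monotone, the largest of
      -- their cut-offs works for all.
      commonCutoff : ∀ {K : Set} (ks : List K) {y} (P : K → ℕ → ℝ) → (∀ k {i j} → i ℕ.≤ j → P k i ≤ P k j) →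
        (∀ k → ∃ λ j → y < P k j) → ∃ λ j → ∀ j′ → j ℕ.≤ j′ → fromℕ (length ks) * y ≤ ∑ ks (λ k → P k j′)
      commonCutoff []       {y} P mono ev = 0 , λ _ _ → ≤-reflexive (zeroˡ y)
      commonCutoff (k ∷ ks) {y} P mono ev =
        let j₁ , y<P = ev k
            j₂ , p   = commonCutoff ks P mono ev
        in j₁ ℕ.⊔ j₂ , λ j′ j≤j′ →
          subst (_≤ P k j′ + ∑ ks (λ k → P k j′)) (trans (cong (_+ fromℕ (length ks) * y) (sym (*-identityˡ y))) (sym (distribʳ y 1# (fromℕ (length ks)))))
            (+-mono-≤ (≤-trans (<⇒≤ y<P) (mono k (ℕ.≤-trans (ℕ.m≤m⊔n j₁ j₂) j≤j′)))
                      (p j′ (ℕ.≤-trans (ℕ.m≤n⊔m j₁ j₂) j≤j′)))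

      0<p : 0# < fromℕ p
      0<p = fromℕ-pos {p} 1≤p

      1≤2p : 1 ℕ.≤ p ℕ.+ p
      1≤2p = ℕ.≤-trans 1≤p (ℕ.m≤m+n p p)

      -- Strictly below 1/p, so that each variant reaches it at a finite cut-off. The loss of a
      -- factor 2 is the reason for 4p levels.
      y : ℝ
      y = fromℕ (p ℕ.+ p) ⁻¹

      y<1/p : y < fromℕ p ⁻¹
      y<1/p = ≰⇒> λ 1/p≤y → <⇒≱ 0<1 (+-cancelʳ-≤ 1# (begin
        1# + 1#                               ≡⟨ cong₂ _+_ (*-inverseˡ 0<p) (*-inverseˡ 0<p) ⟨
        fromℕ p ⁻¹ * fromℕ p + fromℕ p ⁻¹ * fromℕ p ≡⟨ distribˡ _ _ _ ⟨
        fromℕ p ⁻¹ * (fromℕ p + fromℕ p)      ≡⟨ cong (fromℕ p ⁻¹ *_) (fromℕ-+ p p) ⟨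
        fromℕ p ⁻¹ * fromℕ (p ℕ.+ p)          ≤⟨ *-monoˡ-≤ (fromℕ-nonneg (p ℕ.+ p)) 1/p≤y ⟩
        y * fromℕ (p ℕ.+ p)                   ≡⟨ *-inverseˡ (fromℕ-pos {p ℕ.+ p} 1≤2p) ⟩
        1#                                    ≡⟨ +-identityˡ 1# ⟨
        0# + 1#                               ∎))
        where open ≤-Reasoning

    -- The guarantee on B is invoked on the variants only, while the queries are counted on the base
    -- graph. The variants of each slot demand total success 2; the L cancelled below is the share
    -- that outputs can supply, and the queries must pay for the other L.
    queries : (B : Algorithm 𝓡) → Estimates 𝓡 α γ (fromℕ p ⁻¹) B →
              ∃ λ j → fromℕ (groups ℕ.* width) ≤ fromℕ (4 ℕ.* p) * expectedQueries 𝓡 B baseGraph t j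
    queries B estimates = j , +-cancelʳ-≤ (fromℕ L) (begin
        fromℕ L + fromℕ L
          ≡⟨ cong₂ _+_ one one ⟩
        y * fromℕ (p ℕ.+ p) * fromℕ L + y * fromℕ (p ℕ.+ p) * fromℕ L
          ≡⟨ solve 3 (λ y q l → y :* q :* l :+ y :* q :* l := (q :+ q) :* l :* y) refl y (fromℕ (p ℕ.+ p)) (fromℕ L) ⟩
        (fromℕ (p ℕ.+ p) + fromℕ (p ℕ.+ p)) * fromℕ L * y
          ≡⟨ cong (λ z → z * fromℕ L * y) four ⟩
        fromℕ levels * fromℕ L * y
          ≡⟨ cong (_* y) (trans (sym (fromℕ-* levels L)) (cong fromℕ (sym length-indices))) ⟩
        fromℕ (length indices) * y
          ≤⟨ proj₂ common j ℕ.≤-refl ⟩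
        ∑ indices (λ k → P k j)
          ≤⟨ ∑success≤ (variants-close 𝓡) B (λ k x → [ accurate? x k ]) (fromℕ L) (fromℕ-nonneg L)
               (λ k x → []-nonneg (accurate? x k)) (λ k x → []-≤1 (accurate? x k)) ∑accurate≤L j (t ∷ []) _ ⟩
        fromℕ L + fromℕ levels * N
          ≡⟨ trans (+-comm _ _) (cong (λ q → fromℕ q * N + fromℕ L) levels≡4p) ⟩
        fromℕ (4 ℕ.* p) * N + fromℕ L ∎)
      where
      open ≤-Reasoning
      open Coupling 𝓡 (nodes≢[] 𝓡) (relabel V-finite base) indices (λ k → relabel V-finite (variant k)) (fromℕ levels)
        using (∑success≤)
      P : Index → ℕ → ℝ
      P k = outputProbability 𝓡 B (graph k) t (λ x → ⌊ accurate? x k ⌋)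
      common = commonCutoff indices {y} P
        (λ k i≤j → Payoff.payoff-mono 𝓡 B (graph k) (nodes≢[] 𝓡) ≤-refl (λ x → []-nonneg (accurate? x k)) i≤j (t ∷ []) _)
        (λ k → estimates (graph k) t y<1/p)
      j = proj₁ common
      N = expectedQueries 𝓡 B baseGraph t j
      one : fromℕ L ≡ y * fromℕ (p ℕ.+ p) * fromℕ L
      one = sym (trans (cong (_* fromℕ L) (*-inverseˡ (fromℕ-pos {p ℕ.+ p} 1≤2p))) (*-identityˡ _))
      four : fromℕ (p ℕ.+ p) + fromℕ (p ℕ.+ p) ≡ fromℕ levels
      four = trans (sym (fromℕ-+ (p ℕ.+ p) (p ℕ.+ p))) (cong fromℕ (trans (ℕ.+-assoc p p (p ℕ.+ p))
        (trans (cong (λ z → p ℕ.+ (p ℕ.+ (p ℕ.+ z))) (sym (ℕ.+-identityʳ p))) (sym levels≡4p))))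

-- Nodes, edges and out-degrees of the base graph

module BaseGraphSize (shape : Shape) where
  open Shape shape
  open Construction shape
  open ListSum ℕ._+_ 0 ℕ.+-assoc ℕ.+-identityˡ
  open ℕ.≤-Reasoning

  ∑-≤ : ∀ {A : Set} (xs : List A) (f : A → ℕ) b → (∀ x → f x ℕ.≤ b) → ∑ xs f ℕ.≤ length xs ℕ.* b
  ∑-≤ []       f b p = z≤n
  ∑-≤ (x ∷ xs) f b p = ℕ.+-mono-≤ (p x) (∑-≤ xs f b p)

  ∑-const : ∀ {A : Set} (xs : List A) b → ∑ xs (λ _ → b) ≡ length xs ℕ.* b
  ∑-const []       b = refl
  ∑-const (x ∷ xs) b = cong (b ℕ.+_) (∑-const xs b)

  ∑-allFin-≤ : ∀ n (f : Fin n → ℕ) b → (∀ x → f x ℕ.≤ b) → ∑ (allFin n) f ℕ.≤ n ℕ.* b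
  ∑-allFin-≤ n f b p = subst (λ k → ∑ (allFin n) f ℕ.≤ k ℕ.* b) (List.length-tabulate {n = n} id) (∑-≤ (allFin n) f b p)

  size-loop : Finite.size loop-finite ≡ width ℕ.+ (width ℕ.+ (dums ℕ.+ extras))
  size-loop = trans (size-⊎ (Fin-finite width) G₂) (cong₂ ℕ._+_ (List.length-tabulate {n = width} id)
    (trans (size-⊎ (Fin-finite width) G₁) (cong₂ ℕ._+_ (List.length-tabulate {n = width} id)
    (trans (size-⊎ (Fin-finite dums) (Fin-finite extras)) (cong₂ ℕ._+_ (List.length-tabulate {n = dums} id) (List.length-tabulate {n = extras} id))))))
    where
    G₁ = Fin-finite dums ⊎-finite Fin-finite extras
    G₂ = Fin-finite width ⊎-finite G₁

  -- With s = h = q = 1 it bounds the number of nodes, and with these three set to out-degrees the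
  -- number of edges.
  ∑-elements-≤ : ∀ (f : V → ℕ) ℓ s h q → (∀ i → leaves i ℕ.≤ ℓ) →
    f tgt ℕ.≤ 1 → (∀ i → f (mid i) ℕ.≤ 1) → (∀ j → f (src j) ℕ.≤ s) → (∀ i g → f (hub i g) ℕ.≤ h) →
    (∀ i g x → f (leaf i g x) ℕ.≤ 1) → (∀ x → f (pad x) ℕ.≤ q) → (∀ l → f (loop l) ℕ.≤ 1) →
    ∑ elements f ℕ.≤ 1 ℕ.+ (mids ℕ.+ (srcs ℕ.* s ℕ.+ (levels ℕ.* (groups ℕ.* h) ℕ.+
      (levels ℕ.* (groups ℕ.* ℓ) ℕ.+ (pads ℕ.* q ℕ.+ (width ℕ.+ (width ℕ.+ (dums ℕ.+ extras))))))))
  ∑-elements-≤ f ℓ s h q leaves≤ t≤ m≤ s≤ h≤ l≤ p≤ o≤ = begin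
    ∑ elements f
      ≡⟨ ∑-V ℕ._+_ 0 ℕ.+-assoc ℕ.+-identityˡ f ⟩
    _ ≤⟨ ℕ.+-mono-≤ (ℕ.≤-trans (ℕ.≤-reflexive (ℕ.+-identityʳ (f tgt))) t≤)
        (ℕ.+-mono-≤ (subst (∑ (allFin mids) (λ i → f (mid i)) ℕ.≤_) (ℕ.*-identityʳ mids) (∑-allFin-≤ mids _ 1 m≤))
        (ℕ.+-mono-≤ (∑-allFin-≤ srcs _ s s≤)
        (ℕ.+-mono-≤ (∑-allFin-≤ levels (λ i → ∑ (allFin groups) (λ g → f (hub i g))) (groups ℕ.* h) (λ i → ∑-allFin-≤ groups (λ g → f (hub i g)) h (h≤ i)))
        (ℕ.+-mono-≤ (∑-allFin-≤ levels (λ i → ∑ (allFin groups) (λ g → ∑ (allFin (leaves i)) (λ x → f (leaf i g x)))) (groups ℕ.* ℓ) (λ i → ∑-allFin-≤ groups (λ g → ∑ (allFin (leaves i)) (λ x → f (leaf i g x))) ℓ (λ g →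
                       ℕ.≤-trans (∑-allFin-≤ (leaves i) (λ x → f (leaf i g x)) 1 (l≤ i g)) (ℕ.≤-trans (ℕ.≤-reflexive (ℕ.*-identityʳ (leaves i))) (leaves≤ i)))))
        (ℕ.+-mono-≤ (∑-allFin-≤ pads _ q p≤) loops))))) ⟩
    _ ∎
    where
    loops : ∑ (Finite.elements loop-finite) (λ l → f (loop l)) ℕ.≤ width ℕ.+ (width ℕ.+ (dums ℕ.+ extras))
    loops = ℕ.≤-trans (∑-≤ (Finite.elements loop-finite) (λ l → f (loop l)) 1 o≤)
      (ℕ.≤-reflexive (trans (ℕ.*-identityʳ _) size-loop))

  order≡∑ : order ≡ ∑ elements (λ _ → 1)
  order≡∑ = sym (trans (∑-const elements 1) (ℕ.*-identityʳ _))

  edges≡∑ : Graph.edges baseGraph ≡ ∑ elements (length ∘ children)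
  edges≡∑ = trans (sum-map (allFin order)) (trans (sym (∑-map from (allFin order) (length ∘ children)))
    (cong (λ xs → ∑ xs (length ∘ children)) (Finite.map-from-allFin V-finite)))
    where
    sum-map : ∀ us → sumℕ (map (Graph.outdeg baseGraph) us) ≡ ∑ us (λ u → length (children (from u)))
    sum-map []       = refl
    sum-map (u ∷ us) = cong₂ ℕ._+_ (List.length-map to (children (from u))) (sum-map us)

  private
    summand₆ : ∀ a b c d e f g → f ℕ.≤ a ℕ.+ (b ℕ.+ (c ℕ.+ (d ℕ.+ (e ℕ.+ (f ℕ.+ g)))))
    summand₆ a b c d e f g = ℕ.m≤n⇒m≤o+n a (ℕ.m≤n⇒m≤o+n b (ℕ.m≤n⇒m≤o+n c (ℕ.m≤n⇒m≤o+n d (ℕ.m≤n⇒m≤o+n e (ℕ.m≤m+n f g)))))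

    summand₇ : ∀ a b c d e f g → g ℕ.≤ a ℕ.+ (b ℕ.+ (c ℕ.+ (d ℕ.+ (e ℕ.+ (f ℕ.+ g)))))
    summand₇ a b c d e f g = ℕ.m≤n⇒m≤o+n a (ℕ.m≤n⇒m≤o+n b (ℕ.m≤n⇒m≤o+n c (ℕ.m≤n⇒m≤o+n d (ℕ.m≤n⇒m≤o+n e (ℕ.m≤n+m g f)))))

  module _ (f : V → ℕ) where
    private
      T = f tgt ℕ.+ 0
      M = ∑ (allFin mids) (λ i → f (mid i))
      S = ∑ (allFin srcs) (λ j → f (src j))
      H = ∑ (allFin levels) (λ i → ∑ (allFin groups) (λ g → f (hub i g)))
      L = ∑ (allFin levels) (λ i → ∑ (allFin groups) (λ g → ∑ (allFin (leaves i)) (λ x → f (leaf i g x))))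
      P = ∑ (allFin pads) (λ q → f (pad q))
      O = ∑ (Finite.elements loop-finite) (λ l → f (loop l))

    ∑-pads≤ : P ℕ.≤ ∑ elements f
    ∑-pads≤ = subst (P ℕ.≤_) (sym (∑-V ℕ._+_ 0 ℕ.+-assoc ℕ.+-identityˡ f)) (summand₆ T M S H L P O)

    ∑-loops≤ : O ℕ.≤ ∑ elements f
    ∑-loops≤ = subst (O ℕ.≤_) (sym (∑-V ℕ._+_ 0 ℕ.+-assoc ℕ.+-identityˡ f)) (summand₇ T M S H L P O)

  extras≤order : extras ℕ.≤ order
  extras≤order = begin
    extras                                    ≤⟨ ℕ.m≤n⇒m≤o+n width (ℕ.m≤n⇒m≤o+n width (ℕ.m≤n+m extras dums)) ⟩
    width ℕ.+ (width ℕ.+ (dums ℕ.+ extras))   ≡⟨ size-loop ⟨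
    Finite.size loop-finite                   ≡⟨ trans (∑-const (Finite.elements loop-finite) 1) (ℕ.*-identityʳ _) ⟨
    ∑ (Finite.elements loop-finite) (λ _ → 1) ≤⟨ ∑-loops≤ (λ _ → 1) ⟩
    ∑ elements (λ _ → 1)                      ≡⟨ order≡∑ ⟨
    order                                     ∎

  outdeg-src : ∀ j → length (children (src j)) ≡ mids ℕ.+ width
  outdeg-src j = trans (List.length-++ (map (λ i → mid i) (allFin mids))) (cong₂ ℕ._+_
    (trans (List.length-map _ (allFin mids)) (List.length-tabulate {n = mids} id))
    (trans (List.length-map _ (allFin width)) (List.length-tabulate {n = width} id)))

  outdeg-hub : ∀ i g → length (children (hub i g)) ≡ width
  outdeg-hub i g = trans (List.length-map _ (allFin width)) (List.length-tabulate {n = width} id)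

  outdeg-pad : ∀ q → length (children (pad q)) ≡ dums
  outdeg-pad q = trans (List.length-map _ (allFin dums)) (List.length-tabulate {n = dums} id)

  orderBound edgesBound : ℕ → ℕ
  orderBound ℓ = 1 ℕ.+ (mids ℕ.+ (srcs ℕ.* 1 ℕ.+ (levels ℕ.* (groups ℕ.* 1) ℕ.+
      (levels ℕ.* (groups ℕ.* ℓ) ℕ.+ (pads ℕ.* 1 ℕ.+ (width ℕ.+ (width ℕ.+ (dums ℕ.+ extras))))))))
  edgesBound ℓ = 1 ℕ.+ (mids ℕ.+ (srcs ℕ.* (mids ℕ.+ width) ℕ.+ (levels ℕ.* (groups ℕ.* width) ℕ.+
      (levels ℕ.* (groups ℕ.* ℓ) ℕ.+ (pads ℕ.* dums ℕ.+ (width ℕ.+ (width ℕ.+ (dums ℕ.+ extras))))))))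

  order≤ : ∀ ℓ → (∀ i → leaves i ℕ.≤ ℓ) → order ℕ.≤ orderBound ℓ
  order≤ ℓ leaves≤ = subst (ℕ._≤ orderBound ℓ) (sym order≡∑) (∑-elements-≤ (λ _ → 1) ℓ 1 1 1 leaves≤
    ℕ.≤-refl (λ _ → ℕ.≤-refl) (λ _ → ℕ.≤-refl) (λ _ _ → ℕ.≤-refl) (λ _ _ _ → ℕ.≤-refl) (λ _ → ℕ.≤-refl) (λ _ → ℕ.≤-refl))

  edges≤ : ∀ ℓ → (∀ i → leaves i ℕ.≤ ℓ) → Graph.edges baseGraph ℕ.≤ edgesBound ℓ
  edges≤ ℓ leaves≤ = subst (ℕ._≤ edgesBound ℓ) (sym edges≡∑) (∑-elements-≤ (length ∘ children) ℓ (mids ℕ.+ width) width dums leaves≤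
    ℕ.≤-refl (λ _ → ℕ.≤-refl) (λ j → ℕ.≤-reflexive (outdeg-src j)) (λ i g → ℕ.≤-reflexive (outdeg-hub i g))
    (λ _ _ _ → ℕ.≤-refl) (λ q → ℕ.≤-reflexive (outdeg-pad q)) (λ _ → ℕ.≤-refl))

  pads*dums≤edges : pads ℕ.* dums ℕ.≤ Graph.edges baseGraph
  pads*dums≤edges = begin
    pads ℕ.* dums ≡⟨ trans (∑-const (allFin pads) dums) (cong (ℕ._* dums) (List.length-tabulate {n = pads} id)) ⟨
    ∑ (allFin pads) (λ _ → dums) ≡⟨ ∑-cong (λ q → sym (outdeg-pad q)) (allFin pads) ⟩
    ∑ (allFin pads) (λ q → length (children (pad q))) ≤⟨ ∑-pads≤ (length ∘ children) ⟩
    ∑ elements (length ∘ children) ≡⟨ edges≡∑ ⟨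
    Graph.edges baseGraph ∎
    where
    ∑-cong : ∀ {A : Set} {f g : A → ℕ} → (∀ x → f x ≡ g x) → ∀ xs → ∑ xs f ≡ ∑ xs g
    ∑-cong e []       = refl
    ∑-cong e (x ∷ xs) = cong₂ ℕ._+_ (e x) (∑-cong e xs)

  maxOutdeg≤ : ∀ b → 1 ℕ.≤ b → mids ℕ.+ width ℕ.≤ b → dums ℕ.≤ b → Graph.maxOutdeg baseGraph ℕ.≤ b
  maxOutdeg≤ b 1≤b m+w≤b d≤b = max≤v⁺ {xs = map (Graph.outdeg baseGraph) (allFin order)} z≤n (All.map⁺ (All.tabulate λ {u} _ →
    subst (ℕ._≤ b) (sym (List.length-map to (children (from u)))) (bound (from u))))
    where
    bound : ∀ u → length (children u) ℕ.≤ b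
    bound tgt          = 1≤b
    bound (mid _)      = 1≤b
    bound (src j)      = ℕ.≤-trans (ℕ.≤-reflexive (outdeg-src j)) m+w≤b
    bound (hub i g)    = ℕ.≤-trans (ℕ.≤-reflexive (outdeg-hub i g)) (ℕ.≤-trans (ℕ.m≤n+m width mids) m+w≤b)
    bound (leaf _ _ _) = 1≤b
    bound (pad q)      = ℕ.≤-trans (ℕ.≤-reflexive (outdeg-pad q)) d≤b
    bound (loop _)     = 1≤b

  dums≤maxOutdeg : Fin pads → dums ℕ.≤ Graph.maxOutdeg baseGraph
  dums≤maxOutdeg q = ℕ.≤-trans
    (ℕ.≤-reflexive (sym (trans (List.length-map to (children (from (to (pad q)))))
      (trans (cong (length ∘ children) (from-to (pad q))) (outdeg-pad q)))))
    (All.lookup (xs≤max 0 (map (Graph.outdeg baseGraph) (allFin order))) (∈-map⁺ (Graph.outdeg baseGraph) (∈-allFin (to (pad q)))))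

-- Choice of the parameters

module IntegerParameters where
  open import Data.Nat.Base
  open import Data.Nat.Properties
  open import Data.Nat.Solver using (module +-*-Solver)

  -- The rounded-down inverse of an increasing function; it provides the integer square roots, the
  -- quotient M / D, and the largest S with S² d at most κ n.
  bracket : (f : ℕ → ℕ) → f 0 ≡ 0 → (∀ s → f s < f (suc s)) → ∀ x → ∃ λ s → f s ≤ x × x < f (suc s)
  bracket f f0≡0 f< zero = 0 , ≤-reflexive f0≡0 , ≤-<-trans z≤n (f< 0)
  bracket f f0≡0 f< (suc x) with bracket f f0≡0 f< x
  ... | s , fs≤x , x<fs+ with f (suc s) ≤? suc x
  ...   | yes p = suc s , p , ≤-<-trans x<fs+ (f< (suc s))
  ...   | no ¬p = s , m≤n⇒m≤1+n fs≤x , ≰⇒> ¬p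

  square-< : ∀ s → s * s < suc s * suc s
  square-< s = *-mono-< (n<1+n s) (n<1+n s)

  -- The S d slots become the edges of a complete bipartite graph between W sources and A mids, with
  -- A the smaller of S and d. `A≤S` limits what the mids contribute to π(t), `A≤d` the out-degree
  -- of a source, and `W≤S+d` the number of edges leaving the sources.
  record Pairing (S d : ℕ) : Set where
    field
      A W       : ℕ
      W*A≡S*d   : W * A ≡ S * d
      A≤S       : A ≤ S
      A≤d       : A ≤ d
      W≤S+d     : W ≤ S + d
      srcOf     : Fin S × Fin d → Fin W
      midOf     : Fin S × Fin d → Fin A
      slotAt    : Fin W → Fin A → Fin S × Fin d
      slotAt-inverse : ∀ l → slotAt (srcOf l) (midOf l) ≡ l

  pairing : ∀ S d → Pairing S d
  pairing S d with ≤-total S d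
  ... | inj₁ S≤d = record
    { A = S ; W = d ; W*A≡S*d = *-comm d S ; A≤S = ≤-refl ; A≤d = S≤d ; W≤S+d = m≤n+m d S
    ; srcOf = proj₂ ; midOf = proj₁ ; slotAt = λ j i → i , j ; slotAt-inverse = λ _ → refl }
  ... | inj₂ d≤S = record
    { A = d ; W = S ; W*A≡S*d = refl ; A≤S = d≤S ; A≤d = ≤-refl ; W≤S+d = m≤m+n S d
    ; srcOf = proj₁ ; midOf = proj₂ ; slotAt = λ j i → j , i ; slotAt-inverse = λ _ → refl }

  -- The coefficient of n once every parameter is bounded by a multiple of n. The last summand
  -- counts the leaves on all r levels.
  sizeFactor : ℕ → ℕ → ℕ → ℕ
  sizeFactor κ Γ r = 3 + 7 * κ + r * κ + r * (Γ ^ r * (4 * κ))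

  module Parameters (n D M κ Γ r : ℕ) (1≤n : 1 ≤ n) (1≤D : 1 ≤ D) (1≤Γ : 1 ≤ Γ)
                    (D≤κn : D ≤ κ * n) (n≤κM : n ≤ κ * M) (M≤κnD : M ≤ κ * n * D) where

    private
      1≤M : 1 ≤ M
      1≤M = n≢0⇒n>0 λ M≡0 →
        <⇒≱ 1≤n (≤-trans n≤κM (≤-reflexive (trans (cong (κ *_) M≡0) (*-zeroʳ κ))))

      R′ = bracket (λ s → s * s) refl square-< M

    R : ℕ
    R = proj₁ R′

    R²≤M : R * R ≤ M
    R²≤M = proj₁ (proj₂ R′)

    M<[1+R]² : M < suc R * suc R
    M<[1+R]² = proj₂ (proj₂ R′)

    1≤R : 1 ≤ R
    1≤R with R | M<[1+R]²
    ... | suc _ | _ = s≤s z≤n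
    ... | zero  | q = contradiction q (≤⇒≯ 1≤M)

    d : ℕ
    d = D ⊓ R

    d≤D : d ≤ D
    d≤D = m⊓n≤m D R

    1≤d : 1 ≤ d
    1≤d = ⊓-glb 1≤D 1≤R

    d²≤M : d * d ≤ M
    d²≤M = ≤-trans (*-mono-≤ (m⊓n≤n D R) (m⊓n≤n D R)) R²≤M

    private
      -- The target is κ n rather than n because d may exceed n; it satisfies d ≤ D ≤ κ n, and this
      -- makes S at least 1.
      S′ = bracket (λ s → s * s * d) refl (λ s → *-monoˡ-< d ⦃ >-nonZero 1≤d ⦄ (square-< s)) (κ * n)
      Q′ = bracket (_* D) refl (λ s → *-monoˡ-< D ⦃ >-nonZero 1≤D ⦄ (n<1+n s)) M

    S Q : ℕ
    S = proj₁ S′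
    -- Rounded up, so that the pads supply M edges and at least one pad exists to attain out-degree
    -- D even when M < D.
    Q = suc (proj₁ Q′)

    S²d≤κn : S * S * d ≤ κ * n
    S²d≤κn = proj₁ (proj₂ S′)

    κn<[1+S]²d : κ * n < suc S * suc S * d
    κn<[1+S]²d = proj₂ (proj₂ S′)

    1≤S : 1 ≤ S
    1≤S with S | κn<[1+S]²d
    ... | suc _ | _ = s≤s z≤n
    ... | zero  | q = contradiction (≤-trans d≤D D≤κn) (<⇒≱ (≤-trans q (≤-reflexive (+-identityʳ d))))

    M≤QD : M ≤ Q * D
    M≤QD = <⇒≤ (proj₂ (proj₂ Q′))

    QD≤D+M : Q * D ≤ D + M
    QD≤D+M = +-monoʳ-≤ D (proj₁ (proj₂ Q′))

    -- Here m ∈ O(nΔ) enters: M edges fit on O(n) pads of out-degree D.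
    Q≤1+κn : Q ≤ 1 + κ * n
    Q≤1+κn = *-cancelʳ-≤ Q (1 + κ * n) D ⦃ >-nonZero 1≤D ⦄ (≤-trans QD≤D+M (+-monoʳ-≤ D M≤κnD))

    Sd≤κn : S * d ≤ κ * n
    Sd≤κn = ≤-trans (*-monoˡ-≤ d (m≤m*n S S ⦃ >-nonZero 1≤S ⦄)) S²d≤κn

    d≤κn : d ≤ κ * n
    d≤κn = ≤-trans d≤D D≤κn

    S≤κn : S ≤ κ * n
    S≤κn = ≤-trans (m≤m*n S d ⦃ >-nonZero 1≤d ⦄) Sd≤κn

    open Pairing (pairing S d)

    -- The 4 pays for the four terms of `few`, each at most S d, already on level 0; the powers of Γ
    -- separate the levels.
    leafCount : ℕ → ℕ
    leafCount i = Γ ^ i * (4 * (S * d))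

    shape : Shape
    shape = record
      { levels = r ; groups = S ; width = d ; mids = A ; srcs = W ; dums = D ; pads = Q ; extras = n
      ; leaves = λ i → leafCount (toℕ i)
      ; 1≤width = 1≤d ; 1≤dums = 1≤D
      ; srcOf = srcOf ; midOf = midOf ; slotAt = slotAt ; slotAt-inverse = slotAt-inverse
      }

    open Shape shape using (leaves)
    open Construction shape using (order; baseGraph)
    open BaseGraphSize shape

    private
      instance
        Γ≢0 : NonZero Γ
        Γ≢0 = >-nonZero 1≤Γ

    growth : ∀ {i j : Fin r} → i Fin.< j → Γ * leaves i ≤ leaves j
    growth {i} {j} i<j = ≤-trans (≤-reflexive (sym (*-assoc Γ (Γ ^ toℕ i) _)))
      (*-monoˡ-≤ (4 * (S * d)) (^-monoʳ-≤ Γ {suc (toℕ i)} {toℕ j} i<j))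

    few : ∀ i → d + A * d + W * A + 1 ≤ leaves i
    few i = begin
      d + A * d + W * A + 1
        ≤⟨ +-mono-≤ (+-mono-≤ (+-mono-≤ (m≤n*m d S ⦃ >-nonZero 1≤S ⦄) (*-monoˡ-≤ d A≤S)) (≤-reflexive W*A≡S*d)) (*-mono-≤ 1≤S 1≤d) ⟩
      S * d + S * d + S * d + S * d
        ≡⟨ solve 1 (λ x → x :+ x :+ x :+ x := con 4 :* x) refl (S * d) ⟩
      4 * (S * d)
        ≤⟨ m≤n*m (4 * (S * d)) (Γ ^ toℕ i) ⦃ m^n≢0 Γ (toℕ i) ⦄ ⟩
      leaves i ∎
      where
      open ≤-Reasoning
      open +-*-Solver

    private
      leaves≤ : ∀ i → leaves i ≤ leafCount r
      leaves≤ i = *-monoˡ-≤ (4 * (S * d)) (^-monoʳ-≤ Γ (<⇒≤ (Fin.toℕ<n i)))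

      allLeaves≤ : r * (S * leafCount r) ≤ r * (Γ ^ r * (4 * κ)) * n
      allLeaves≤ = begin
        r * (S * (Γ ^ r * (4 * (S * d))))
          ≡⟨ solve 4 (λ r S g d → r :* (S :* (g :* (con 4 :* (S :* d)))) := r :* (g :* (con 4 :* (S :* S :* d)))) refl r S (Γ ^ r) d ⟩
        r * (Γ ^ r * (4 * (S * S * d)))
          ≤⟨ *-monoʳ-≤ r (*-monoʳ-≤ (Γ ^ r) (*-monoʳ-≤ 4 S²d≤κn)) ⟩
        r * (Γ ^ r * (4 * (κ * n)))
          ≡⟨ solve 4 (λ r g k n → r :* (g :* (con 4 :* (k :* n))) := r :* (g :* (con 4 :* k)) :* n) refl r (Γ ^ r) κ n ⟩
        r * (Γ ^ r * (4 * κ)) * n ∎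
        where
        open ≤-Reasoning
        open +-*-Solver

      E : ℕ
      E = r * (Γ ^ r * (4 * κ)) * n

    n≤order : n ≤ order
    n≤order = extras≤order

    order≤K*n : order ≤ sizeFactor κ Γ r * n
    order≤K*n = begin
      order
        ≤⟨ order≤ (leafCount r) leaves≤ ⟩
      1 + (A + (W * 1 + (r * (S * 1) + (r * (S * leafCount r) + (Q * 1 + (d + (d + (D + n))))))))
        ≤⟨ +-mono-≤ 1≤n (+-mono-≤ (≤-trans A≤S S≤κn)
           (+-mono-≤ (≤-trans (≤-reflexive (*-identityʳ W)) (≤-trans W≤S+d (+-mono-≤ S≤κn d≤κn)))
           (+-mono-≤ (*-monoʳ-≤ r (≤-trans (≤-reflexive (*-identityʳ S)) S≤κn))
           (+-mono-≤ allLeaves≤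
           (+-mono-≤ (≤-trans (≤-reflexive (*-identityʳ Q)) (≤-trans Q≤1+κn (+-monoˡ-≤ (κ * n) 1≤n)))
           (+-mono-≤ d≤κn (+-mono-≤ d≤κn (+-monoˡ-≤ n D≤κn)))))))) ⟩
      n + (κ * n + ((κ * n + κ * n) + (r * (κ * n) + (E + ((n + κ * n) + (κ * n + (κ * n + (κ * n + n))))))))
        ≡⟨ solve 4 (λ n k r x → n :+ (k :* n :+ ((k :* n :+ k :* n) :+ (r :* (k :* n) :+ (x :* n :+ ((n :+ k :* n) :+ (k :* n :+ (k :* n :+ (k :* n :+ n)))))))) :=
                                (con 3 :+ con 7 :* k :+ r :* k :+ x) :* n) refl n κ r (r * (Γ ^ r * (4 * κ))) ⟩
      sizeFactor κ Γ r * n ∎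
      where
      open ≤-Reasoning
      open +-*-Solver

    M≤edges : M ≤ Graph.edges baseGraph
    M≤edges = ≤-trans M≤QD pads*dums≤edges

    edges≤K*M : Graph.edges baseGraph ≤ (sizeFactor κ Γ r * κ + 2) * M
    edges≤K*M = begin
      Graph.edges baseGraph
        ≤⟨ edges≤ (leafCount r) leaves≤ ⟩
      1 + (A + (W * (A + d) + (r * (S * d) + (r * (S * leafCount r) + (Q * D + (d + (d + (D + n))))))))
        ≤⟨ +-mono-≤ 1≤n (+-mono-≤ (≤-trans A≤S S≤κn)
           (+-mono-≤ srcEdges (+-mono-≤ (*-monoʳ-≤ r Sd≤κn) (+-mono-≤ allLeaves≤
           -- Bounding the last n by n + n is deliberate slack: it makes the coefficient of n equal
           -- to `sizeFactor` again.
           (+-mono-≤ (≤-trans QD≤D+M (+-monoˡ-≤ M D≤κn)) (+-mono-≤ d≤κn (+-mono-≤ d≤κn (+-mono-≤ D≤κn (m≤m+n n n))))))))) ⟩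
      n + (κ * n + ((κ * n + (κ * n + M)) + (r * (κ * n) + (E + ((κ * n + M) + (κ * n + (κ * n + (κ * n + (n + n)))))))))
        ≡⟨ solve 5 (λ n k r x m → n :+ (k :* n :+ ((k :* n :+ (k :* n :+ m)) :+ (r :* (k :* n) :+ (x :* n :+ ((k :* n :+ m) :+ (k :* n :+ (k :* n :+ (k :* n :+ (n :+ n))))))))) :=
                                (con 3 :+ con 7 :* k :+ r :* k :+ x) :* n :+ con 2 :* m) refl n κ r (r * (Γ ^ r * (4 * κ))) M ⟩
      sizeFactor κ Γ r * n + 2 * M
        ≤⟨ +-monoˡ-≤ (2 * M) (*-monoʳ-≤ (sizeFactor κ Γ r) n≤κM) ⟩
      sizeFactor κ Γ r * (κ * M) + 2 * M
        ≡⟨ solve 3 (λ x k m → x :* (k :* m) :+ con 2 :* m := (x :* k :+ con 2) :* m) refl (sizeFactor κ Γ r) κ M ⟩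
      (sizeFactor κ Γ r * κ + 2) * M ∎
      where
      open ≤-Reasoning
      open +-*-Solver
      srcEdges : W * (A + d) ≤ κ * n + (κ * n + M)
      srcEdges = begin
        W * (A + d)             ≡⟨ *-distribˡ-+ W A d ⟩
        W * A + W * d           ≤⟨ +-mono-≤ (≤-reflexive W*A≡S*d) (*-monoˡ-≤ d W≤S+d) ⟩
        S * d + (S + d) * d     ≡⟨ cong (S * d +_) (*-distribʳ-+ d S d) ⟩
        S * d + (S * d + d * d) ≤⟨ +-mono-≤ Sd≤κn (+-mono-≤ Sd≤κn d²≤M) ⟩
        κ * n + (κ * n + M)     ∎

    D≤maxOutdeg : D ≤ Graph.maxOutdeg baseGraph
    D≤maxOutdeg = dums≤maxOutdeg zero

    maxOutdeg≤2D : Graph.maxOutdeg baseGraph ≤ 2 * D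
    maxOutdeg≤2D = maxOutdeg≤ (2 * D) (≤-trans 1≤D (m≤m+n D _))
      (≤-trans (+-mono-≤ (≤-trans A≤d d≤D) d≤D) (≤-reflexive (cong (D +_) (sym (+-identityʳ D))))) (m≤m+n D _)

    -- e approximates √ d, and suc S * e approximates √ (κ * n).
    private
      e′ = bracket (λ s → s * s) refl square-< d

    e : ℕ
    e = suc (proj₁ e′)

    d<e² : d < e * e
    d<e² = proj₂ (proj₂ e′)

    e²≤4d : e * e ≤ 4 * d
    e²≤4d = begin
      e * e                   ≤⟨ *-mono-≤ e≤2s e≤2s ⟩
      (s + s) * (s + s)       ≡⟨ solve 1 (λ s → (s :+ s) :* (s :+ s) := con 4 :* (s :* s)) refl s ⟩
      4 * (s * s)             ≤⟨ *-monoʳ-≤ 4 (proj₁ (proj₂ e′)) ⟩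
      4 * d                   ∎
      where
      open ≤-Reasoning
      open +-*-Solver
      s = proj₁ e′
      1≤s : 1 ≤ s
      1≤s with s | d<e²
      ... | suc _ | _ = s≤s z≤n
      ... | zero  | q = contradiction q (≤⇒≯ 1≤d)
      e≤2s : e ≤ s + s
      e≤2s = +-monoˡ-≤ s 1≤s

    n≤[[1+S]e]² : 1 ≤ κ → n ≤ (suc S * e) * (suc S * e)
    n≤[[1+S]e]² 1≤κ = begin
      n                       ≤⟨ m≤n*m n κ ⦃ >-nonZero 1≤κ ⦄ ⟩
      κ * n                   ≤⟨ <⇒≤ κn<[1+S]²d ⟩
      suc S * suc S * d       ≤⟨ *-monoʳ-≤ (suc S * suc S) (<⇒≤ d<e²) ⟩
      suc S * suc S * (e * e) ≡⟨ solve 2 (λ s e → s :* s :* (e :* e) := (s :* e) :* (s :* e)) refl (suc S) e ⟩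
      (suc S * e) * (suc S * e) ∎
      where
      open ≤-Reasoning
      open +-*-Solver

    -- The two cases are whether D or R attains the minimum d. They show that e bounds √Δ or
    -- m^(1/4), hence the smaller of the two.
    D≤e²⊎M≤e⁴ : D ≤ e * e ⊎ M ≤ (e * e) * (e * e)
    D≤e²⊎M≤e⁴ with ⊓-sel D R
    ... | inj₁ d≡D = inj₁ (≤-trans (≤-reflexive (sym d≡D)) (<⇒≤ d<e²))
    ... | inj₂ d≡R = inj₂ (≤-trans (<⇒≤ M<[1+R]²) (*-mono-≤ R<e² R<e²))
      where
      R<e² : R < e * e
      R<e² = subst (_< e * e) d≡R d<e²

    -- The left side dominates √n times the minimum, and the right side is 8 times the number of
    -- slots. The 8 arises from 1 + S ≤ 2 S and e² ≤ 4 d.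
    scale≤ : suc S * e * e ≤ 8 * (S * d)
    scale≤ = begin
      suc S * e * e     ≡⟨ *-assoc (suc S) e e ⟩
      suc S * (e * e)   ≤⟨ *-mono-≤ (+-monoˡ-≤ S 1≤S) e²≤4d ⟩
      (S + S) * (4 * d) ≡⟨ solve 2 (λ s d → (s :+ s) :* (con 4 :* d) := con 8 :* (s :* d)) refl S d ⟩
      8 * (S * d)       ∎
      where
      open ≤-Reasoning
      open +-*-Solver

-- From real growth functions to integer parameters

open IntegerParameters

-- D and M are Δ and m rounded up. The single constant κ absorbs the constants of all four growth
-- conditions together with the rounding error, so that the construction of the graph is pure
-- integer arithmetic.
record Rounding (𝓡 : Reals) (κ n : ℕ) (Δ m : Reals.ℝ 𝓡) : Set where
  open Reals 𝓡
  field
    D M     : ℕ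
    1≤n     : 1 ℕ.≤ n
    1≤D     : 1 ℕ.≤ D
    0≤Δ     : 0# ≤ Δ
    0≤m     : 0# ≤ m
    Δ≤D     : Δ ≤ fromℕ D
    m≤M     : m ≤ fromℕ M
    D≤κΔ    : fromℕ D ≤ fromℕ κ * Δ
    M≤κm    : fromℕ M ≤ fromℕ κ * m
    D≤κn    : D ℕ.≤ κ ℕ.* n
    n≤κM    : n ℕ.≤ κ ℕ.* M
    M≤κnD   : M ℕ.≤ κ ℕ.* n ℕ.* D

module _ (𝓡 : Reals) where
  open Reals 𝓡
  open OrderedField 𝓡

  rounding : ∀ (Δ m : ℕ → ℝ) → Δ ∈Ω (λ _ → 1#) → Δ ∈O fromℕ → m ∈Ω fromℕ → m ∈O (λ n → fromℕ n * Δ n) →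
             ∃ λ κ → 1 ℕ.≤ κ × ∃ λ n₀ → ∀ n → n₀ ℕ.≤ n → Rounding 𝓡 κ n (Δ n) (m n)
  rounding Δ m (c₁ , 0<c₁ , n₁ , Δ≥) (c₂ , 0<c₂ , n₂ , Δ≤) (c₃ , 0<c₃ , n₃ , m≥) (c₄ , 0<c₄ , n₄ , m≤) =
    κ , ℕ.s≤s ℕ.z≤n , suc (n₁ ℕ.⊔ n₂ ℕ.⊔ (n₃ ℕ.⊔ n₄)) , λ n n₀≤n → let open AtSize n n₀≤n in record
      { D = D ; M = M ; 1≤n = 1≤n ; 1≤D = ℕ.s≤s ℕ.z≤n ; 0≤Δ = 0≤Δ ; 0≤m = 0≤m ; Δ≤D = Δ≤D ; m≤M = m≤M
      ; D≤κΔ = ≤-trans D≤u₁Δ (*-monoˡ-≤ 0≤Δ u₁≤κ) ; M≤κm = ≤-trans M≤u₃m (*-monoˡ-≤ 0≤m u₃≤κ)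
      ; D≤κn = D≤κn ; n≤κM = n≤κM ; M≤κnD = M≤κnD }
    where
    u₁ u₃ : ℝ
    -- Rounding up adds at most 1, and 1 ≤ Δ / c₁ because Δ is bounded below; so D is at most (1 +
    -- 1/c₁) Δ. Likewise 1 ≤ n ≤ m / c₃ yields `u₃`.
    u₁ = 1# + c₁ ⁻¹
    u₃ = 1# + c₃ ⁻¹

    0≤u₁ : 0# ≤ u₁
    0≤u₁ = +-nonneg 0≤1 (<⇒≤ (⁻¹-pos 0<c₁))

    0≤u₃ : 0# ≤ u₃
    0≤u₃ = +-nonneg 0≤1 (<⇒≤ (⁻¹-pos 0<c₃))

    κ₁ κ₂ κ₃ κ₄ κ : ℕ
    κ₁ = proj₁ (archimedean u₁)
    κ₂ = proj₁ (archimedean (u₁ * c₂))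
    κ₃ = proj₁ (archimedean u₃)
    κ₄ = proj₁ (archimedean (u₃ * c₄))
    κ = suc (κ₁ ℕ.⊔ κ₂ ℕ.⊔ (κ₃ ℕ.⊔ κ₄))

    u₁≤κ : u₁ ≤ fromℕ κ
    u₁≤κ = ≤-trans (proj₂ (archimedean u₁)) (fromℕ-mono-≤ {κ₁} {κ}
      (ℕ.m≤n⇒m≤1+n (ℕ.≤-trans (ℕ.m≤m⊔n κ₁ κ₂) (ℕ.m≤m⊔n (κ₁ ℕ.⊔ κ₂) (κ₃ ℕ.⊔ κ₄)))))

    u₁c₂≤κ : u₁ * c₂ ≤ fromℕ κ
    u₁c₂≤κ = ≤-trans (proj₂ (archimedean (u₁ * c₂))) (fromℕ-mono-≤ {κ₂} {κ}
      (ℕ.m≤n⇒m≤1+n (ℕ.≤-trans (ℕ.m≤n⊔m κ₁ κ₂) (ℕ.m≤m⊔n (κ₁ ℕ.⊔ κ₂) (κ₃ ℕ.⊔ κ₄)))))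

    u₃≤κ : u₃ ≤ fromℕ κ
    u₃≤κ = ≤-trans (proj₂ (archimedean u₃)) (fromℕ-mono-≤ {κ₃} {κ}
      (ℕ.m≤n⇒m≤1+n (ℕ.≤-trans (ℕ.m≤m⊔n κ₃ κ₄) (ℕ.m≤n⊔m (κ₁ ℕ.⊔ κ₂) (κ₃ ℕ.⊔ κ₄)))))

    u₃c₄≤κ : u₃ * c₄ ≤ fromℕ κ
    u₃c₄≤κ = ≤-trans (proj₂ (archimedean (u₃ * c₄))) (fromℕ-mono-≤ {κ₄} {κ}
      (ℕ.m≤n⇒m≤1+n (ℕ.≤-trans (ℕ.m≤n⊔m κ₃ κ₄) (ℕ.m≤n⊔m (κ₁ ℕ.⊔ κ₂) (κ₃ ℕ.⊔ κ₄)))))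

    module AtSize (n : ℕ) (n₀≤n : suc (n₁ ℕ.⊔ n₂ ℕ.⊔ (n₃ ℕ.⊔ n₄)) ℕ.≤ n) where

      below : ∀ {k} → k ℕ.≤ n₁ ℕ.⊔ n₂ ℕ.⊔ (n₃ ℕ.⊔ n₄) → k ℕ.≤ n
      below k≤ = ℕ.≤-trans (ℕ.m≤n⇒m≤1+n k≤) n₀≤n

      1≤n : 1 ℕ.≤ n
      1≤n = ℕ.≤-trans (ℕ.s≤s ℕ.z≤n) n₀≤n

      c₁≤Δ : c₁ * 1# ≤ Δ n
      c₁≤Δ = Δ≥ n (below (ℕ.≤-trans (ℕ.m≤m⊔n n₁ n₂) (ℕ.m≤m⊔n (n₁ ℕ.⊔ n₂) (n₃ ℕ.⊔ n₄))))
      Δ≤c₂n : Δ n ≤ c₂ * fromℕ n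
      Δ≤c₂n = Δ≤ n (below (ℕ.≤-trans (ℕ.m≤n⊔m n₁ n₂) (ℕ.m≤m⊔n (n₁ ℕ.⊔ n₂) (n₃ ℕ.⊔ n₄))))
      c₃n≤m : c₃ * fromℕ n ≤ m n
      c₃n≤m = m≥ n (below (ℕ.≤-trans (ℕ.m≤m⊔n n₃ n₄) (ℕ.m≤n⊔m (n₁ ℕ.⊔ n₂) (n₃ ℕ.⊔ n₄))))
      m≤c₄nΔ : m n ≤ c₄ * (fromℕ n * Δ n)
      m≤c₄nΔ = m≤ n (below (ℕ.≤-trans (ℕ.m≤n⊔m n₃ n₄) (ℕ.m≤n⊔m (n₁ ℕ.⊔ n₂) (n₃ ℕ.⊔ n₄))))

      0≤n : 0# ≤ fromℕ n
      0≤n = fromℕ-nonneg n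

      1≤c₁⁻¹Δ : 1# ≤ c₁ ⁻¹ * Δ n
      1≤c₁⁻¹Δ = subst (1# ≤_) (*-comm _ _) (x*z≤y⇒x≤y*z⁻¹ 0<c₁ (subst (_≤ Δ n) (*-comm _ _) c₁≤Δ))

      n≤c₃⁻¹m : fromℕ n ≤ c₃ ⁻¹ * m n
      n≤c₃⁻¹m = subst (fromℕ n ≤_) (*-comm _ _) (x*z≤y⇒x≤y*z⁻¹ 0<c₃ (subst (_≤ m n) (*-comm _ _) c₃n≤m))

      0≤Δ : 0# ≤ Δ n
      0≤Δ = ≤-trans (<⇒≤ (*-pos 0<c₁ 0<1)) c₁≤Δ

      0≤m : 0# ≤ m n
      0≤m = ≤-trans (*-nonneg (<⇒≤ 0<c₃) 0≤n) c₃n≤m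

      ⌊Δ⌋ = floor 0≤Δ
      ⌊m⌋ = floor 0≤m

      D M : ℕ
      D = suc (proj₁ ⌊Δ⌋)
      M = suc (proj₁ ⌊m⌋)

      Δ≤D : Δ n ≤ fromℕ D
      Δ≤D = <⇒≤ (proj₂ (proj₂ ⌊Δ⌋))

      m≤M : m n ≤ fromℕ M
      m≤M = <⇒≤ (proj₂ (proj₂ ⌊m⌋))

      [1+x]y : ∀ x y → x * y + y ≡ (1# + x) * y
      [1+x]y x y = trans (+-comm _ _) (trans (cong (_+ x * y) (sym (*-identityˡ y))) (sym (distribʳ y 1# x)))

      D≤u₁Δ : fromℕ D ≤ u₁ * Δ n
      D≤u₁Δ = ≤-trans (+-mono-≤ 1≤c₁⁻¹Δ (proj₁ (proj₂ ⌊Δ⌋))) (≤-reflexive ([1+x]y (c₁ ⁻¹) (Δ n)))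

      M≤u₃m : fromℕ M ≤ u₃ * m n
      M≤u₃m = ≤-trans (+-mono-≤ (≤-trans (≤-trans (≤-reflexive (sym fromℕ-1)) (fromℕ-mono-≤ {1} {n} 1≤n)) n≤c₃⁻¹m) (proj₁ (proj₂ ⌊m⌋)))
        (≤-reflexive ([1+x]y (c₃ ⁻¹) (m n)))

      D≤κn : D ℕ.≤ κ ℕ.* n
      D≤κn = fromℕ-cancel-≤ D (κ ℕ.* n) (begin
        fromℕ D              ≤⟨ D≤u₁Δ ⟩
        u₁ * Δ n             ≤⟨ *-monoʳ-≤ 0≤u₁ Δ≤c₂n ⟩
        u₁ * (c₂ * fromℕ n)  ≡⟨ *-assoc u₁ c₂ _ ⟨
        u₁ * c₂ * fromℕ n    ≤⟨ *-monoˡ-≤ 0≤n u₁c₂≤κ ⟩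
        fromℕ κ * fromℕ n    ≡⟨ fromℕ-* κ n ⟨
        fromℕ (κ ℕ.* n)      ∎)
        where open ≤-Reasoning

      n≤κM : n ℕ.≤ κ ℕ.* M
      n≤κM = fromℕ-cancel-≤ n (κ ℕ.* M) (begin
        fromℕ n              ≤⟨ n≤c₃⁻¹m ⟩
        c₃ ⁻¹ * m n          ≤⟨ *-mono-≤ 0≤m (fromℕ-nonneg κ) (≤-trans (y≤x+y 0≤1) u₃≤κ) m≤M ⟩
        fromℕ κ * fromℕ M    ≡⟨ fromℕ-* κ M ⟨
        fromℕ (κ ℕ.* M)      ∎)
        where open ≤-Reasoning

      M≤κnD : M ℕ.≤ κ ℕ.* n ℕ.* D
      M≤κnD = fromℕ-cancel-≤ M (κ ℕ.* n ℕ.* D) (begin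
        fromℕ M                       ≤⟨ M≤u₃m ⟩
        u₃ * m n                      ≤⟨ *-monoʳ-≤ 0≤u₃ m≤c₄nΔ ⟩
        u₃ * (c₄ * (fromℕ n * Δ n))   ≡⟨ solve 4 (λ a b c d → a :* (b :* (c :* d)) := a :* b :* c :* d) refl u₃ c₄ (fromℕ n) (Δ n) ⟩
        u₃ * c₄ * fromℕ n * Δ n       ≤⟨ *-mono-≤ 0≤Δ (*-nonneg (fromℕ-nonneg κ) 0≤n) (*-monoˡ-≤ 0≤n u₃c₄≤κ) Δ≤D ⟩
        fromℕ κ * fromℕ n * fromℕ D   ≡⟨ trans (fromℕ-* (κ ℕ.* n) D) (cong (_* fromℕ D) (fromℕ-* κ n)) ⟨
        fromℕ (κ ℕ.* n ℕ.* D)         ∎)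
        where open ≤-Reasoning

  separationFactor : ∀ {α} → 0# < α → α < 1# → ∀ γ → ∃ λ Γ → 1 ℕ.≤ Γ × (γ * γ) * fromℕ 2 < fromℕ Γ * (α * (1# - α) ^ 3)
  separationFactor {α} 0<α α<1 γ = suc k , ℕ.s≤s ℕ.z≤n , ≰⇒> λ Γβ≤ → <⇒≱ (fromℕ-mono-< {k} {suc k} ℕ.≤-refl)
    (≤-trans (x*z≤y⇒x≤y*z⁻¹ 0<β Γβ≤) (proj₂ bound))
    where
    β = α * (1# - α) ^ 3
    0<β : 0# < β
    0<β = *-pos 0<α (^-pos (0<y-x α<1) 3)
    bound : ∃ λ k → (γ * γ) * fromℕ 2 * β ⁻¹ ≤ fromℕ k
    bound = archimedean _
    k = proj₁ bound

  -- The constants of the final bounds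

  module HardGraph (κ Γ p : ℕ) (1≤κ : 1 ℕ.≤ κ) (1≤Γ : 1 ℕ.≤ Γ) (1≤p : 1 ℕ.≤ p) where

    r : ℕ
    r = 4 ℕ.* p

    1≤8r : 1 ℕ.≤ 8 ℕ.* r
    1≤8r = ℕ.*-mono-≤ {1} {8} (ℕ.s≤s ℕ.z≤n) (ℕ.*-mono-≤ {1} {4} (ℕ.s≤s ℕ.z≤n) 1≤p)

    0<8r : 0# < fromℕ (8 ℕ.* r)
    0<8r = fromℕ-pos {8 ℕ.* r} 1≤8r

    -- One constant for three upper bounds: nodes need K, edges (K κ + 2) κ, and the maximum
    -- out-degree 2 κ.
    K Cℕ : ℕ
    K = sizeFactor κ Γ r
    Cℕ = (K ℕ.* κ ℕ.+ 2) ℕ.* κ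

    2≤Kκ+2 : 2 ℕ.≤ K ℕ.* κ ℕ.+ 2
    2≤Kκ+2 = ℕ.m≤n+m 2 (K ℕ.* κ)

    1≤Cℕ : 1 ℕ.≤ Cℕ
    1≤Cℕ = ℕ.*-mono-≤ (ℕ.≤-trans (ℕ.n≤1+n 1) 2≤Kκ+2) 1≤κ

    c C : ℝ
    -- The 8 stems from `scale≤` and r = 4p from `queries`. Being at most 1, the same c also serves
    -- the lower bounds on the size of the graph.
    c = fromℕ (8 ℕ.* r) ⁻¹
    C = fromℕ Cℕ

    c≤1 : c ≤ 1#
    c≤1 = ≤-trans (≤-reflexive (sym (*-identityˡ c))) (x≤y*z⇒x*z⁻¹≤y 0<8r
      (≤-trans (≤-reflexive (sym fromℕ-1)) (≤-trans (fromℕ-mono-≤ {1} {8 ℕ.* r} 1≤8r)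
        (≤-reflexive (sym (*-identityˡ _))))))

    c*x≤ : ∀ {x y} → 0# ≤ x → x ≤ y → c * x ≤ y
    c*x≤ {x} 0≤x x≤y = ≤-trans (*-monoˡ-≤ 0≤x c≤1) (≤-trans (≤-reflexive (*-identityˡ x)) x≤y)

    module _ {n : ℕ} {Δ m : ℝ} (rounded : Rounding 𝓡 κ n Δ m) where
      open Rounding rounded
      open Parameters n D M κ Γ r 1≤n 1≤D 1≤Γ D≤κn n≤κM M≤κnD public using (shape)
      open Parameters n D M κ Γ r 1≤n 1≤D 1≤Γ D≤κn n≤κM M≤κnD hiding (shape)
      open Construction shape public using (baseGraph; to)
      open Graph baseGraph using (size; edges; maxOutdeg)

      private
        instance
          κ≢0 : ℕ.NonZero κ
          κ≢0 = ℕ.>-nonZero 1≤κ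

        K≤Cℕ : K ℕ.≤ Cℕ
        K≤Cℕ = ℕ.≤-trans (ℕ.m≤m*n K κ) (ℕ.≤-trans (ℕ.m≤m+n _ 2) (ℕ.m≤m*n _ κ))

      n≤size : c * fromℕ n ≤ fromℕ size
      n≤size = c*x≤ (fromℕ-nonneg n) (fromℕ-mono-≤ {n} {size} n≤order)

      size≤n : fromℕ size ≤ C * fromℕ n
      size≤n = ≤-trans (fromℕ-mono-≤ {size} {Cℕ ℕ.* n} (ℕ.≤-trans order≤K*n (ℕ.*-monoˡ-≤ n K≤Cℕ))) (≤-reflexive (fromℕ-* Cℕ n))

      m≤edges : c * m ≤ fromℕ edges
      m≤edges = c*x≤ 0≤m (≤-trans m≤M (fromℕ-mono-≤ {M} {edges} M≤edges))

      edges≤m : fromℕ edges ≤ C * m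
      edges≤m = begin
        fromℕ edges                                     ≤⟨ fromℕ-mono-≤ {edges} {(K ℕ.* κ ℕ.+ 2) ℕ.* M} edges≤K*M ⟩
        fromℕ ((K ℕ.* κ ℕ.+ 2) ℕ.* M)                   ≡⟨ fromℕ-* (K ℕ.* κ ℕ.+ 2) M ⟩
        fromℕ (K ℕ.* κ ℕ.+ 2) * fromℕ M                 ≤⟨ *-monoʳ-≤ (fromℕ-nonneg (K ℕ.* κ ℕ.+ 2)) M≤κm ⟩
        fromℕ (K ℕ.* κ ℕ.+ 2) * (fromℕ κ * m)         ≡⟨ *-assoc _ _ _ ⟨
        fromℕ (K ℕ.* κ ℕ.+ 2) * fromℕ κ * m           ≡⟨ cong (_* m) (fromℕ-* (K ℕ.* κ ℕ.+ 2) κ) ⟨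
        C * m                                         ∎
        where open ≤-Reasoning

      Δ≤maxOutdeg : c * Δ ≤ fromℕ maxOutdeg
      Δ≤maxOutdeg = c*x≤ 0≤Δ (≤-trans Δ≤D (fromℕ-mono-≤ {D} {maxOutdeg} D≤maxOutdeg))

      maxOutdeg≤Δ : fromℕ maxOutdeg ≤ C * Δ
      maxOutdeg≤Δ = begin
        fromℕ maxOutdeg           ≤⟨ fromℕ-mono-≤ {maxOutdeg} {2 ℕ.* D} maxOutdeg≤2D ⟩
        fromℕ (2 ℕ.* D)           ≡⟨ fromℕ-* 2 D ⟩
        fromℕ 2 * fromℕ D         ≤⟨ *-monoʳ-≤ (fromℕ-nonneg 2) D≤κΔ ⟩
        fromℕ 2 * (fromℕ κ * Δ) ≤⟨ *-monoˡ-≤ (*-nonneg (fromℕ-nonneg κ) 0≤Δ) (fromℕ-mono-≤ {2} {K ℕ.* κ ℕ.+ 2} 2≤Kκ+2) ⟩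
        fromℕ (K ℕ.* κ ℕ.+ 2) * (fromℕ κ * Δ) ≡⟨ *-assoc _ _ _ ⟨
        fromℕ (K ℕ.* κ ℕ.+ 2) * fromℕ κ * Δ   ≡⟨ cong (_* Δ) (fromℕ-* (K ℕ.* κ ℕ.+ 2) κ) ⟨
        C * Δ                   ∎
        where open ≤-Reasoning

      private
        module ⊓ = MinOp (Min.minOperator (DecTotalOrder.totalOrder decTotalOrder))

        √min≤e : √ Δ ⊓ √ (√ m) ≤ fromℕ e
        √min≤e with D≤e²⊎M≤e⁴
        ... | inj₁ D≤e² = ≤-trans (⊓.x⊓y≤x _ _) (proj₂ (√-bounds 0≤Δ (fromℕ-nonneg e)
              (≤-trans Δ≤D (≤-trans (fromℕ-mono-≤ {D} {e ℕ.* e} D≤e²) (≤-reflexive (fromℕ-* e e))))))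
        ... | inj₂ M≤e⁴ = ≤-trans (⊓.x⊓y≤y _ _) (proj₂ (√-bounds (proj₁ √m) (fromℕ-nonneg e)
              (≤-trans (proj₂ √m) (≤-reflexive (fromℕ-* e e)))))
          where
          √m : 0# ≤ √ m × √ m ≤ fromℕ (e ℕ.* e)
          √m = √-bounds 0≤m (fromℕ-nonneg (e ℕ.* e)) (≤-trans m≤M
            (≤-trans (fromℕ-mono-≤ {M} {(e ℕ.* e) ℕ.* (e ℕ.* e)} M≤e⁴) (≤-reflexive (fromℕ-* (e ℕ.* e) (e ℕ.* e)))))

        √n : 0# ≤ √ (fromℕ n) × √ (fromℕ n) ≤ fromℕ (suc S ℕ.* e)
        √n = √-bounds (fromℕ-nonneg n) (fromℕ-nonneg (suc S ℕ.* e))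
          (≤-trans (fromℕ-mono-≤ {n} {(suc S ℕ.* e) ℕ.* (suc S ℕ.* e)} (n≤[[1+S]e]² 1≤κ)) (≤-reflexive (fromℕ-* (suc S ℕ.* e) (suc S ℕ.* e))))

      bound : ∀ {α} → 0# < α → α < 1# → ∀ {γ} → 1# ≤ γ → (γ * γ) * fromℕ 2 < fromℕ Γ * (α * (1# - α) ^ 3) →
              (B : Algorithm 𝓡) → Estimates 𝓡 α γ (fromℕ p ⁻¹) B →
              c * (√ (fromℕ n) * (√ Δ ⊓ √ (√ m))) ≤⋁ expectedQueries 𝓡 B baseGraph (to tgt)
      -- A single cut-off already attains the whole bound, so the same j answers every smaller y.
      bound 0<α α<1 1≤γ Γ-large B estimates y<b = j , <-≤-trans y<b (begin
        c * X                       ≡⟨ *-comm c X ⟩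
        X * fromℕ (8 ℕ.* r) ⁻¹      ≤⟨ x≤y*z⇒x*z⁻¹≤y 0<8r (begin
          √ (fromℕ n) * (√ Δ ⊓ √ (√ m)) ≤⟨ *-monoʳ-≤ (proj₁ √n) √min≤e ⟩
          √ (fromℕ n) * fromℕ e                 ≤⟨ *-monoˡ-≤ (fromℕ-nonneg e) (proj₂ √n) ⟩
          fromℕ (suc S ℕ.* e) * fromℕ e         ≡⟨ fromℕ-* (suc S ℕ.* e) e ⟨
          fromℕ (suc S ℕ.* e ℕ.* e)             ≤⟨ fromℕ-mono-≤ {suc S ℕ.* e ℕ.* e} {8 ℕ.* (S ℕ.* d)} scale≤ ⟩
          fromℕ (8 ℕ.* (S ℕ.* d))               ≡⟨ fromℕ-* 8 (S ℕ.* d) ⟩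
          fromℕ 8 * fromℕ (S ℕ.* d)             ≤⟨ *-monoʳ-≤ (fromℕ-nonneg 8) (proj₂ enough) ⟩
          fromℕ 8 * (fromℕ r * N)               ≡⟨ *-assoc _ _ _ ⟨
          fromℕ 8 * fromℕ r * N                 ≡⟨ cong (_* N) (fromℕ-* 8 r) ⟨
          fromℕ (8 ℕ.* r) * N                   ≡⟨ *-comm _ N ⟩
          N * fromℕ (8 ℕ.* r)                   ∎) ⟩
        N                           ∎)
        where
        open ≤-Reasoning
        enough : ∃ λ j → fromℕ (S ℕ.* d) ≤ fromℕ r * expectedQueries 𝓡 B baseGraph (to tgt) j
        enough = QueryBound.queries 𝓡 shape 0<α α<1 1≤γ 1≤p refl Γ Γ-large growth few B estimates
        j = proj₁ enough
        N = expectedQueries 𝓡 B baseGraph (to tgt) j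
        X = √ (fromℕ n) * (√ Δ ⊓ √ (√ m))

theorem7p1 : (𝓡 : Reals) → let open Reals 𝓡 in
    (α : ℝ) → 0# < α → α < 1# →
    (p : ℕ) → 2 ℕ.≤ p →
    (Δ : ℕ → ℝ) → Δ ∈Ω (λ _ → 1#) → Δ ∈O fromℕ →
    (m : ℕ → ℝ) → m ∈Ω fromℕ → m ∈O (λ n → fromℕ n * Δ n) →
    (γ : ℝ) → 1# ≤ γ →
    ∃₂ λ c C → 0# < c × 0# < C ×
    ((B : Algorithm 𝓡) → Estimates 𝓡 α γ (fromℕ p ⁻¹) B →
    ∃ λ n₀ → ∀ n → n₀ ℕ.≤ n →
    ∃ λ H → let open Graph H in
    (c * fromℕ n ≤ fromℕ size      × fromℕ size      ≤ C * fromℕ n) ×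
    (c * m n     ≤ fromℕ edges     × fromℕ edges     ≤ C * m n) ×
    (c * Δ n     ≤ fromℕ maxOutdeg × fromℕ maxOutdeg ≤ C * Δ n) ×
    ∃ λ t →
    c * (√ (fromℕ n) * (√ (Δ n) ⊓ √ (√ (m n)))) ≤⋁ expectedQueries 𝓡 B H t)
theorem7p1 𝓡 α 0<α α<1 p 2≤p Δ Δ≥ Δ≤ m m≥ m≤ γ 1≤γ =
  assemble (rounding 𝓡 Δ m Δ≥ Δ≤ m≥ m≤) (separationFactor 𝓡 0<α α<1 γ)
  where
  open Reals 𝓡
  open OrderedField 𝓡
  1≤p = ℕ.≤-trans (ℕ.n≤1+n 1) 2≤p

  assemble : (∃ λ κ → 1 ℕ.≤ κ × ∃ λ n₀ → ∀ n → n₀ ℕ.≤ n → Rounding 𝓡 κ n (Δ n) (m n)) →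
             (∃ λ Γ → 1 ℕ.≤ Γ × (γ * γ) * fromℕ 2 < fromℕ Γ * (α * (1# - α) ^ 3)) → _
  assemble (κ , 1≤κ , n₀ , rounded) (Γ , 1≤Γ , Γ-large) =
    let open HardGraph 𝓡 κ Γ p 1≤κ 1≤Γ 1≤p in
    c , C , ⁻¹-pos 0<8r , fromℕ-pos {Cℕ} 1≤Cℕ , λ B estimates → n₀ , λ n n₀≤n →
      let R = rounded n n₀≤n in
      baseGraph R , (n≤size R , size≤n R) , (m≤edges R , edges≤m R) , (Δ≤maxOutdeg R , maxOutdeg≤Δ R) ,
      to R tgt , λ {_} → bound R 0<α α<1 1≤γ Γ-large B estimates
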